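{- Let $\mathcal{S}$ be a finite set of positive integers, and let $\mathcal{G}_{\mathcal{S}}$ denote the family of (finite, simple) planar graphs having no cycle whose length lies in $\mathcal{S}$. Then there exists a constant $C_{\mathcal{S}}$ such that $\chi(G^2)\le \Delta(G)+C_{\mathcal{S}}$ for all $G\in\mathcal{G}_{\mathcal{S}}$ if and only if $4\in\mathcal{S}$.
   Context: The square $G^2$ of a graph $G$ is the graph on $V(G)$ in which two distinct vertices are adjacent if and only if their distance in $G$ is at most $2$. $\chi$ denotes the chromatic number and $\Delta$ the maximum degree. -}

module Defs where

open import Data.Nat as ℕ using (ℕ; zero; suc; _⊔_)
open import Data.Bool using (Bool; true; false; if_then_else_)
open import Data.Fin as Fin using (Fin; inject₁; fromℕ)
open import Data.List as List using (List; []; _∷_; _++_; [_])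
open import Data.Rational as ℚ using (ℚ; 0ℚ; 1ℚ)
open import Data.Product using (Σ; ∃; ∃-syntax; _×_; _,_)
open import Data.Sum using (_⊎_)
open import Data.Empty using (⊥)
open import Data.Nat.ListAction using (sum)
open import Relation.Nullary using (¬_)
open import Relation.Binary.PropositionalEquality using (_≡_; _≢_)
open import Function.Definitions using (Injective)

record Graph (n : ℕ) : Set where
  field
    adj   : Fin n → Fin n → Bool
    sym   : ∀ u v → adj u v ≡ adj v u
    irrefl : ∀ v → adj v v ≡ false
open Graph public

Adj : ∀ {n} → Graph n → Fin n → Fin n → Set
Adj G u v = adj G u v ≡ true

degree : ∀ {n} → Graph n → Fin n → ℕ
degree {n} G v = sum (List.map (λ w → if adj G v w then 1 else 0) (List.allFin n))

maxDegree : ∀ {n} → Graph n → ℕ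
maxDegree {n} G = List.foldr _⊔_ 0 (List.map (degree G) (List.allFin n))

SqAdj : ∀ {n} → Graph n → Fin n → Fin n → Set
SqAdj G u v = u ≢ v × (Adj G u v ⊎ ∃[ w ] (Adj G u w × Adj G w v))

-- proper colouring of G² with k colours; χ(G²) ≤ k iff such a colouring exists
SquareColourable : ∀ {n} → Graph n → ℕ → Set
SquareColourable {n} G k =
  Σ (Fin n → Fin k) λ c → ∀ u v → SqAdj G u v → c u ≢ c v

CycleOfLength : ∀ {n} → Graph n → ℕ → Set
CycleOfLength {n} G zero = ⊥
CycleOfLength {n} G (suc m) =
  (3 ℕ.≤ suc m) ×
  Σ (Fin (suc m) → Fin n) λ f →
    Injective _≡_ _≡_ f ×
    (∀ (i : Fin m) → Adj G (f (inject₁ i)) (f (Fin.suc i))) ×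
    Adj G (f (fromℕ m)) (f Fin.zero)

NoCycleLengthIn : ∀ {n} → List ℕ → Graph n → Set
NoCycleLengthIn S G = ∀ k → k List.∈ S → ¬ CycleOfLength G k
  where open import Data.List.Membership.Propositional as List using ()

-- Planarity, via piecewise-linear drawings in the rational plane ℚ².
-- Vertices go to distinct points; each edge uv (u < v) is drawn as a
-- polygonal curve from pos u to pos v with rational bend points.
-- The curve of an edge contains no vertex point other than its ends,
-- and curves of distinct edges only meet in vertex points.

Point : Set
Point = ℚ × ℚ

OnSegment : Point → Point → Point → Set
OnSegment (px , py) (ax , ay) (bx , by) =
  ∃[ t ] (0ℚ ℚ.≤ t × t ℚ.≤ 1ℚ ×
          px ≡ ax ℚ.+ t ℚ.* (bx ℚ.- ax) ×
          py ≡ ay ℚ.+ t ℚ.* (by ℚ.- ay))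

OnPolyline : Point → List Point → Set
OnPolyline p [] = ⊥
OnPolyline p (a ∷ []) = p ≡ a
OnPolyline p (a ∷ b ∷ rest) = OnSegment p a b ⊎ OnPolyline p (b ∷ rest)

record PlanarDrawing {n : ℕ} (G : Graph n) : Set where
  field
    pos   : Fin n → Point
    pos-injective : Injective _≡_ _≡_ pos
    bends : Fin n → Fin n → List Point
  curve : Fin n → Fin n → List Point
  curve u v = pos u ∷ (bends u v ++ [ pos v ])
  field
    avoids-vertices : ∀ u v w p → u Fin.< v → Adj G u v →
      OnPolyline p (curve u v) → p ≡ pos w → w ≡ u ⊎ w ≡ v
    no-crossings : ∀ u v u′ v′ p → u Fin.< v → Adj G u v →
      u′ Fin.< v′ → Adj G u′ v′ → (u , v) ≢ (u′ , v′) →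
      OnPolyline p (curve u v) → OnPolyline p (curve u′ v′) →
      ∃[ w ] p ≡ pos w

Planar : ∀ {n} → Graph n → Set
Planar G = PlanarDrawing G

{-# OPTIONS --safe #-}

-- Necessity of 4 ∈ S.  Arrange an odd number 2t + 1 of hubs in a cycle and join
-- every two consecutive hubs by p paths of length 2.  A cycle of this planar
-- graph has length 4 or passes through all hubs.  The middle vertices at a common
-- hub need distinct colours, so each colour is used at most t times on the
-- (2t + 1) p middle vertices; about 2p + p/t colours are needed, while Δ = 2p.
--
-- Sufficiency.  A drawing without crossings gives for each edge e and vertex v the
-- parity x(e,v) of the number of crossings of e with a ray from v, and for
-- independent edges ab, cd the sum x(ab,c) + x(ab,d) + x(cd,a) + x(cd,b) depends
-- only on the order of a, b, c, d along the x-axis.  This property survives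
-- contraction and fails for K₅, so by Mader's argument such graphs are sparse.
--
-- Let X be a set of vertices, and let d(u) be the number of neighbours of u in X.
-- If G has no 4-cycle, contracting each y outside X into one of its neighbours in
-- X shows that the sum of d(y) - 1 over y outside X is O(|X|).  Applied to X and
-- then to B = {u : d(u) > K}, this yields by averaging a vertex x in X outside B
-- with at most one neighbour in B and boundedly many neighbours outside X that
-- have another neighbour in X.  So x has at most Δ + O(1) neighbours in X in G²,
-- and G² can be coloured greedily.
module Submission where

-- Deleting a vertex of G may destroy edges of G² between other vertices, so G stays whole
-- throughout and only the set X of vertices to be coloured shrinks. This is why a vertex of low
-- degree is needed for every X, and why vertices outside X still matter: they are middle vertices
-- of paths of length 2. Arbitrarily many of them may have a single neighbour in X, but those join
-- no two vertices of X; hence d(y) - 1 is summed instead of d(y). The delicate point is the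
-- coefficient 1 of Δ: x may have only one neighbour that itself has unboundedly many neighbours in
-- X. Taking B in place of X, the sum of d(y) - 1 measures exactly the excess over one such
-- neighbour. Contraction is never performed on curves. An edge that stands for a path receives the
-- sum of the parities of the edges of the path, and the terms of the middle vertex cancel, so only
-- the parities and the order of the vertices have to be carried along.

module Crossings where

  open import Defs hiding (sym)
  open import Data.Fin as Fin using (Fin)
  open import Data.Fin.Properties as Fin using ()
  open import Data.Bool using (Bool; true; false; _∧_; _xor_; not)
  open import Data.Bool.Properties using (xor-comm; xor-same; not-involutive)
  open import Data.Rational as ℚ using (ℚ; 0ℚ; 1ℚ; _<_; _-_; -_) renaming (_+_ to _+ℚ_; _*_ to _*ℚ_)
  open import Data.Rational.Properties as ℚ using ()
  open import Data.Rational.Solver using (module +-*-Solver)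
  open import Data.Product using (∃-syntax; _×_; _,_; proj₁; proj₂)
  open import Data.List using (List; []; _∷_; _++_; [_])
  open import Data.Sum using (_⊎_; inj₁; inj₂)
  open import Data.Empty using (⊥; ⊥-elim)
  open import Relation.Nullary using (¬_; Dec; yes; no; does; contradiction)
  open import Relation.Nullary.Decidable using (dec-true; dec-false)
  open import Relation.Binary.Definitions using (tri<; tri≈; tri>)
  open import Relation.Binary.PropositionalEquality hiding ([_])
  open import Data.Bool.Solver using (module xor-∧-Solver)
  private module X = xor-∧-Solver
  open +-*-Solver using (solve; _:+_; _:*_; _:-_; :-_; _:=_; con)

  -- Signs in ℚ.

  Pos : ℚ → Set
  Pos x = 0ℚ < x

  pos-+ : ∀ {x y} → Pos x → Pos y → Pos (x +ℚ y)
  pos-+ = ℚ.+-mono-<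

  pos-* : ∀ {x y} → Pos x → Pos y → Pos (x *ℚ y)
  pos-* {x} {y} px py = subst (_< x *ℚ y) (ℚ.*-zeroʳ x) (ℚ.*-monoʳ-<-pos x {{ℚ.positive px}} py)

  pos-irrefl : ¬ Pos 0ℚ
  pos-irrefl = ℚ.<-irrefl refl

  pos-neg : ∀ {x} → Pos x → ¬ Pos (- x)
  pos-neg {x} p q = pos-irrefl (subst Pos (ℚ.+-inverseʳ x) (pos-+ p q))

  <⇒pos : ∀ {x y} → x < y → Pos (y - x)
  <⇒pos {x} {y} l = subst (_< y - x) (ℚ.+-inverseʳ x) (ℚ.+-monoˡ-< (- x) l)

  pos⇒< : ∀ {x y} → Pos (y - x) → x < y
  pos⇒< {x} {y} p = subst₂ _<_ (ℚ.+-identityˡ x) (solve 2 (λ x y → y :- x :+ x := y) refl x y) (ℚ.+-monoˡ-< x p)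

  data Sign (x : ℚ) : Set where
    plus  : Pos x → Sign x
    nil   : x ≡ 0ℚ → Sign x
    minus : Pos (- x) → Sign x

  sign : ∀ x → Sign x
  sign x with ℚ.<-cmp 0ℚ x
  ... | tri< p _ _ = plus p
  ... | tri≈ _ e _ = nil (sym e)
  ... | tri> _ _ n = minus (subst Pos (ℚ.+-identityˡ (- x)) (<⇒pos n))

  inverse : ∀ {w} → Pos w → ∃[ i ] (Pos i × i *ℚ w ≡ 1ℚ)
  inverse {w} p = ℚ.1/ w , ℚ.positive⁻¹ _ {{ℚ.1/pos⇒pos w}} , ℚ.*-inverseˡ w
    where
    instance
      _ = ℚ.positive p
      _ = ℚ.pos⇒nonZero w

  *-cancelˡ : ∀ {w x y} → Pos w → w *ℚ x ≡ w *ℚ y → x ≡ y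
  *-cancelˡ {w} {x} {y} p e with inverse p
  ... | i , _ , iw = trans (sym (undo x)) (trans (cong (i *ℚ_) e) (undo y))
    where
    undo : ∀ z → i *ℚ (w *ℚ z) ≡ z
    undo z = trans (sym (ℚ.*-assoc i w z)) (trans (cong (_*ℚ z) iw) (ℚ.*-identityˡ z))

  pos-*-cancel : ∀ {w x} → Pos w → Pos (w *ℚ x) → Pos x
  pos-*-cancel {w} {x} p q with inverse p
  ... | i , pi , iw = subst Pos
    (trans (sym (ℚ.*-assoc i w x)) (trans (cong (_*ℚ x) iw) (ℚ.*-identityˡ x))) (pos-* pi q)

  -- The witness is t = x / (x + y): the two nonnegative quantities are distances to the two sides
  -- of the wanted point, and one of them may vanish.
  ratio : ∀ {x y} → ¬ Pos (- x) → ¬ Pos (- y) → Pos (x +ℚ y) →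
    ∃[ t ] (0ℚ ℚ.≤ t × t ℚ.≤ 1ℚ × (x +ℚ y) *ℚ t ≡ x)
  ratio {x} {y} nx ny p with inverse p
  ... | i , pi , iw = i *ℚ x , ℚ.≮⇒≥ lower , ℚ.≮⇒≥ upper , back
    where
    w = x +ℚ y
    back : w *ℚ (i *ℚ x) ≡ x
    back = trans (solve 3 (λ w i x → w :* (i :* x) := (i :* w) :* x) refl w i x)
             (trans (cong (_*ℚ x) iw) (ℚ.*-identityˡ x))
    lower : ¬ (i *ℚ x < 0ℚ)
    lower l = nx (pos-*-cancel pi (subst Pos (solve 2 (λ i x → con 0ℚ :- i :* x := i :* (:- x)) refl i x) (<⇒pos l)))
    upper : ¬ (1ℚ < i *ℚ x)
    upper l = ny (pos-*-cancel pi (subst Pos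
      (trans (cong (λ z → i *ℚ x - z) (sym iw))
             (solve 3 (λ i x y → i :* x :- i :* (x :+ y) := i :* (:- y)) refl i x y)) (<⇒pos l)))

  -- Vectors in lexicographically positive position span an open half-plane
  -- together with one boundary ray, so they are linearly ordered by direction.

  LexPos : Point → Set
  LexPos (x , y) = Pos x ⊎ (x ≡ 0ℚ × Pos y)

  _⊕_ _⊖_ : Point → Point → Point
  (ax , ay) ⊕ (bx , by) = ax +ℚ bx , ay +ℚ by
  (ax , ay) ⊖ (bx , by) = ax - bx , ay - by

  _·_ : ℚ → Point → Point
  k · (x , y) = k *ℚ x , k *ℚ y

  infixl 6 _⊕_ _⊖_
  infixr 7 _·_

  cross : Point → Point → ℚ
  cross (ax , ay) (bx , by) = ax *ℚ by - ay *ℚ bx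

  lexPos-⊕ : ∀ {u v} → LexPos u → LexPos v → LexPos (u ⊕ v)
  lexPos-⊕ (inj₁ p) (inj₁ q) = inj₁ (pos-+ p q)
  lexPos-⊕ {ux , uy} {vx , vy} (inj₁ p) (inj₂ (refl , _)) = inj₁ (subst Pos (sym (ℚ.+-identityʳ ux)) p)
  lexPos-⊕ {ux , uy} {vx , vy} (inj₂ (refl , _)) (inj₁ q) = inj₁ (subst Pos (sym (ℚ.+-identityˡ vx)) q)
  lexPos-⊕ (inj₂ (refl , p)) (inj₂ (refl , q)) = inj₂ (refl , pos-+ p q)

  lexPos-· : ∀ {k v} → Pos k → LexPos v → LexPos (k · v)
  lexPos-· k (inj₁ p) = inj₁ (pos-* k p)
  lexPos-· {k} pk (inj₂ (refl , p)) = inj₂ (ℚ.*-zeroʳ k , pos-* pk p)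

  lexPos-0 : ¬ LexPos (0ℚ , 0ℚ)
  lexPos-0 (inj₁ p) = pos-irrefl p
  lexPos-0 (inj₂ (_ , p)) = pos-irrefl p

  lexPos-·⁻ : ∀ {k v} → LexPos v → LexPos (k · v) → Pos k
  lexPos-·⁻ {k} {x , y} p q with sign k
  ... | plus pk = pk
  ... | nil refl = ⊥-elim (lexPos-0 (subst LexPos (cong₂ _,_ (ℚ.*-zeroˡ x) (ℚ.*-zeroˡ y)) q))
  ... | minus nk = ⊥-elim (lexPos-0 (subst LexPos (cong₂ _,_ (z k x) (z k y)) (lexPos-⊕ (lexPos-· nk p) q)))
    where
    z : ∀ k x → (- k) *ℚ x +ℚ k *ℚ x ≡ 0ℚ
    z = solve 2 (λ k x → (:- k) :* x :+ k :* x := con 0ℚ) refl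

  -- from (u × q) p = (u × p) q + (p × q) u
  cross-trans : ∀ {u p q} → LexPos u → LexPos p → LexPos q →
    Pos (cross u p) → Pos (cross p q) → Pos (cross u q)
  cross-trans {ux , uy} {px , py} {qx , qy} u p q up pq = lexPos-·⁻ p
    (subst LexPos (cong₂ _,_
       (solve 6 (λ ux uy px py qx qy → (ux :* py :- uy :* px) :* qx :+ (px :* qy :- py :* qx) :* ux := (ux :* qy :- uy :* qx) :* px) refl ux uy px py qx qy)
       (solve 6 (λ ux uy px py qx qy → (ux :* py :- uy :* px) :* qy :+ (px :* qy :- py :* qx) :* uy := (ux :* qy :- uy :* qx) :* py) refl ux uy px py qx qy))
      (lexPos-⊕ (lexPos-· up q) (lexPos-· pq u)))

  infix 4 _≺_
  record _≺_ (a b : Point) : Set where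
    constructor lex
    field positive : LexPos (b ⊖ a)

  data Order (a b : Point) : Set where
    less    : a ≺ b → Order a b
    same    : a ≡ b → Order a b
    greater : b ≺ a → Order a b

  -‿zero : ∀ x y → x - y ≡ 0ℚ → x ≡ y
  -‿zero x y e = trans (solve 2 (λ x y → x := x :- y :+ y) refl x y) (trans (cong (_+ℚ y) e) (ℚ.+-identityˡ y))

  neg-sub : ∀ x y → - (x - y) ≡ y - x
  neg-sub = solve 2 (λ x y → :- (x :- y) := y :- x) refl

  order : ∀ a b → Order a b
  order (ax , ay) (bx , by) = by-sign (sign (bx - ax)) (sign (by - ay))
    where
    by-sign : Sign (bx - ax) → Sign (by - ay) → Order (ax , ay) (bx , by)
    by-sign (plus p) _ = less (lex (inj₁ p))
    by-sign (minus n) _ = greater (lex (inj₁ (subst Pos (neg-sub bx ax) n)))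
    by-sign (nil e) (plus p) = less (lex (inj₂ (e , p)))
    by-sign (nil e) (minus n) = greater (lex (inj₂ (trans (sym (neg-sub bx ax)) (cong -_ e) , subst Pos (neg-sub by ay) n)))
    by-sign (nil e) (nil f) = same (cong₂ _,_ (sym (-‿zero bx ax e)) (sym (-‿zero by ay f)))

  sub-split : ∀ a b c → b - a ≡ (c - a) +ℚ (b - c)
  sub-split = solve 3 (λ a b c → b :- a := (c :- a) :+ (b :- c)) refl

  ⊖-split : ∀ a b c → b ⊖ a ≡ (c ⊖ a) ⊕ (b ⊖ c)
  ⊖-split (ax , ay) (bx , by) (cx , cy) = cong₂ _,_ (sub-split ax bx cx) (sub-split ay by cy)

  ≺-trans : ∀ {a b c} → a ≺ b → b ≺ c → a ≺ c
  ≺-trans {a} {b} {c} (lex p) (lex q) = lex (subst LexPos (sym (⊖-split a c b)) (lexPos-⊕ p q))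

  ≺-irrefl : ∀ {a} → ¬ a ≺ a
  ≺-irrefl {ax , ay} (lex p) = lexPos-0 (subst LexPos (cong₂ _,_ (ℚ.+-inverseʳ ax) (ℚ.+-inverseʳ ay)) p)

  ≺-asym : ∀ {a b} → a ≺ b → ¬ b ≺ a
  ≺-asym p q = ≺-irrefl (≺-trans p q)

  _≺?_ : ∀ a b → Dec (a ≺ b)
  a ≺? b with order a b
  ... | less p = yes p
  ... | same refl = no ≺-irrefl
  ... | greater p = no (≺-asym p)

  abstract
    lt : Point → Point → Bool
    lt a b = does (a ≺? b)

    lt-true : ∀ {a b} → a ≺ b → lt a b ≡ true
    lt-true {a} {b} = dec-true (a ≺? b)

    lt-false : ∀ {a b} → b ≺ a → lt a b ≡ false
    lt-false {a} {b} p = dec-false (a ≺? b) (≺-asym p)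

  lt-antisym : ∀ {a b} → a ≢ b → lt a b ≡ not (lt b a)
  lt-antisym {a} {b} a≢b = cases (order a b)
    where
    cases : Order a b → lt a b ≡ not (lt b a)
    cases (less p) = trans (lt-true p) (cong not (sym (lt-false p)))
    cases (same e) = contradiction e a≢b
    cases (greater p) = trans (lt-false p) (cong not (sym (lt-true p)))

  -- Signed areas and intersecting segments.

  area : Point → Point → Point → ℚ
  area a b p = cross (b ⊖ a) (p ⊖ a)

  onSegment-swap : ∀ {p a b} → OnSegment p a b → OnSegment p b a
  onSegment-swap {px , py} {ax , ay} {bx , by} (t , t≥0 , t≤1 , ex , ey) =
    1ℚ - t
    , ℚ.≮⇒≥ (λ l → ℚ.<-irrefl refl (ℚ.<-≤-trans (pos⇒< (subst Pos (solve 1 (λ t → con 0ℚ :- (con 1ℚ :- t) := t :- con 1ℚ) refl t) (<⇒pos l))) t≤1))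
    , ℚ.≮⇒≥ (λ l → ℚ.<-irrefl refl (ℚ.<-≤-trans (pos⇒< (subst Pos (solve 1 (λ t → (con 1ℚ :- t) :- con 1ℚ := con 0ℚ :- t) refl t) (<⇒pos l))) t≥0))
    , trans ex (z ax bx t) , trans ey (z ay by t)
    where
    z : ∀ a b t → a +ℚ t *ℚ (b - a) ≡ b +ℚ (1ℚ - t) *ℚ (a - b)
    z = solve 3 (λ a b t → a :+ t :* (b :- a) := b :+ (con 1ℚ :- t) :* (a :- b)) refl

  record Proportion (u v : Point) : Set where
    constructor proportion
    field
      {factor} : ℚ
      factor≥0 : 0ℚ ℚ.≤ factor
      factor≤1 : factor ℚ.≤ 1ℚ
      scaled   : factor · u ≡ v

  -- Both summands point into the same half-plane, so the ratio of abscissas lies between 0 and 1.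
  -- Only if both are vertical does it have to be read off the ordinates.
  collinear : ∀ {r q} → LexPos r → LexPos q → cross (r ⊕ q) r ≡ 0ℚ → Proportion (r ⊕ q) r
  collinear {rx , ry} {qx , qy} pr pq e = cases pr pq
    where
    horizontal : ¬ Pos (- rx) → ¬ Pos (- qx) → Pos (rx +ℚ qx) → Proportion (rx +ℚ qx , ry +ℚ qy) (rx , ry)
    horizontal nr nq w = build (ratio nr nq w)
      where
      build : ∃[ t ] (0ℚ ℚ.≤ t × t ℚ.≤ 1ℚ × (rx +ℚ qx) *ℚ t ≡ rx) → Proportion (rx +ℚ qx , ry +ℚ qy) (rx , ry)
      build (t , t≥0 , t≤1 , te) = proportion t≥0 t≤1 (cong₂ _,_ (trans (ℚ.*-comm t _) te)
        (*-cancelˡ w (trans (solve 3 (λ w t v → w :* (t :* v) := (w :* t) :* v) refl (rx +ℚ qx) t (ry +ℚ qy))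
          (trans (cong (_*ℚ (ry +ℚ qy)) te) (trans (ℚ.*-comm rx _) (sym (-‿zero _ _ e)))))))
    vertical : rx ≡ 0ℚ → qx ≡ 0ℚ → Pos ry → Pos qy → Proportion (rx +ℚ qx , ry +ℚ qy) (rx , ry)
    vertical refl refl p q = build (ratio (pos-neg p) (pos-neg q) (pos-+ p q))
      where
      build : ∃[ t ] (0ℚ ℚ.≤ t × t ℚ.≤ 1ℚ × (ry +ℚ qy) *ℚ t ≡ ry) → Proportion (0ℚ +ℚ 0ℚ , ry +ℚ qy) (0ℚ , ry)
      build (t , t≥0 , t≤1 , te) = proportion t≥0 t≤1 (cong₂ _,_ (ℚ.*-zeroʳ t) (trans (ℚ.*-comm t _) te))
    cases : LexPos (rx , ry) → LexPos (qx , qy) → Proportion (rx +ℚ qx , ry +ℚ qy) (rx , ry)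
    cases (inj₁ p) (inj₁ q) = horizontal (pos-neg p) (pos-neg q) (pos-+ p q)
    cases (inj₁ p) (inj₂ (z , _)) = horizontal (pos-neg p) (λ n → pos-irrefl (subst Pos (cong -_ z) n)) (subst (λ z → Pos (rx +ℚ z)) (sym z) (subst Pos (sym (ℚ.+-identityʳ rx)) p))
    cases (inj₂ (z , _)) (inj₁ q) = horizontal (λ n → pos-irrefl (subst Pos (cong -_ z) n)) (pos-neg q) (subst (λ z → Pos (z +ℚ qx)) (sym z) (subst Pos (sym (ℚ.+-identityˡ qx)) q))
    cases (inj₂ (z , p)) (inj₂ (z′ , q)) = vertical z z′ p q

  unshift : ∀ a p → p ≡ a ⊕ (p ⊖ a)
  unshift (ax , ay) (px , py) = cong₂ _,_ (z ax px) (z ay py)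
    where
    z : ∀ a p → p ≡ a +ℚ (p - a)
    z = solve 2 (λ a p → p := a :+ (p :- a)) refl

  onSegment : ∀ {p a b} → Proportion (b ⊖ a) (p ⊖ a) → OnSegment p a b
  onSegment {p} {a} {b} (proportion {t} t≥0 t≤1 e) = t , t≥0 , t≤1 , cong proj₁ eq , cong proj₂ eq
    where
    eq : p ≡ a ⊕ t · (b ⊖ a)
    eq = trans (unshift a p) (cong (a ⊕_) (sym e))

  collinear⇒on : ∀ {a b p} → a ≺ p → p ≺ b → area a b p ≡ 0ℚ → OnSegment p a b
  collinear⇒on {a} {b} {p} (lex ap) (lex pb) e =
    onSegment {p} {a} {b} (subst (λ u → Proportion u (p ⊖ a)) (sym (⊖-split a b p))
      (collinear ap pb (subst (λ u → cross u (p ⊖ a) ≡ 0ℚ) (⊖-split a b p) e)))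

  record Meet (a b c d : Point) : Set where
    constructor meeting
    field
      point : Point
      on₁ : OnSegment point a b
      on₂ : OnSegment point c d

  -- Segments from 0 to u and from r to r + w: the parameters of the common
  -- point come from (r × w) u − (r × u) w = (u × w) r.
  crossing : ∀ u r w → Pos (- cross u r) → Pos (cross u (r ⊕ w)) → Pos (cross r w) → Pos (- cross w (u ⊖ r)) →
    ∃[ s ] ∃[ t ] (0ℚ ℚ.≤ s × s ℚ.≤ 1ℚ × 0ℚ ℚ.≤ t × t ℚ.≤ 1ℚ × s · u ≡ r ⊕ t · w)
  crossing (ux , uy) (rx , ry) (wx , wy) nc pd pa nb =
    build (ratio (pos-neg pa) (pos-neg nb) (pos-+ pa nb)) (ratio (pos-neg nc) (pos-neg pd) (pos-+ nc pd))
    where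
    u r w : Point
    u = ux , uy
    r = rx , ry
    w = wx , wy
    A B C D W : ℚ
    A = cross r w
    B = - cross w (u ⊖ r)
    C = - cross u r
    D = cross u (r ⊕ w)
    W = cross u w
    W≡ : A +ℚ B ≡ W
    W≡ = solve 6 (λ ux uy rx ry wx wy → (rx :* wy :- ry :* wx) :+ :- (wx :* (uy :- ry) :- wy :* (ux :- rx)) := ux :* wy :- uy :* wx) refl ux uy rx ry wx wy
    W≡′ : C +ℚ D ≡ W
    W≡′ = solve 6 (λ ux uy rx ry wx wy → :- (ux :* ry :- uy :* rx) :+ (ux :* (ry :+ wy) :- uy :* (rx :+ wx)) := ux :* wy :- uy :* wx) refl ux uy rx ry wx wy
    build : ∃[ s ] (0ℚ ℚ.≤ s × s ℚ.≤ 1ℚ × (A +ℚ B) *ℚ s ≡ A) → ∃[ t ] (0ℚ ℚ.≤ t × t ℚ.≤ 1ℚ × (C +ℚ D) *ℚ t ≡ C) →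
      ∃[ s ] ∃[ t ] (0ℚ ℚ.≤ s × s ℚ.≤ 1ℚ × 0ℚ ℚ.≤ t × t ℚ.≤ 1ℚ × s · u ≡ r ⊕ t · w)
    build (s , s≥0 , s≤1 , se) (t , t≥0 , t≤1 , te) = s , t , s≥0 , s≤1 , t≥0 , t≤1 , cong₂ _,_ (agree ux rx wx planex) (agree uy ry wy planey)
      where
      planex : A *ℚ ux ≡ W *ℚ rx +ℚ C *ℚ wx
      planex = solve 6 (λ ux uy rx ry wx wy → (rx :* wy :- ry :* wx) :* ux := (ux :* wy :- uy :* wx) :* rx :+ :- (ux :* ry :- uy :* rx) :* wx) refl ux uy rx ry wx wy
      planey : A *ℚ uy ≡ W *ℚ ry +ℚ C *ℚ wy
      planey = solve 6 (λ ux uy rx ry wx wy → (rx :* wy :- ry :* wx) :* uy := (ux :* wy :- uy :* wx) :* ry :+ :- (ux :* ry :- uy :* rx) :* wy) refl ux uy rx ry wx wy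
      spread : ∀ w t a k → w *ℚ (a +ℚ t *ℚ k) ≡ w *ℚ a +ℚ (w *ℚ t) *ℚ k
      spread = solve 4 (λ w t a k → w :* (a :+ t :* k) := w :* a :+ (w :* t) :* k) refl
      agree : ∀ u r w → A *ℚ u ≡ W *ℚ r +ℚ C *ℚ w → s *ℚ u ≡ r +ℚ t *ℚ w
      agree u r w e = *-cancelˡ (subst Pos W≡ (pos-+ pa nb))
        (trans (sym (ℚ.*-assoc W s u)) (trans (cong (_*ℚ u) (trans (cong (_*ℚ s) (sym W≡)) se))
          (trans e (sym (trans (spread W t r w) (cong (λ z → W *ℚ r +ℚ z *ℚ w) (trans (cong (_*ℚ t) (sym W≡′)) te)))))))

  meet : ∀ {a b c d} → Pos (- area a b c) → Pos (area a b d) → Pos (area c d a) → Pos (- area c d b) → Meet a b c d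
  meet {a} {b} {c} {d} nc pd pa nb =
    build (crossing (b ⊖ a) (c ⊖ a) (d ⊖ c) nc
      (subst (λ v → Pos (cross (b ⊖ a) v)) (⊖-split a d c) pd)
      (subst Pos (flip (d ⊖ c) a c) pa)
      (subst (λ v → Pos (- cross (d ⊖ c) v)) (⊖-rebase a b c) nb))
    where
    flip : ∀ w a c → cross w (a ⊖ c) ≡ cross (c ⊖ a) w
    flip (wx , wy) (ax , ay) (cx , cy) =
      solve 6 (λ wx wy ax ay cx cy → wx :* (ay :- cy) :- wy :* (ax :- cx) := (cx :- ax) :* wy :- (cy :- ay) :* wx) refl wx wy ax ay cx cy
    ⊖-rebase : ∀ a b c → b ⊖ c ≡ (b ⊖ a) ⊖ (c ⊖ a)
    ⊖-rebase (ax , ay) (bx , by) (cx , cy) = cong₂ _,_ (z ax bx cx) (z ay by cy)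
      where
      z : ∀ a b c → b - c ≡ (b - a) - (c - a)
      z = solve 3 (λ a b c → b :- c := (b :- a) :- (c :- a)) refl
    ⊕-assoc : ∀ a r v → a ⊕ (r ⊕ v) ≡ (a ⊕ r) ⊕ v
    ⊕-assoc (ax , ay) (rx , ry) (vx , vy) = cong₂ _,_ (sym (ℚ.+-assoc ax rx vx)) (sym (ℚ.+-assoc ay ry vy))
    build : ∃[ s ] ∃[ t ] (0ℚ ℚ.≤ s × s ℚ.≤ 1ℚ × 0ℚ ℚ.≤ t × t ℚ.≤ 1ℚ × s · (b ⊖ a) ≡ (c ⊖ a) ⊕ t · (d ⊖ c)) → Meet a b c d
    build (s , t , s≥0 , s≤1 , t≥0 , t≤1 , e) = meeting (a ⊕ s · (b ⊖ a))
      (s , s≥0 , s≤1 , refl , refl)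
      (t , t≥0 , t≤1 , cong proj₁ p≡ , cong proj₂ p≡)
      where
      p≡ : a ⊕ s · (b ⊖ a) ≡ c ⊕ t · (d ⊖ c)
      p≡ = trans (cong (a ⊕_) e) (trans (⊕-assoc a (c ⊖ a) (t · (d ⊖ c))) (cong (_⊕ t · (d ⊖ c)) (sym (unshift a c))))
  meet-swap : ∀ {a b c d} → Meet a b c d → Meet c d a b
  meet-swap (meeting p on on′) = meeting p on′ on

  meet⁻ : ∀ {a b c d} → Pos (area a b c) → Pos (- area a b d) → Pos (- area c d a) → Pos (area c d b) → Meet a b c d
  meet⁻ pc nd na pb = meet-swap (meet na pb pc nd)

  cross-flip : ∀ u v → - cross u v ≡ cross v u
  cross-flip (ux , uy) (vx , vy) = solve 4 (λ a b c d → :- (a :* d :- b :* c) := c :* b :- d :* a) refl ux uy vx vy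

  cross-flip′ : ∀ {u v} → Pos (- cross u v) → Pos (cross v u)
  cross-flip′ {u} {v} = subst Pos (cross-flip u v)

  cross-flip⁻ : ∀ {u v} → Pos (cross u v) → Pos (- cross v u)
  cross-flip⁻ {u} {v} = subst Pos (sym (cross-flip v u))

  area-rotate : ∀ a b c → area a b c ≡ cross (b ⊖ c) (b ⊖ a)
  area-rotate (ax , ay) (bx , by) (cx , cy) =
    solve 6 (λ ax ay bx by cx cy → (bx :- ax) :* (cy :- ay) :- (by :- ay) :* (cx :- ax)
      := (bx :- cx) :* (by :- ay) :- (by :- cy) :* (bx :- ax)) refl ax ay bx by cx cy

  area-reverse : ∀ a b c → area a b c ≡ cross (a ⊖ c) (b ⊖ a)
  area-reverse (ax , ay) (bx , by) (cx , cy) =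
    solve 6 (λ ax ay bx by cx cy → (bx :- ax) :* (cy :- ay) :- (by :- ay) :* (cx :- ax)
      := (ax :- cx) :* (by :- ay) :- (ay :- cy) :* (bx :- ax)) refl ax ay bx by cx cy

  area-middle : ∀ a b c → area a b c ≡ cross (b ⊖ c) (c ⊖ a)
  area-middle (ax , ay) (bx , by) (cx , cy) =
    solve 6 (λ ax ay bx by cx cy → (bx :- ax) :* (cy :- ay) :- (by :- ay) :* (cx :- ax)
      := (bx :- cx) :* (cy :- ay) :- (by :- cy) :* (cx :- ax)) refl ax ay bx by cx cy

  area-end : ∀ a b c → area a b c ≡ cross (b ⊖ a) (c ⊖ b)
  area-end (ax , ay) (bx , by) (cx , cy) =
    solve 6 (λ ax ay bx by cx cy → (bx :- ax) :* (cy :- ay) :- (by :- ay) :* (cx :- ax)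
      := (bx :- ax) :* (cy :- by) :- (by :- ay) :* (cx :- bx)) refl ax ay bx by cx cy

  cross-⊕ˡ : ∀ u v w → cross (u ⊕ v) w ≡ cross u w +ℚ cross v w
  cross-⊕ˡ (ux , uy) (vx , vy) (wx , wy) =
    solve 6 (λ ux uy vx vy wx wy → (ux :+ vx) :* wy :- (uy :+ vy) :* wx := (ux :* wy :- uy :* wx) :+ (vx :* wy :- vy :* wx)) refl ux uy vx vy wx wy

  cross-⊕ʳ : ∀ u v w → cross u (v ⊕ w) ≡ cross u v +ℚ cross u w
  cross-⊕ʳ (ux , uy) (vx , vy) (wx , wy) =
    solve 6 (λ ux uy vx vy wx wy → ux :* (vy :+ wy) :- uy :* (vx :+ wx) := (ux :* vy :- uy :* vx) :+ (ux :* wy :- uy :* wx)) refl ux uy vx vy wx wy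

  cross-inner : ∀ a b c d → cross (b ⊖ a) (d ⊖ c) ≡ cross (c ⊖ a) (b ⊖ a) +ℚ cross (b ⊖ d) (b ⊖ a)
  cross-inner a b c d = subst (λ u → cross u (d ⊖ c) ≡ cross (c ⊖ a) u +ℚ cross (b ⊖ d) u)
    (sym (trans (⊖-split a b c) (cong (c ⊖ a ⊕_) (⊖-split c b d)))) (expand (c ⊖ a) (d ⊖ c) (b ⊖ d))
    where
    expand : ∀ r p q → cross (r ⊕ (p ⊕ q)) p ≡ cross r (r ⊕ (p ⊕ q)) +ℚ cross q (r ⊕ (p ⊕ q))
    expand (rx , ry) (px , py) (qx , qy) =
      solve 6 (λ rx ry px py qx qy →
        (rx :+ (px :+ qx)) :* py :- (ry :+ (py :+ qy)) :* px
        := (rx :* (ry :+ (py :+ qy)) :- ry :* (rx :+ (px :+ qx))) :+ (qx :* (ry :+ (py :+ qy)) :- qy :* (rx :+ (px :+ qx))))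
        refl rx ry px py qx qy

  -- The line ab separates c from d by assumption; that cd separates a from b comes from comparing
  -- directions. As c is below and d above ab, both ac and db are less steep than ab, while cd is
  -- steeper by `cross-inner`. Transitivity makes ac and db less steep than cd, so a is above and b
  -- below the line cd.
  nested-meet : ∀ {a b c d} → a ≺ c → c ≺ d → d ≺ b → Pos (- area a b c) → Pos (area a b d) → Meet a b c d
  nested-meet {a} {b} {c} {d} ac@(lex r) cd@(lex p) db@(lex q) nc pd =
    meet nc pd (subst Pos (sym (area-reverse c d a)) (cross-trans r u p ru up))
      (subst Pos (trans (sym (cross-flip (d ⊖ c) (b ⊖ d))) (cong -_ (sym (area-end c d b)))) (cross-trans q u p qu up))
    where
    u : LexPos (b ⊖ a)
    u = _≺_.positive (≺-trans ac (≺-trans cd db))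
    ru : Pos (cross (c ⊖ a) (b ⊖ a))
    ru = cross-flip′ {b ⊖ a} {c ⊖ a} nc
    qu : Pos (cross (b ⊖ d) (b ⊖ a))
    qu = subst Pos (area-rotate a b d) pd
    up : Pos (cross (b ⊖ a) (d ⊖ c))
    up = subst Pos (sym (cross-inner a b c d)) (pos-+ ru qu)

  nested-meet⁻ : ∀ {a b c d} → a ≺ c → c ≺ d → d ≺ b → Pos (area a b c) → Pos (- area a b d) → Meet a b c d
  nested-meet⁻ {a} {b} {c} {d} ac@(lex r) cd@(lex p) db@(lex q) pc nd =
    meet⁻ pc nd (subst Pos (trans (sym (cross-flip (c ⊖ a) (d ⊖ c))) (cong -_ (sym (area-reverse c d a)))) (cross-trans p u r pu pc))
      (subst Pos (sym (area-end c d b)) (cross-trans p u q pu uq))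
    where
    u : LexPos (b ⊖ a)
    u = _≺_.positive (≺-trans ac (≺-trans cd db))
    uq : Pos (cross (b ⊖ a) (b ⊖ d))
    uq = cross-flip′ {b ⊖ d} {b ⊖ a} (subst (λ z → Pos (- z)) (area-rotate a b d) nd)
    pu : Pos (cross (d ⊖ c) (b ⊖ a))
    pu = subst Pos (cross-flip (b ⊖ a) (d ⊖ c))
      (subst (λ z → Pos (- z)) (sym (cross-inner a b c d))
        (subst Pos (sym (ℚ.neg-distrib-+ (cross (c ⊖ a) (b ⊖ a)) (cross (b ⊖ d) (b ⊖ a))))
          (pos-+ (cross-flip⁻ {b ⊖ a} {c ⊖ a} pc) (cross-flip⁻ {b ⊖ a} {b ⊖ d} uq))))

  -- The slopes increase along a, c, b, d. These points therefore form a convex chain, in which ab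
  -- and cd are the diagonals of a convex quadrilateral.
  linked-meet : ∀ {a b c d} → a ≺ c → c ≺ b → b ≺ d → Pos (- area a b c) → Pos (- area c d b) → Meet a b c d
  linked-meet {a} {b} {c} {d} (lex r) (lex p) (lex q) nc nb =
    meet nc
      (subst Pos (sym (trans (area-end a b d) (trans (cong (λ v → cross v (d ⊖ b)) (⊖-split a b c)) (cross-⊕ˡ (c ⊖ a) (b ⊖ c) (d ⊖ b))))) (pos-+ rq pq))
      (subst Pos (sym (trans (area-reverse c d a) (trans (cong (cross (c ⊖ a)) (⊖-split c d b)) (cross-⊕ʳ (c ⊖ a) (b ⊖ c) (d ⊖ b))))) (pos-+ rp rq))
      nb
    where
    rp : Pos (cross (c ⊖ a) (b ⊖ c))
    rp = cross-flip′ {b ⊖ c} {c ⊖ a} (subst (λ z → Pos (- z)) (area-middle a b c) nc)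
    pq : Pos (cross (b ⊖ c) (d ⊖ b))
    pq = cross-flip′ {d ⊖ b} {b ⊖ c} (subst (λ z → Pos (- z)) (area-middle c d b) nb)
    rq : Pos (cross (c ⊖ a) (d ⊖ b))
    rq = cross-trans r p q rp pq

  linked-meet⁻ : ∀ {a b c d} → a ≺ c → c ≺ b → b ≺ d → Pos (area a b c) → Pos (area c d b) → Meet a b c d
  linked-meet⁻ {a} {b} {c} {d} (lex r) (lex p) (lex q) pc pb =
    meet⁻ pc
      (subst (λ z → Pos (- z)) (sym (area-end a b d)) (cross-flip⁻ {d ⊖ b} {b ⊖ a}
        (subst Pos (sym (trans (cong (cross (d ⊖ b)) (⊖-split a b c)) (cross-⊕ʳ (d ⊖ b) (c ⊖ a) (b ⊖ c)))) (pos-+ qr qp))))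
      (subst (λ z → Pos (- z)) (sym (area-reverse c d a)) (cross-flip⁻ {d ⊖ c} {c ⊖ a}
        (subst Pos (sym (trans (cong (λ v → cross v (c ⊖ a)) (⊖-split c d b)) (cross-⊕ˡ (b ⊖ c) (d ⊖ b) (c ⊖ a)))) (pos-+ pr qr))))
      pb
    where
    pr : Pos (cross (b ⊖ c) (c ⊖ a))
    pr = subst Pos (area-middle a b c) pc
    qp : Pos (cross (d ⊖ b) (b ⊖ c))
    qp = subst Pos (area-middle c d b) pb
    qr : Pos (cross (d ⊖ b) (c ⊖ a))
    qr = cross-trans q p r qp pr

  -- Rays and the balance identity.

  abstract
    -- The name is right for `a ≺ b`; for `b ≺ a` the value true means above. `under₁` consults it
    -- only when a ≺ p ≺ b.
    below : Point → Point → Point → Bool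
    below a b p = does (0ℚ ℚ.<? (- area a b p))

    below-true : ∀ a b p → Pos (- area a b p) → below a b p ≡ true
    below-true a b p = dec-true (0ℚ ℚ.<? (- area a b p))

    below-false : ∀ a b p → Pos (area a b p) → below a b p ≡ false
    below-false a b p q = dec-false (0ℚ ℚ.<? (- area a b p)) (pos-neg q)

  onSegment-start : ∀ a b → OnSegment a a b
  onSegment-start (ax , ay) (bx , by) = 0ℚ , ℚ.≤-refl , ℚ.<⇒≤ (ℚ.positive⁻¹ 1ℚ) , z ax bx , z ay by
    where
    z : ∀ a b → a ≡ a +ℚ 0ℚ *ℚ (b - a)
    z = solve 2 (λ a b → a := a :+ con 0ℚ :* (b :- a)) refl

  onSegment-end : ∀ a b → OnSegment b a b
  onSegment-end a b = onSegment-swap {b} {b} {a} (onSegment-start b a)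

  nested-below : ∀ {a b c d} → ¬ Meet a b c d → a ≺ c → c ≺ d → d ≺ b → below a b c ≡ below a b d
  nested-below {a} {b} {c} {d} ¬m ac cd db = cases (sign (area a b c)) (sign (area a b d))
    where
    cases : Sign (area a b c) → Sign (area a b d) → below a b c ≡ below a b d
    cases (plus p)  (plus q)  = trans (below-false a b c p) (sym (below-false a b d q))
    cases (minus p) (minus q) = trans (below-true a b c p) (sym (below-true a b d q))
    cases (plus p)  (minus q) = contradiction (nested-meet⁻ ac cd db p q) ¬m
    cases (minus p) (plus q)  = contradiction (nested-meet ac cd db p q) ¬m
    cases (nil e)   _ = contradiction (meeting c (collinear⇒on ac (≺-trans cd db) e) (onSegment-start c d)) ¬m
    cases _ (nil e) = contradiction (meeting d (collinear⇒on (≺-trans ac cd) db e) (onSegment-end c d)) ¬m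

  linked-below : ∀ {a b c d} → ¬ Meet a b c d → a ≺ c → c ≺ b → b ≺ d → below a b c ≡ not (below c d b)
  linked-below {a} {b} {c} {d} ¬m ac cb bd = cases (sign (area a b c)) (sign (area c d b))
    where
    cases : Sign (area a b c) → Sign (area c d b) → below a b c ≡ not (below c d b)
    cases (plus p)  (minus q) = trans (below-false a b c p) (cong not (sym (below-true c d b q)))
    cases (minus p) (plus q)  = trans (below-true a b c p) (cong not (sym (below-false c d b q)))
    cases (plus p)  (plus q)  = contradiction (linked-meet⁻ ac cb bd p q) ¬m
    cases (minus p) (minus q) = contradiction (linked-meet ac cb bd p q) ¬m
    cases (nil e)   _ = contradiction (meeting c (collinear⇒on ac cb e) (onSegment-start c d)) ¬m
    cases _ (nil e) = contradiction (meeting b (onSegment-end a b) (collinear⇒on cb bd e)) ¬m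

  -- Whether the segment meets the upward ray from p. Comparing abscissas
  -- lexicographically amounts to tilting the rays a little, so that vertical
  -- segments and equal abscissas need no special treatment.
  under₁ : Point → Point → Point → Bool
  under₁ a b p = (lt a p ∧ lt p b) ∧ below a b p

  under : Point → Point → Point → Bool
  under a b p = under₁ a b p xor under₁ b a p

  under-sym : ∀ a b p → under a b p ≡ under b a p
  under-sym a b p = xor-comm (under₁ a b p) (under₁ b a p)

  Interleave : {A : Set} → (A → A → Bool) → A → A → A → A → Bool
  Interleave l a b c d = (l a c xor l a d) xor (l b c xor l b d)

  -- For disjoint curves ab and cd: modulo 2, the rays from the ends of each curve
  -- meet the other curve as often as the pairs of ends interleave.
  Balanced : Point → Point → Point → Point → Set
  Balanced a b c d = (under a b c xor under a b d) xor (under c d a xor under c d b) ≡ Interleave lt a b c d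

  -- Balanced a b c d with the values of lt and below made variables
  BalancedValues : (ac ca bc cb ad da bd db abc bac abd bad cda dca cdb dcb : Bool) → Set
  BalancedValues ac ca bc cb ad da bd db abc bac abd bad cda dca cdb dcb =
    ((((ac ∧ cb) ∧ abc) xor ((bc ∧ ca) ∧ bac)) xor (((ad ∧ db) ∧ abd) xor ((bd ∧ da) ∧ bad)))
    xor ((((ca ∧ ad) ∧ cda) xor ((da ∧ ac) ∧ dca)) xor (((cb ∧ bd) ∧ cdb) xor ((db ∧ bc) ∧ dcb)))
    ≡ (ac xor ad) xor (bc xor bd)

  balanced-disjoint : ∀ {ac ca bc cb ad da bd db} abc bac abd bad cda dca cdb dcb →
    ac ≡ true → ca ≡ false → bc ≡ true → cb ≡ false → ad ≡ true → da ≡ false → bd ≡ true → db ≡ false →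
    BalancedValues ac ca bc cb ad da bd db abc bac abd bad cda dca cdb dcb
  balanced-disjoint abc bac abd bad cda dca cdb dcb refl refl refl refl refl refl refl refl = refl

  balanced-linked : ∀ {ac ca bc cb ad da bd db} abc bac abd bad cda dca cdb dcb →
    ac ≡ true → ca ≡ false → bc ≡ false → cb ≡ true → ad ≡ true → da ≡ false → bd ≡ true → db ≡ false →
    abc ≡ not cdb → BalancedValues ac ca bc cb ad da bd db abc bac abd bad cda dca cdb dcb
  balanced-linked abc bac abd bad cda dca false dcb refl refl refl refl refl refl refl refl refl = refl
  balanced-linked abc bac abd bad cda dca true dcb refl refl refl refl refl refl refl refl refl = refl

  balanced-nested : ∀ {ac ca bc cb ad da bd db} abc bac abd bad cda dca cdb dcb →
    ac ≡ true → ca ≡ false → bc ≡ false → cb ≡ true → ad ≡ true → da ≡ false → bd ≡ false → db ≡ true →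
    abc ≡ abd → BalancedValues ac ca bc cb ad da bd db abc bac abd bad cda dca cdb dcb
  balanced-nested false bac abd bad cda dca cdb dcb refl refl refl refl refl refl refl refl refl = refl
  balanced-nested true bac abd bad cda dca cdb dcb refl refl refl refl refl refl refl refl refl = refl

  balanced-first : ∀ {a b c d} → ¬ Meet a b c d → a ≺ b → c ≺ d → a ≺ c → Balanced a b c d
  balanced-first {a} {b} {c} {d} ¬m ab cd ac = cases (order b c) (order b d)
    where
    ad = ≺-trans ac cd
    cases : Order b c → Order b d → Balanced a b c d
    cases (same e) _ = contradiction (meeting b (onSegment-end a b) (subst (λ c → OnSegment b c d) e (onSegment-start b d))) ¬m
    cases _ (same e) = contradiction (meeting b (onSegment-end a b) (subst (λ d → OnSegment b c d) e (onSegment-end c b))) ¬m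
    cases (less bc) _ = balanced-disjoint (below a b c) (below b a c) (below a b d) (below b a d) (below c d a) (below d c a) (below c d b) (below d c b)
      (lt-true ac) (lt-false ac) (lt-true bc) (lt-false bc) (lt-true ad) (lt-false ad) (lt-true (≺-trans bc cd)) (lt-false (≺-trans bc cd))
    cases (greater cb) (less bd) = balanced-linked (below a b c) (below b a c) (below a b d) (below b a d) (below c d a) (below d c a) (below c d b) (below d c b)
      (lt-true ac) (lt-false ac) (lt-false cb) (lt-true cb) (lt-true ad) (lt-false ad) (lt-true bd) (lt-false bd) (linked-below ¬m ac cb bd)
    cases (greater cb) (greater db) = balanced-nested (below a b c) (below b a c) (below a b d) (below b a d) (below c d a) (below d c a) (below c d b) (below d c b)
      (lt-true ac) (lt-false ac) (lt-false cb) (lt-true cb) (lt-true ad) (lt-false ad) (lt-false db) (lt-true db) (nested-below ¬m ac cd db)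

  interchange : ∀ a b c d → (a xor b) xor (c xor d) ≡ (a xor c) xor (b xor d)
  interchange = X.solve 4 (λ a b c d → (a X.:+ b) X.:+ (c X.:+ d) X.:= (a X.:+ c) X.:+ (b X.:+ d)) refl

  swapˡ : ∀ a b c d s t u v → (a xor b) xor (c xor d) ≡ (s xor t) xor (u xor v) →
    (a xor b) xor (d xor c) ≡ (u xor v) xor (s xor t)
  swapˡ a b c d s t u v e = trans (cong ((a xor b) xor_) (xor-comm d c)) (trans e (xor-comm (s xor t) (u xor v)))

  balanced-swap : ∀ {a b c d} → Balanced a b c d → Balanced b a c d
  balanced-swap {a} {b} {c} {d} e rewrite under-sym b a c | under-sym b a d =
    swapˡ (under a b c) (under a b d) (under c d a) (under c d b) (lt a c) (lt a d) (lt b c) (lt b d) e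

  Interleave-sym : ∀ {A : Set} (l : A → A → Bool) {a b c d} → l c a ≡ not (l a c) → l c b ≡ not (l b c) → l d a ≡ not (l a d) → l d b ≡ not (l b d) →
    Interleave l a b c d ≡ Interleave l c d a b
  Interleave-sym l {a} {b} {c} {d} p q r s rewrite p | q | r | s = negate (l a c) (l a d) (l b c) (l b d)
    where
    negate : ∀ x y z w → (x xor y) xor (z xor w) ≡ (not x xor not z) xor (not y xor not w)
    negate x y z w = trans (interchange x y z w) (cong₂ _xor_ (xor-not x z) (xor-not y w))
      where
      xor-not : ∀ x y → x xor y ≡ not x xor not y
      xor-not false y = sym (not-involutive y)
      xor-not true y = refl

  balanced-turn : ∀ {a b c d} → a ≢ c → b ≢ c → a ≢ d → b ≢ d → Balanced a b c d → Balanced c d a b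
  balanced-turn {a} {b} {c} {d} ac bc ad bd e = trans (xor-comm (under c d a xor under c d b) _)
    (trans e (Interleave-sym lt (lt-antisym (≢-sym ac)) (lt-antisym (≢-sym bc)) (lt-antisym (≢-sym ad)) (lt-antisym (≢-sym bd))))

  -- Consecutive bends of a polyline may coincide, so segments that shrink to a point have to be
  -- covered.
  balanced-degenerate : ∀ a c d → Balanced a a c d
  balanced-degenerate a c d
    rewrite xor-same (under₁ a a c) | xor-same (under₁ a a d) | xor-same (under c d a) | xor-same (lt a c xor lt a d) = refl

  balanced : ∀ {a b c d} → ¬ Meet a b c d → Balanced a b c d
  balanced {a} {b} {c} {d} ¬m = cases (order a b) (order c d)
    where
    turn : ∀ {a b c d} → ¬ Meet a b c d → Balanced c d a b → Balanced a b c d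
    turn {a} {b} {c} {d} ¬m = balanced-turn
      (λ e → ¬m (meeting a (onSegment-start a b) (subst (λ z → OnSegment z c d) e (onSegment-start c d))))
      (λ e → ¬m (meeting a (onSegment-start a b) (subst (λ z → OnSegment z c d) e (onSegment-end c d))))
      (λ e → ¬m (meeting b (onSegment-end a b) (subst (λ z → OnSegment z c d) e (onSegment-start c d))))
      (λ e → ¬m (meeting b (onSegment-end a b) (subst (λ z → OnSegment z c d) e (onSegment-end c d))))
    increasing : ∀ {a b c d} → ¬ Meet a b c d → a ≺ b → c ≺ d → Balanced a b c d
    increasing {a} {b} {c} {d} ¬m ab cd = by (order a c)
      where
      by : Order a c → Balanced a b c d
      by (less ac) = balanced-first ¬m ab cd ac
      by (same e) = contradiction (meeting a (onSegment-start a b) (subst (λ c → OnSegment a c d) e (onSegment-start a d))) ¬m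
      by (greater ca) = turn ¬m (balanced-first (λ m → ¬m (meet-swap m)) cd ab ca)
    flipˡ : ∀ {a b c d} → ¬ Meet a b c d → ¬ Meet b a c d
    flipˡ {a} {b} ¬m (meeting p on on′) = ¬m (meeting p (onSegment-swap {p} {b} {a} on) on′)
    flipʳ : ∀ {a b c d} → ¬ Meet a b c d → ¬ Meet a b d c
    flipʳ {a} {b} {c} {d} ¬m (meeting p on on′) = ¬m (meeting p on (onSegment-swap {p} {d} {c} on′))
    right : ∀ {a b c d} → ¬ Meet a b c d → a ≺ b → Order c d → Balanced a b c d
    right ¬m ab (less cd) = increasing ¬m ab cd
    right {a} {b} {c} ¬m ab (same refl) = turn ¬m (balanced-degenerate c a b)
    right {a} {b} {c} {d} ¬m ab (greater dc) = turn ¬m (balanced-swap {d} {c} {a} {b} (turn (λ m → flipʳ ¬m (meet-swap m)) (increasing (flipʳ ¬m) ab dc)))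
    cases : Order a b → Order c d → Balanced a b c d
    cases (less ab) o = right ¬m ab o
    cases (same refl) o = balanced-degenerate a c d
    cases (greater ba) o = balanced-swap {b} {a} {c} {d} (right (flipˡ ¬m) ba o)

  underPath : Point → List Point → Point → Bool
  underPath a [] p = false
  underPath a (b ∷ l) p = under a b p xor underPath b l p

  lastPoint : Point → List Point → Point
  lastPoint a [] = a
  lastPoint a (b ∷ l) = lastPoint b l

  -- The balance identity is additive in each of the two curves.
  additive : ∀ uc ud ue sa sb pa pb ac ad ae bc bd be →
    (uc xor ud) xor (sa xor sb) ≡ (ac xor ad) xor (bc xor bd) →
    (ud xor ue) xor (pa xor pb) ≡ (ad xor ae) xor (bd xor be) →
    (uc xor ue) xor ((sa xor pa) xor (sb xor pb)) ≡ (ac xor ae) xor (bc xor be)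
  additive uc ud ue sa sb pa pb ac ad ae bc bd be e₁ e₂ =
    trans (X.solve 7 (λ uc ud ue sa sb pa pb →
        (uc X.:+ ue) X.:+ ((sa X.:+ pa) X.:+ (sb X.:+ pb)) X.:= ((uc X.:+ ud) X.:+ (sa X.:+ sb)) X.:+ ((ud X.:+ ue) X.:+ (pa X.:+ pb)))
        refl uc ud ue sa sb pa pb)
      (trans (cong₂ _xor_ e₁ e₂)
        (X.solve 6 (λ ac ad ae bc bd be →
          ((ac X.:+ ad) X.:+ (bc X.:+ bd)) X.:+ ((ad X.:+ ae) X.:+ (bd X.:+ be)) X.:= (ac X.:+ ae) X.:+ (bc X.:+ be))
          refl ac ad ae bc bd be))

  xor-cancel₄ : ∀ u s t → (u xor u) xor (false xor false) ≡ (s xor s) xor (t xor t)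
  xor-cancel₄ u s t rewrite xor-same u | xor-same s | xor-same t = refl

  balanced-path : ∀ a b c l → (∀ p → OnSegment p a b → OnPolyline p (c ∷ l) → ⊥) → let d = lastPoint c l in
    (under a b c xor under a b d) xor (underPath c l a xor underPath c l b) ≡ Interleave lt a b c d
  balanced-path a b c [] _ = xor-cancel₄ (under a b c) (lt a c) (lt b c)
  balanced-path a b c (d ∷ l) dis = additive
    (under a b c) (under a b d) (under a b e) (under c d a) (under c d b) (underPath d l a) (underPath d l b)
    (lt a c) (lt a d) (lt a e) (lt b c) (lt b d) (lt b e)
    (balanced (λ (meeting p on on′) → dis p on (inj₁ on′)))
    (balanced-path a b d l (λ p on on′ → dis p on (inj₂ on′)))
    where
    e = lastPoint d l

  balanced-paths : ∀ a k c l → (∀ p → OnPolyline p (a ∷ k) → OnPolyline p (c ∷ l) → ⊥) → let b = lastPoint a k ; d = lastPoint c l in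
    (underPath a k c xor underPath a k d) xor (underPath c l a xor underPath c l b) ≡ Interleave lt a b c d
  balanced-paths a [] c l _ = flat (underPath c l a) (lt a c) (lt a (lastPoint c l))
    where
    flat : ∀ u s t → (false xor false) xor (u xor u) ≡ (s xor t) xor (s xor t)
    flat u s t rewrite xor-same u | xor-same (s xor t) = refl
  balanced-paths a (b ∷ k) c l dis = trans (xor-comm (underPath a (b ∷ k) c xor underPath a (b ∷ k) d) _)
    (trans (additive
      (underPath c l a) (underPath c l b) (underPath c l e) (under a b c) (under a b d) (underPath b k c) (underPath b k d)
      (lt a c) (lt b c) (lt e c) (lt a d) (lt b d) (lt e d)
      (reshape (underPath c l a) (underPath c l b) (under a b c) (under a b d) (lt a c) (lt a d) (lt b c) (lt b d) (balanced-path a b c l (λ p on on′ → dis p (inj₁ on) on′)))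
      (reshape (underPath c l b) (underPath c l e) (underPath b k c) (underPath b k d) (lt b c) (lt b d) (lt e c) (lt e d) (balanced-paths b k c l (λ p on on′ → dis p (inj₂ on) on′))))
     (interchange (lt a c) (lt e c) (lt a d) (lt e d)))
    where
    d = lastPoint c l
    e = lastPoint b k
    reshape : ∀ u v x y s t z w → (x xor y) xor (u xor v) ≡ (s xor t) xor (z xor w) → (u xor v) xor (x xor y) ≡ (s xor z) xor (t xor w)
    reshape u v x y s t z w e = trans (xor-comm (u xor v) (x xor y)) (trans e (interchange s t z w))

  -- Parities attached to a drawing.

  -- What is kept of a drawing once the curves are forgotten: `l` compares abscissas, `x a b v` is
  -- the crossing parity of the edge ab with the ray from v. Balance is asked of independent edges
  -- only, because curves with a common end do meet.
  record Drawn {n} (l : Fin n → Fin n → Bool) (E : Fin n → Fin n → Set) : Set where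
    field
      l-antisym : ∀ {a b} → a ≢ b → l a b ≡ not (l b a)
      x         : Fin n → Fin n → Fin n → Bool
      x-sym     : ∀ a b v → x a b v ≡ x b a v
      x-balance : ∀ {a b c d} → E a b → E c d → a ≢ c → a ≢ d → b ≢ c → b ≢ d →
        (x a b c xor x a b d) xor (x c d a xor x c d b) ≡ Interleave l a b c d

  lastPoint-++ : ∀ a l b → lastPoint a (l ++ [ b ]) ≡ b
  lastPoint-++ a [] b = refl
  lastPoint-++ a (c ∷ l) b = lastPoint-++ c l b

  adj-irrefl : ∀ {n} (G : Graph n) {u} → ¬ Adj G u u
  adj-irrefl G {u} e with trans (sym e) (irrefl G u)
  ... | ()

  adj-sym : ∀ {n} (G : Graph n) {u v} → Adj G u v → Adj G v u
  adj-sym G {u} {v} e = trans (Graph.sym G v u) e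

  -- Curves are constrained for u < v only, so the parities of an edge are always read from its
  -- increasing direction. Independent edges have disjoint curves: a common point would be a vertex
  -- by `no-crossings`, and by `avoids-vertices` an end of both edges.
  planar⇒drawn : ∀ {n} {G : Graph n} → Planar G → ∃[ l ] Drawn l (Adj G)
  planar⇒drawn {n} {G} D = l , record
    { l-antisym = λ a≢b → lt-antisym (λ e → a≢b (pos-injective e))
    ; x = λ a b v → x′ a b v (a Fin.<? b)
    ; x-sym = λ a b v → symmetric a b v (a Fin.<? b) (b Fin.<? a)
    ; x-balance = λ {a} {b} {c} {d} ab cd ac ad bc bd → balance ab cd ac ad bc bd (a Fin.<? b) (c Fin.<? d)
    }
    where
    open PlanarDrawing D
    l : Fin n → Fin n → Bool
    l a b = lt (pos a) (pos b)
    tail : Fin n → Fin n → List Point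
    tail a b = bends a b ++ [ pos b ]
    z : Fin n → Fin n → Fin n → Bool
    z a b v = underPath (pos a) (tail a b) (pos v)
    x′ : ∀ a b v → Dec (a Fin.< b) → Bool
    x′ a b v (yes _) = z a b v
    x′ a b v (no _) = z b a v
    symmetric : ∀ a b v (p : Dec (a Fin.< b)) (q : Dec (b Fin.< a)) → x′ a b v p ≡ x′ b a v q
    symmetric a b v (yes p) (yes q) = contradiction q (Fin.<-asym p)
    symmetric a b v (yes p) (no q) = refl
    symmetric a b v (no p) (yes q) = refl
    symmetric a b v (no p) (no q) with Fin.<-cmp a b
    ... | tri< a<b _ _ = contradiction a<b p
    ... | tri≈ _ refl _ = refl
    ... | tri> _ _ b<a = contradiction b<a q
    oriented : ∀ {a b c d} → a Fin.< b → c Fin.< d → Adj G a b → Adj G c d → a ≢ c → a ≢ d → b ≢ c → b ≢ d →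
      (z a b c xor z a b d) xor (z c d a xor z c d b) ≡ Interleave l a b c d
    oriented {a} {b} {c} {d} a<b c<d ab cd a≢c a≢d b≢c b≢d =
      subst₂ (λ p q → (z a b c xor underPath (pos a) (tail a b) q) xor (z c d a xor underPath (pos c) (tail c d) p) ≡ Interleave lt (pos a) p (pos c) q)
        (lastPoint-++ (pos a) (bends a b) (pos b)) (lastPoint-++ (pos c) (bends c d) (pos d))
        (balanced-paths (pos a) (tail a b) (pos c) (tail c d) disjoint)
      where
      disjoint : ∀ p → OnPolyline p (curve a b) → OnPolyline p (curve c d) → ⊥
      disjoint p on on′ with no-crossings a b c d p a<b ab c<d cd (λ e → a≢c (cong proj₁ e)) on on′
      ... | w , e with avoids-vertices a b w p a<b ab on e | avoids-vertices c d w p c<d cd on′ e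
      ... | inj₁ refl | inj₁ r = a≢c r
      ... | inj₁ refl | inj₂ r = a≢d r
      ... | inj₂ refl | inj₁ r = b≢c r
      ... | inj₂ refl | inj₂ r = b≢d r
    flip : ∀ {a b} → Adj G a b → ¬ a Fin.< b → b Fin.< a
    flip {a} {b} ab a≮b with Fin.<-cmp a b
    ... | tri< a<b _ _ = contradiction a<b a≮b
    ... | tri≈ _ refl _ = contradiction ab (adj-irrefl G)
    ... | tri> _ _ b<a = b<a
    swap₁ : ∀ a b c d {X Y S T : Bool} → (X xor Y) xor (S xor T) ≡ (l b c xor l b d) xor (l a c xor l a d) →
      (X xor Y) xor (T xor S) ≡ Interleave l a b c d
    swap₁ a b c d {X} {Y} {S} {T} = swapˡ X Y S T (l b c) (l b d) (l a c) (l a d)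
    swap₂ : ∀ a b c d {X Y S T : Bool} → (X xor Y) xor (S xor T) ≡ (l a d xor l a c) xor (l b d xor l b c) →
      (Y xor X) xor (S xor T) ≡ Interleave l a b c d
    swap₂ a b c d {X} {Y} {S} {T} e = trans (cong (_xor (S xor T)) (xor-comm Y X)) (trans e (cong₂ _xor_ (xor-comm (l a d) _) (xor-comm (l b d) _)))
    balance : ∀ {a b c d} → Adj G a b → Adj G c d → a ≢ c → a ≢ d → b ≢ c → b ≢ d → (p : Dec (a Fin.< b)) (q : Dec (c Fin.< d)) →
      (x′ a b c p xor x′ a b d p) xor (x′ c d a q xor x′ c d b q) ≡ Interleave l a b c d
    balance ab cd ac ad bc bd (yes p) (yes q) = oriented p q ab cd ac ad bc bd
    balance {a} {b} {c} {d} ab cd ac ad bc bd (yes p) (no q) =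
      swap₂ a b c d {z a b d} {z a b c} {z d c a} {z d c b} (oriented p (flip cd q) ab (adj-sym G cd) ad ac bd bc)
    balance {a} {b} {c} {d} ab cd ac ad bc bd (no p) (yes q) =
      swap₁ a b c d {z b a c} {z b a d} {z c d b} {z c d a} (oriented (flip ab p) q (adj-sym G ab) cd bc bd ac ad)
    balance {a} {b} {c} {d} ab cd ac ad bc bd (no p) (no q) =
      swap₂ a b c d {z b a d} {z b a c} {z d c a} {z d c b}
        (swap₁ a b d c {z b a d} {z b a c} {z d c b} {z d c a} (oriented (flip ab p) (flip cd q) (adj-sym G ab) (adj-sym G cd) bd bc ad ac))

-- Indicator functions and double counting.

module Sums where

  open import Data.Nat using (ℕ; zero; suc; _+_; _*_; _≤_; _<_; z≤n; s≤s)
  open import Data.Nat.Properties as ℕ using (+-*-semiring)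
  open import Data.Fin using (Fin; zero; suc; _↑ˡ_; _↑ʳ_; combine)
  open import Data.Fin.Properties as Fin using (_≟_)
  open import Data.Product using (_×_; _,_; ∃-syntax)
  open import Data.Bool using (if_then_else_)
  open import Relation.Nullary using (¬_; Dec; yes; no; does; contradiction)
  open import Relation.Nullary.Decidable using (dec-true; dec-false; _×-dec_; _⊎-dec_)
  open import Data.Sum using (_⊎_; inj₁; inj₂)
  open import Relation.Binary.PropositionalEquality
  open import Algebra.Properties.Semiring.Sum +-*-semiring using (sum; sum-cong-≗; ∑-distrib-+; ∑-comm)

  # : ∀ {a} {P : Set a} → Dec P → ℕ
  # d = if does d then 1 else 0

  #-yes : ∀ {P : Set} (d : Dec P) → P → # d ≡ 1
  #-yes d p = cong (if_then 1 else 0) (dec-true d p)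

  #-no : ∀ {P : Set} (d : Dec P) → ¬ P → # d ≡ 0
  #-no d p = cong (if_then 1 else 0) (dec-false d p)

  #-mono : ∀ {P Q : Set} (d : Dec P) (e : Dec Q) → (P → Q) → # d ≤ # e
  #-mono (yes p) e f rewrite #-yes e (f p) = ℕ.≤-refl
  #-mono (no _) e f = z≤n

  #-cong : ∀ {P Q : Set} (d : Dec P) (e : Dec Q) → (P → Q) → (Q → P) → # d ≡ # e
  #-cong d e f g = ℕ.≤-antisym (#-mono d e f) (#-mono e d g)

  #-pos : ∀ {P : Set} (d : Dec P) → 1 ≤ # d → P
  #-pos (yes p) _ = p

  #≤1 : ∀ {P : Set} (d : Dec P) → # d ≤ 1
  #≤1 (yes _) = ℕ.≤-refl
  #≤1 (no _) = z≤n

  sum-mono : ∀ {n} {f g : Fin n → ℕ} → (∀ i → f i ≤ g i) → sum f ≤ sum g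
  sum-mono {zero} h = z≤n
  sum-mono {suc n} h = ℕ.+-mono-≤ (h zero) (sum-mono (λ i → h (suc i)))

  sum-const : ∀ n k → sum {n} (λ _ → k) ≡ n * k
  sum-const zero k = refl
  sum-const (suc n) k = cong (k +_) (sum-const n k)

  sum-zero : ∀ {n} (f : Fin n → ℕ) → (∀ i → f i ≡ 0) → sum f ≡ 0
  sum-zero {n} f h = trans (sum-cong-≗ h) (trans (sum-const n 0) (ℕ.*-zeroʳ n))

  sum-point : ∀ {n} (i : Fin n) (f : Fin n → ℕ) → sum (λ j → # (j ≟ i) * f j) ≡ f i
  sum-point {suc n} zero f = trans (cong₂ _+_ (ℕ.+-identityʳ (f zero)) (sum-zero {n} (λ j → # (suc j ≟ zero {n}) * f (suc j)) (λ i → refl))) (ℕ.+-identityʳ (f zero))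
  sum-point {suc n} (suc i) f = trans (sum-cong-≗ (λ j → cong (_* f (suc j)) (#-cong (suc j ≟ suc i) (j ≟ i) (λ { refl → refl }) (cong suc))))
    (sum-point i (λ j → f (suc j)))

  term≤sum : ∀ {n} (f : Fin n → ℕ) i → f i ≤ sum f
  term≤sum f zero = ℕ.m≤m+n _ _
  term≤sum f (suc i) = ℕ.≤-trans (term≤sum (λ j → f (suc j)) i) (ℕ.m≤n+m _ _)

  sum>0 : ∀ {n} (f : Fin n → ℕ) → 1 ≤ sum f → ∃[ i ] 1 ≤ f i
  sum>0 {suc n} f h with f zero in e
  ... | suc k = zero , subst (1 ≤_) (sym e) (s≤s z≤n)
  ... | zero with sum>0 (λ i → f (suc i)) h
  ... | i , p = suc i , p

  sum-below : ∀ {n} {f g : Fin n → ℕ} → sum f < sum g → ∃[ i ] f i < g i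
  sum-below {suc n} {f} {g} h with f zero ℕ.<? g zero
  ... | yes p = zero , p
  ... | no ¬p with sum-below (ℕ.+-cancelˡ-< (g zero) _ _ (ℕ.≤-<-trans (ℕ.+-monoˡ-≤ _ (ℕ.≮⇒≥ ¬p)) h))
  ... | i , q = suc i , q

  sum-unique : ∀ {n} {P : Fin n → Set} (P? : ∀ i → Dec (P i)) → (∀ {i j} → P i → P j → i ≡ j) → sum (λ i → # (P? i)) ≤ 1
  sum-unique {zero} P? u = z≤n
  sum-unique {suc n} {P} P? u with P? zero
  ... | yes p = s≤s (ℕ.≤-reflexive (sum-zero _ (λ i → #-no (P? (suc i)) (λ q → contradiction (u p q) λ ()))))
  ... | no _ = sum-unique (λ i → P? (suc i)) (λ p q → Fin.suc-injective (u p q))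

  ≤1-unique : ∀ {n} {P : Fin n → Set} (P? : ∀ i → Dec (P i)) → sum (λ i → # (P? i)) ≤ 1 → ∀ {i j} → P i → P j → i ≡ j
  ≤1-unique P? h {zero} {zero} p q = refl
  ≤1-unique {suc n} P? h {zero} {suc j} p q = contradiction (ℕ.≤-trans (ℕ.+-mono-≤ (ℕ.≤-reflexive (sym (#-yes (P? zero) p)))
    (ℕ.≤-trans (ℕ.≤-reflexive (sym (#-yes (P? (suc j)) q))) (term≤sum (λ i → # (P? (suc i))) j))) h) λ { (s≤s ()) }
  ≤1-unique P? h {suc i} {zero} p q = sym (≤1-unique P? h {zero} {suc i} q p)
  ≤1-unique P? h {suc i} {suc j} p q = cong suc (≤1-unique (λ i → P? (suc i)) (ℕ.≤-trans (ℕ.m≤n+m _ _) h) p q)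

  #-× : ∀ {P Q : Set} (d : Dec P) (e : Dec Q) → # (d ×-dec e) ≡ # d * # e
  #-× (yes _) (yes _) = refl
  #-× (yes _) (no _) = refl
  #-× (no _) _ = refl

  #-cover : ∀ {P Q R S : Set} (d : Dec P) (q : Dec Q) (r : Dec R) (s : Dec S) →
    (P → Q ⊎ R ⊎ S) → # d ≤ # q + (# r + # s)
  #-cover (no _) q r s f = z≤n
  #-cover (yes p) q r s f with f p
  ... | inj₁ x rewrite #-yes q x = s≤s z≤n
  ... | inj₂ (inj₁ x) rewrite #-yes r x = ℕ.≤-trans (s≤s z≤n) (ℕ.m≤n+m _ (# q))
  ... | inj₂ (inj₂ x) rewrite #-yes s x = ℕ.≤-trans (ℕ.m≤n+m 1 (# r)) (ℕ.m≤n+m _ (# q))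

  #-exclusive : ∀ {P Q R S : Set} (d : Dec P) (q : Dec Q) (r : Dec R) (s : Dec S) →
    (P → S) → (Q → S) → (R → S) → ¬ (P × Q) → ¬ (P × R) → ¬ (Q × R) → # d + (# q + # r) ≤ # s
  #-exclusive (yes x) (yes y) _ s f g h pq pr qr = contradiction (x , y) pq
  #-exclusive (yes x) (no _) (yes z) s f g h pq pr qr = contradiction (x , z) pr
  #-exclusive (yes x) (no _) (no _) s f g h pq pr qr = ℕ.≤-reflexive (sym (#-yes s (f x)))
  #-exclusive (no _) (yes y) (yes z) s f g h pq pr qr = contradiction (y , z) qr
  #-exclusive (no _) (yes y) (no _) s f g h pq pr qr = ℕ.≤-reflexive (sym (#-yes s (g y)))
  #-exclusive (no _) (no _) (yes z) s f g h pq pr qr = ℕ.≤-reflexive (sym (#-yes s (h z)))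
  #-exclusive (no _) (no _) (no _) s f g h pq pr qr = z≤n

  ∑∑-distrib-+ : ∀ {m n} (f g : Fin m → Fin n → ℕ) →
    sum (λ i → sum (λ j → f i j + g i j)) ≡ sum (λ i → sum (f i)) + sum (λ i → sum (g i))
  ∑∑-distrib-+ f g = trans (sum-cong-≗ (λ i → ∑-distrib-+ (f i) (g i))) (∑-distrib-+ (λ i → sum (f i)) (λ i → sum (g i)))

  sum-cross : ∀ {n} (b : Fin n) (f : Fin n → ℕ) →
    sum (λ p → sum (λ q → # (p ≟ b) * f q + # (q ≟ b) * f p)) ≡ sum f + sum f
  sum-cross b f = trans (∑∑-distrib-+ (λ p q → # (p ≟ b) * f q) (λ p q → # (q ≟ b) * f p))
    (cong₂ _+_ (trans (∑-comm (λ p q → # (p ≟ b) * f q)) (sum-cong-≗ (λ q → sum-point b (λ _ → f q))))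
               (sum-cong-≗ (λ p → sum-point b (λ _ → f p))))

  #-⊎ : ∀ {P Q : Set} (d : Dec P) (e : Dec Q) → # (d ⊎-dec e) ≤ # d + # e
  #-⊎ (yes _) e = s≤s z≤n
  #-⊎ (no _) (yes _) = ℕ.≤-refl
  #-⊎ (no _) (no _) = z≤n

  sum-↑ : ∀ a {b} (f : Fin (a + b) → ℕ) → sum f ≡ sum (λ i → f (i ↑ˡ b)) + sum (λ j → f (a ↑ʳ j))
  sum-↑ zero f = refl
  sum-↑ (suc a) f = trans (cong (f zero +_) (sum-↑ a (λ i → f (suc i)))) (sym (ℕ.+-assoc (f zero) _ _))

  sum-combine : ∀ a {b} (f : Fin (a * b) → ℕ) → sum f ≡ sum (λ (i : Fin a) → sum (λ (j : Fin b) → f (combine i j)))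
  sum-combine zero f = refl
  sum-combine (suc a) {b} f = trans (sum-↑ b f) (cong (sum (λ j → f (j ↑ˡ (a * b))) +_) (sum-combine a (λ i → f (b ↑ʳ i))))

-- The parity obstruction to K₅ and Mader's edge bound.

module Sparsity where

  open Crossings using (Drawn; Interleave; Interleave-sym; interchange; additive)
  open Sums
  open import Data.Nat using (ℕ; zero; suc; _+_; _*_; _≤_; z≤n; s≤s; s≤s⁻¹; >-nonZero)
  open import Data.Nat.Properties as ℕ using (+-*-semiring)
  open import Data.Bool using (Bool; true; false; _xor_; not)
  open import Data.Bool.Properties using (xor-comm)
  open import Data.Bool.Solver using (module xor-∧-Solver)
  open import Data.Maybe using (Maybe; just; nothing)
  open import Data.Fin as Fin using (Fin)
  open import Data.Fin.Properties as Fin using (_≟_)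
  open import Data.List using (List; []; _∷_; length)
  open import Data.List.Relation.Unary.All as All using (All; []; _∷_)
  open import Data.List.Relation.Unary.AllPairs using (AllPairs; []; _∷_)
  open import Data.Product using (∃-syntax; _×_; _,_; proj₁; proj₂)
  open import Data.Sum using (_⊎_; inj₁; inj₂)
  open import Data.Empty using (⊥)
  open import Relation.Nullary using (¬_; Dec; yes; no; contradiction)
  open import Relation.Nullary.Decidable using (_⊎-dec_; _×-dec_; ¬?)
  open import Relation.Binary.PropositionalEquality hiding ([_])
  open import Algebra.Properties.Semiring.Sum +-*-semiring using (sum; sum-cong-≗; ∑-distrib-+; *-distribˡ-sum)
  open import Data.Nat.Tactic.RingSolver using (solve-∀)
  private module X = xor-∧-Solver

  module _ {n} {l : Fin n → Fin n → Bool} {E : Fin n → Fin n → Set} (D : Drawn l E) where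
    open Drawn D

    private
      -- parity of the crossings of the triangle abc with the ray of v
      T : Fin n → Fin n → Fin n → Fin n → Bool
      T v a b c = (x a b v xor x a c v) xor x b c v

      -- Each of the six edges of K₄ lies in exactly two of its four triangles.
      triples : ∀ v a b c d → (T v a b c xor T v a b d) xor (T v a c d xor T v b c d) ≡ false
      triples v a b c d = X.solve 6 (λ ab ac ad bc bd cd →
        (((ab X.:+ ac) X.:+ bc) X.:+ ((ab X.:+ ad) X.:+ bd)) X.:+ (((ac X.:+ ad) X.:+ cd) X.:+ ((bc X.:+ bd) X.:+ cd)) X.:= X.con false)
        refl (x a b v) (x a c v) (x a d v) (x b c v) (x b d v) (x c d v)

    -- Any linear order makes exactly one of the three pairings of four vertices interleave.
    K₄-odd : ∀ {a b c d} → a ≢ b → a ≢ c → a ≢ d → b ≢ c → b ≢ d → c ≢ d →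
      E a b → E a c → E a d → E b c → E b d → E c d →
      (T a b c d xor T b a c d) xor (T c a b d xor T d a b c) ≡ true
    K₄-odd {a} {b} {c} {d} a≢b a≢c a≢d b≢c b≢d c≢d ab ac ad bc bd cd =
      -- The twelve parities regroup into the three pairings of a, b, c, d into independent edges,
      -- to each of which `x-balance` applies.
      trans (X.solve 12 (λ abc abd cda cdb acb acd bda bdc adb adc bca bcd →
          (((bca X.:+ bda) X.:+ cda) X.:+ ((acb X.:+ adb) X.:+ cdb)) X.:+ (((abc X.:+ adc) X.:+ bdc) X.:+ ((abd X.:+ acd) X.:+ bcd))
          X.:= ((abc X.:+ abd) X.:+ (cda X.:+ cdb)) X.:+ (((acb X.:+ acd) X.:+ (bda X.:+ bdc)) X.:+ ((adb X.:+ adc) X.:+ (bca X.:+ bcd))))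
          refl (x a b c) (x a b d) (x c d a) (x c d b) (x a c b) (x a c d) (x b d a) (x b d c) (x a d b) (x a d c) (x b c a) (x b c d))
        (trans (cong₂ _xor_ (x-balance ab cd a≢c a≢d b≢c b≢d)
                 (cong₂ _xor_ (x-balance ac bd a≢b a≢d (≢-sym b≢c) c≢d) (x-balance ad bc a≢b a≢c (≢-sym b≢d) (≢-sym c≢d))))
          (one-pairing (l-antisym (≢-sym b≢c)) (l-antisym (≢-sym b≢d)) (l-antisym (≢-sym c≢d))))
      where
      one-pairing : l c b ≡ not (l b c) → l d b ≡ not (l b d) → l d c ≡ not (l c d) →
        Interleave l a b c d xor (Interleave l a c b d xor Interleave l a d b c) ≡ true
      one-pairing cb db dc rewrite cb | db | dc = X.solve 6 (λ ab ac ad bc bd cd →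
        let ¬_ = X.con true X.:+_ in
        ((ac X.:+ ad) X.:+ (bc X.:+ bd)) X.:+ (((ab X.:+ ad) X.:+ ((¬ bc) X.:+ cd)) X.:+ ((ab X.:+ ac) X.:+ ((¬ bd) X.:+ (¬ cd)))) X.:= X.con true)
        refl (l a b) (l a c) (l a d) (l b c) (l b d) (l c d)

    -- The sum of `K₄-odd` over the five K₄ is odd. Sorted by the vertex whose ray is crossed, the
    -- same terms are, for each vertex, the four triangles on the other four vertices, and these
    -- cancel by `triples`.
    no-K₅ : ∀ {a b c d e} → (∀ {u v} → E u v → u ≢ v) →
      E a b → E a c → E a d → E a e → E b c → E b d → E b e → E c d → E c e → E d e → ⊥
    no-K₅ {a} {b} {c} {d} {e} i ab ac ad ae bc bd be cd ce de = impossible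
      (trans (sym (cong₂ _xor_ (cong₂ _xor_ (K₄-odd (i ab) (i ac) (i ad) (i bc) (i bd) (i cd) ab ac ad bc bd cd) (K₄-odd (i ab) (i ac) (i ae) (i bc) (i be) (i ce) ab ac ae bc be ce))
          (cong₂ _xor_ (K₄-odd (i ab) (i ad) (i ae) (i bd) (i be) (i de) ab ad ae bd be de)
            (cong₂ _xor_ (K₄-odd (i ac) (i ad) (i ae) (i cd) (i ce) (i de) ac ad ae cd ce de) (K₄-odd (i bc) (i bd) (i be) (i cd) (i ce) (i de) bc bd be cd ce de)))))
        (trans (regroup (T a b c d) (T b a c d) (T c a b d) (T d a b c) (T a b c e) (T b a c e) (T c a b e) (T e a b c)
                        (T a b d e) (T b a d e) (T d a b e) (T e a b d) (T a c d e) (T c a d e) (T d a c e) (T e a c d)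
                        (T b c d e) (T c b d e) (T d b c e) (T e b c d))
          (cong₂ _xor_ (cong₂ _xor_ (triples a b c d e) (triples b a c d e))
            (cong₂ _xor_ (triples c a b d e) (cong₂ _xor_ (triples d a b c e) (triples e a b c d))))))
      where
      impossible : ¬ (true ≡ false)
      impossible ()
      regroup : ∀ a₁ b₁ c₁ d₁ a₂ b₂ c₂ e₁ a₃ b₃ d₂ e₂ a₄ c₃ d₃ e₃ b₄ c₄ d₄ e₄ →
        (((a₁ xor b₁) xor (c₁ xor d₁)) xor ((a₂ xor b₂) xor (c₂ xor e₁))) xor (((a₃ xor b₃) xor (d₂ xor e₂)) xor (((a₄ xor c₃) xor (d₃ xor e₃)) xor ((b₄ xor c₄) xor (d₄ xor e₄))))
        ≡ (((a₁ xor a₂) xor (a₃ xor a₄)) xor ((b₁ xor b₂) xor (b₃ xor b₄))) xor (((c₁ xor c₂) xor (c₃ xor c₄)) xor (((d₁ xor d₂) xor (d₃ xor d₄)) xor ((e₁ xor e₂) xor (e₃ xor e₄))))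
      regroup = X.solve 20 (λ a₁ b₁ c₁ d₁ a₂ b₂ c₂ e₁ a₃ b₃ d₂ e₂ a₄ c₃ d₃ e₃ b₄ c₄ d₄ e₄ →
        (((a₁ X.:+ b₁) X.:+ (c₁ X.:+ d₁)) X.:+ ((a₂ X.:+ b₂) X.:+ (c₂ X.:+ e₁))) X.:+ (((a₃ X.:+ b₃) X.:+ (d₂ X.:+ e₂)) X.:+ (((a₄ X.:+ c₃) X.:+ (d₃ X.:+ e₃)) X.:+ ((b₄ X.:+ c₄) X.:+ (d₄ X.:+ e₄))))
        X.:= (((a₁ X.:+ a₂) X.:+ (a₃ X.:+ a₄)) X.:+ ((b₁ X.:+ b₂) X.:+ (b₃ X.:+ b₄))) X.:+ (((c₁ X.:+ c₂) X.:+ (c₃ X.:+ c₄)) X.:+ (((d₁ X.:+ d₂) X.:+ (d₃ X.:+ d₄)) X.:+ ((e₁ X.:+ e₂) X.:+ (e₃ X.:+ e₄))))) refl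

  -- An edge of E′ is an edge of E or stands for a path of E of length two.
  -- Contracting the edge ab into a is the case in which every middle vertex is b.
  record Rerouted {n} (E E′ : Fin n → Fin n → Set) : Set where
    field
      mid     : Fin n → Fin n → Maybe (Fin n)
      mid-sym : ∀ p q → mid p q ≡ mid q p
      direct  : ∀ {p q} → E′ p q → mid p q ≡ nothing → E p q
      path    : ∀ {p q m} → E′ p q → mid p q ≡ just m → E p m × E m q
      avoid   : ∀ {p q r s m} → E′ p q → E′ r s → p ≢ r → p ≢ s → q ≢ r → q ≢ s → mid p q ≡ just m → m ≢ r × m ≢ s
      private-mid : ∀ {p q r s m} → E′ p q → E′ r s → p ≢ r → p ≢ s → q ≢ r → q ≢ s → mid p q ≡ just m → mid r s ≢ just m

  -- `avoid` and `private-mid` make every edge of one path independent of every edge of the other,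
  -- so `x-balance` holds for each such pair; adding these identities removes the middle vertices.
  drawn-reroute : ∀ {n} {l : Fin n → Fin n → Bool} {E E′} → Drawn l E → Rerouted E E′ → Drawn l E′
  drawn-reroute {n} {l} {E} {E′} D R = record
    { l-antisym = l-antisym
    ; x = λ p q → along (mid p q) p q
    ; x-sym = λ p q v → trans (cong (λ μ → along μ p q v) (mid-sym p q)) (along-sym (mid q p) p q v)
    ; x-balance = λ pq rs p≢r p≢s q≢r q≢s → both pq rs p≢r p≢s q≢r q≢s (mid _ _) refl (mid _ _) refl
    }
    where
    open Drawn D
    open Rerouted R
    along : Maybe (Fin n) → Fin n → Fin n → Fin n → Bool
    along nothing p q v = x p q v
    along (just m) p q v = x p m v xor x m q v
    along-sym : ∀ μ p q v → along μ p q v ≡ along μ q p v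
    along-sym nothing p q v = x-sym p q v
    along-sym (just m) p q v = trans (xor-comm (x p m v) _) (cong₂ _xor_ (x-sym m q v) (x-sym p m v))
    Balance : (ξ : Fin n → Bool) (a b : Fin n) (η : Fin n → Bool) (c d : Fin n) → Set
    Balance ξ a b η c d = (ξ c xor ξ d) xor (η a xor η b) ≡ Interleave l a b c d
    turn : ∀ ξ {a b} η {c d} → a ≢ c → a ≢ d → b ≢ c → b ≢ d → Balance ξ a b η c d → Balance η c d ξ a b
    turn ξ η ac ad bc bd e = trans (xor-comm (η _ xor η _) _)
      (trans e (Interleave-sym l (l-antisym (≢-sym ac)) (l-antisym (≢-sym bc)) (l-antisym (≢-sym ad)) (l-antisym (≢-sym bd))))
    concat : ∀ ξ₁ ξ₂ η {a m b c d} → Balance ξ₁ a m η c d → Balance ξ₂ m b η c d → Balance (λ v → ξ₁ v xor ξ₂ v) a b η c d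
    concat ξ₁ ξ₂ η {a} {m} {b} {c} {d} e₁ e₂ =
      trans (xor-comm ((ξ₁ c xor ξ₂ c) xor (ξ₁ d xor ξ₂ d)) _)
        (trans (additive (η a) (η m) (η b) (ξ₁ c) (ξ₁ d) (ξ₂ c) (ξ₂ d) (l a c) (l m c) (l b c) (l a d) (l m d) (l b d)
            (reshape (ξ₁ c xor ξ₁ d) (η a xor η m) (l a c) (l a d) (l m c) (l m d) e₁)
            (reshape (ξ₂ c xor ξ₂ d) (η m xor η b) (l m c) (l m d) (l b c) (l b d) e₂))
          (interchange (l a c) (l b c) (l a d) (l b d)))
      where
      reshape : ∀ u v s t z w → u xor v ≡ (s xor t) xor (z xor w) → v xor u ≡ (s xor z) xor (t xor w)
      reshape u v s t z w e = trans (xor-comm v u) (trans e (interchange s t z w))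
    edge-path : ∀ {a b c d} → E a b → E′ c d → a ≢ c → a ≢ d → b ≢ c → b ≢ d →
      ∀ μ → mid c d ≡ μ → (∀ {m} → μ ≡ just m → m ≢ a × m ≢ b) → Balance (x a b) a b (along μ c d) c d
    edge-path ab cd ac ad bc bd nothing e _ = x-balance ab (direct cd e) ac ad bc bd
    edge-path {a} {b} {c} {d} ab cd ac ad bc bd (just m) e av =
      turn (along (just m) c d) (x a b) (≢-sym ac) (≢-sym bc) (≢-sym ad) (≢-sym bd)
        (concat (x c m) (x m d) (x a b)
          (x-balance (proj₁ (path cd e)) ab (≢-sym ac) (≢-sym bc) (proj₁ (av refl)) (proj₂ (av refl)))
          (x-balance (proj₂ (path cd e)) ab (proj₁ (av refl)) (proj₂ (av refl)) (≢-sym ad) (≢-sym bd)))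
    both : ∀ {a b c d} → E′ a b → E′ c d → a ≢ c → a ≢ d → b ≢ c → b ≢ d →
      ∀ μ → mid a b ≡ μ → ∀ ν → mid c d ≡ ν → Balance (along μ a b) a b (along ν c d) c d
    both ab cd ac ad bc bd nothing e ν f =
      edge-path (direct ab e) cd ac ad bc bd ν f (λ { refl → avoid cd ab (≢-sym ac) (≢-sym bc) (≢-sym ad) (≢-sym bd) f })
    both {a} {b} {c} {d} ab cd ac ad bc bd (just m) e ν f = concat (x a m) (x m b) (along ν c d)
      (edge-path (proj₁ (path ab e)) cd ac ad mc md ν f (λ { {m′} refl → proj₁ (av refl) , m′≢m refl }))
      (edge-path (proj₂ (path ab e)) cd mc md bc bd ν f (λ { {m′} refl → m′≢m refl , proj₂ (av refl) }))
      where
      mc = proj₁ (avoid ab cd ac ad bc bd e)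
      md = proj₂ (avoid ab cd ac ad bc bd e)
      av : ∀ {m′} → ν ≡ just m′ → m′ ≢ a × m′ ≢ b
      av refl = avoid cd ab (≢-sym ac) (≢-sym bc) (≢-sym ad) (≢-sym bd) f
      m′≢m : ∀ {m′} → ν ≡ just m′ → m′ ≢ m
      m′≢m refl refl = private-mid ab cd ac ad bc bd e f

  -- A graph E on the vertex set X, in a drawn graph in which the pairwise
  -- adjacent vertices T outside X are joined to all of X.
  record Coned {n} (l : Fin n → Fin n → Bool) (T : List (Fin n)) : Set₁ where
    field
      E      : Fin n → Fin n → Set
      E?     : ∀ a b → Dec (E a b)
      E-sym  : ∀ {a b} → E a b → E b a
      E-irr  : ∀ {a b} → E a b → a ≢ b
      drawn  : Drawn l E
      X      : Fin n → Set
      X?     : ∀ a → Dec (X a)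
      T-T    : AllPairs E T
      T-X    : All (λ z → ∀ {a} → X a → E z a) T

    size : ℕ
    size = sum (λ a → # (X? a))
    edge? : ∀ a b → Dec (X a × X b × E a b)
    edge? a b = X? a ×-dec X? b ×-dec E? a b
    -- each edge counted in both directions
    edges : ℕ
    edges = sum (λ a → sum (λ b → # (edge? a b)))
    common? : ∀ a b w → Dec (X w × E a w × E b w)
    common? a b w = X? w ×-dec E? a w ×-dec E? b w
    common : Fin n → Fin n → ℕ
    common a b = sum (λ w → # (common? a b w))

  module _ {n} {l : Fin n → Fin n → Bool} {T : List (Fin n)} (G : Coned l T) where
    open Coned G

    module Contraction (a b : Fin n) (Xa : X a) (Xb : X b) (ab : E a b) where

      -- The vertex `b` becomes isolated instead of disappearing, so that the vertex type and the
      -- order `l` stay fixed. Where an edge of `E` exists already, it is used directly rather than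
      -- through `b`.
      E′ : Fin n → Fin n → Set
      E′ p q = p ≢ b × q ≢ b × (E p q ⊎ ((p ≡ a × q ≢ a × E b q) ⊎ (q ≡ a × p ≢ a × E p b)))

      E′? : ∀ p q → Dec (E′ p q)
      E′? p q = ¬? (p ≟ b) ×-dec ¬? (q ≟ b) ×-dec (E? p q ⊎-dec ((p ≟ a ×-dec ¬? (q ≟ a) ×-dec E? b q) ⊎-dec (q ≟ a ×-dec ¬? (p ≟ a) ×-dec E? p b)))

      X′ : Fin n → Set
      X′ p = X p × p ≢ b

      rerouted : Rerouted E E′
      rerouted = record
        { mid = λ p q → via (E? p q)
        ; mid-sym = λ p q → via-sym (E? p q) (E? q p)
        ; direct = λ {p} {q} → direct (E? p q)
        ; path = λ {p} {q} → path (E? p q)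
        ; avoid = λ {p} {q} → avoid (E? p q)
        ; private-mid = λ {p} {q} {r} {s} → private-mid (E? p q) (E? r s)
        }
        where
        via : ∀ {p q} → Dec (E p q) → Maybe (Fin n)
        via (yes _) = nothing
        via (no _) = just b
        via-sym : ∀ {p q} (d : Dec (E p q)) (e : Dec (E q p)) → via d ≡ via e
        via-sym (yes _) (yes _) = refl
        via-sym (no _) (no _) = refl
        via-sym (yes e) (no ¬e) = contradiction (E-sym e) ¬e
        via-sym (no ¬e) (yes e) = contradiction (E-sym e) ¬e
        direct : ∀ {p q} (d : Dec (E p q)) → E′ p q → via d ≡ nothing → E p q
        direct (yes e) _ _ = e
        path : ∀ {p q m} (d : Dec (E p q)) → E′ p q → via d ≡ just m → E p m × E m q
        path (no ¬e) (_ , _ , inj₁ e) refl = contradiction e ¬e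
        path (no ¬e) (_ , _ , inj₂ (inj₁ (refl , _ , bq))) refl = ab , bq
        path (no ¬e) (_ , _ , inj₂ (inj₂ (refl , _ , pb))) refl = pb , E-sym ab
        -- Every edge routed through b ends at a, so two independent edges never both use b.
        at-a : ∀ {p q} → ¬ E p q → E′ p q → p ≡ a ⊎ q ≡ a
        at-a ¬e (_ , _ , inj₁ e) = contradiction e ¬e
        at-a ¬e (_ , _ , inj₂ (inj₁ (e , _))) = inj₁ e
        at-a ¬e (_ , _ , inj₂ (inj₂ (e , _))) = inj₂ e
        avoid : ∀ {p q r s m} (d : Dec (E p q)) → E′ p q → E′ r s → p ≢ r → p ≢ s → q ≢ r → q ≢ s → via d ≡ just m → m ≢ r × m ≢ s
        avoid (no _) _ (r≢b , s≢b , _) _ _ _ _ refl = ≢-sym r≢b , ≢-sym s≢b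
        private-mid : ∀ {p q r s m} (d : Dec (E p q)) (d′ : Dec (E r s)) → E′ p q → E′ r s → p ≢ r → p ≢ s → q ≢ r → q ≢ s → via d ≡ just m → via d′ ≢ just m
        private-mid (no ¬e) (no ¬f) e f pr ps qr qs refl refl with at-a ¬e e | at-a ¬f f
        ... | inj₁ refl | inj₁ refl = pr refl
        ... | inj₁ refl | inj₂ refl = ps refl
        ... | inj₂ refl | inj₁ refl = qr refl
        ... | inj₂ refl | inj₂ refl = qs refl

      contracted : Coned l T
      contracted = record
        { E = E′ ; E? = E′? ; X = X′ ; X? = λ p → X? p ×-dec ¬? (p ≟ b)
        ; E-sym = λ { (p , q , inj₁ e) → q , p , inj₁ (E-sym e)
                    ; (p , q , inj₂ (inj₁ (r , s , e))) → q , p , inj₂ (inj₂ (r , s , E-sym e))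
                    ; (p , q , inj₂ (inj₂ (r , s , e))) → q , p , inj₂ (inj₁ (r , s , E-sym e)) }
        ; E-irr = λ { (_ , _ , inj₁ e) → E-irr e
                    ; (_ , _ , inj₂ (inj₁ (refl , s , _))) → ≢-sym s
                    ; (_ , _ , inj₂ (inj₂ (refl , s , _))) → s }
        ; drawn = drawn-reroute drawn rerouted
        ; T-T = lift T-X T-T
        ; T-X = All.map (λ z-X {_} (Xp , p≢b) → E-irr (z-X Xb) , p≢b , inj₁ (z-X Xp)) T-X
        }
        where
        lift : ∀ {T} → All (λ z → ∀ {a} → X a → E z a) T → AllPairs E T → AllPairs E′ T
        lift [] [] = []
        lift (z-X ∷ T-X) (z-T ∷ T-T) = All.zipWith (λ (e , w-X) → E-irr (z-X Xb) , E-irr (w-X Xb) , inj₁ e) (z-T , T-X) ∷ lift T-X T-T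

      private module C = Coned contracted

      size-contracted : size ≡ C.size + 1
      size-contracted = trans (sum-cong-≗ split) (trans (∑-distrib-+ (λ p → # (C.X? p)) (λ p → # (p ≟ b) * 1))
        (cong (C.size +_) (sum-point b (λ _ → 1))))
        where
        split : ∀ p → # (X? p) ≡ # (C.X? p) + # (p ≟ b) * 1
        split p with p ≟ b | X? p
        ... | yes refl | yes _ = refl
        ... | yes refl | no ¬Xb = contradiction Xb ¬Xb
        ... | no _ | yes _ = refl
        ... | no _ | no _ = refl

      -- All edges at b are lost. Those to `N`, the neighbours of b that are neither a nor adjacent
      -- to a, reappear at a; what is gone for good is the edge ab and one edge for each common
      -- neighbour. The factor 2 comes from counting both directions.
      edges-contracted : edges ≤ C.edges + 2 * (1 + common a b)
      edges-contracted = begin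
        edges                                                        ≤⟨ sum-mono (λ p → sum-mono (λ q → lost p q)) ⟩
        sum (λ p → sum (λ q → kept p q + (# (p ≟ b) * g q + # (q ≟ b) * g p))) ≡⟨ ∑∑-distrib-+ kept (λ p q → # (p ≟ b) * g q + # (q ≟ b) * g p) ⟩
        K + sum (λ p → sum (λ q → # (p ≟ b) * g q + # (q ≟ b) * g p)) ≡⟨ cong (K +_) (sum-cross b g) ⟩
        K + (sum g + sum g)                                          ≤⟨ ℕ.+-monoʳ-≤ K (ℕ.+-mono-≤ degree-b degree-b) ⟩
        K + ((sum N + (1 + common a b)) + (sum N + (1 + common a b))) ≡⟨ arith K (sum N) (1 + common a b) ⟩
        (K + (sum N + sum N)) + 2 * (1 + common a b)                 ≤⟨ ℕ.+-monoˡ-≤ _ gained ⟩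
        C.edges + 2 * (1 + common a b)                               ∎
        where
        open ℕ.≤-Reasoning
        arith : ∀ k n c → k + ((n + c) + (n + c)) ≡ (k + (n + n)) + 2 * c
        arith = solve-∀
        kept? : ∀ p q → Dec ((X p × p ≢ b) × (X q × q ≢ b) × E p q)
        kept? p q = (X? p ×-dec ¬? (p ≟ b)) ×-dec (X? q ×-dec ¬? (q ≟ b)) ×-dec E? p q
        kept : Fin n → Fin n → ℕ
        kept p q = # (kept? p q)
        K : ℕ
        K = sum (λ p → sum (kept p))
        g : Fin n → ℕ
        g q = # (edge? b q)
        new? : ∀ q → Dec ((X q × q ≢ b) × q ≢ a × E b q × ¬ E a q)
        new? q = (X? q ×-dec ¬? (q ≟ b)) ×-dec ¬? (q ≟ a) ×-dec E? b q ×-dec ¬? (E? a q)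
        N : Fin n → ℕ
        N q = # (new? q)
        lost : ∀ p q → # (edge? p q) ≤ kept p q + (# (p ≟ b) * g q + # (q ≟ b) * g p)
        lost p q = subst₂ (λ s t → # (edge? p q) ≤ kept p q + (s + t)) (#-× (p ≟ b) (edge? b q)) (#-× (q ≟ b) (edge? b p))
          (#-cover (edge? p q) (kept? p q) (p ≟ b ×-dec edge? b q) (q ≟ b ×-dec edge? b p) classify)
          where
          classify : X p × X q × E p q → _
          classify (Xp , Xq , e) with p ≟ b | q ≟ b
          ... | yes refl | _ = inj₂ (inj₁ (refl , Xp , Xq , e))
          ... | no _ | yes refl = inj₂ (inj₂ (refl , Xq , Xp , E-sym e))
          ... | no p≢b | no q≢b = inj₁ ((Xp , p≢b) , (Xq , q≢b) , e)
        degree-b : sum g ≤ sum N + (1 + common a b)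
        degree-b = begin
          sum g                                                           ≤⟨ sum-mono bound ⟩
          sum (λ q → N q + (# (q ≟ a) * 1 + # (common? a b q)))           ≡⟨ ∑-distrib-+ N _ ⟩
          sum N + sum (λ q → # (q ≟ a) * 1 + # (common? a b q))           ≡⟨ cong (sum N +_) (∑-distrib-+ (λ q → # (q ≟ a) * 1) _) ⟩
          sum N + (sum (λ q → # (q ≟ a) * 1) + common a b)                ≡⟨ cong (λ z → sum N + (z + common a b)) (sum-point a (λ _ → 1)) ⟩
          sum N + (1 + common a b)                                        ∎
          where
          bound : ∀ q → g q ≤ N q + (# (q ≟ a) * 1 + # (common? a b q))
          bound q = subst (λ s → g q ≤ N q + (s + # (common? a b q))) (sym (ℕ.*-identityʳ (# (q ≟ a))))
            (#-cover (edge? b q) (new? q) (q ≟ a) (common? a b q) classify)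
            where
            classify : X b × X q × E b q → _
            classify (_ , Xq , e) with q ≟ a | E? a q
            ... | yes q≡a | _ = inj₂ (inj₁ q≡a)
            ... | no _ | yes aq = inj₂ (inj₂ (Xq , aq , e))
            ... | no q≢a | no ¬aq = inj₁ ((Xq , ≢-sym (E-irr e)) , q≢a , e , ¬aq)
        gained : K + (sum N + sum N) ≤ C.edges
        gained = begin
          K + (sum N + sum N)                                                      ≡⟨ cong (K +_) (sum-cross a N) ⟨
          K + sum (λ p → sum (λ q → # (p ≟ a) * N q + # (q ≟ a) * N p))            ≡⟨ ∑∑-distrib-+ kept (λ p q → # (p ≟ a) * N q + # (q ≟ a) * N p) ⟨
          sum (λ p → sum (λ q → kept p q + (# (p ≟ a) * N q + # (q ≟ a) * N p)))   ≤⟨ sum-mono (λ p → sum-mono (λ q → bound p q)) ⟩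
          C.edges                                                                  ∎
          where
          a≢b = E-irr ab
          bound : ∀ p q → kept p q + (# (p ≟ a) * N q + # (q ≟ a) * N p) ≤ # (C.edge? p q)
          bound p q = subst₂ (λ s t → kept p q + (s + t) ≤ # (C.edge? p q)) (#-× (p ≟ a) (new? q)) (#-× (q ≟ a) (new? p))
            (#-exclusive (kept? p q) (p ≟ a ×-dec new? q) (q ≟ a ×-dec new? p) (C.edge? p q)
              (λ { (Xp , Xq , e) → Xp , Xq , proj₂ Xp , proj₂ Xq , inj₁ e })
              (λ { (refl , Xq , q≢a , bq , _) → (Xa , a≢b) , Xq , a≢b , proj₂ Xq , inj₂ (inj₁ (refl , q≢a , bq)) })
              (λ { (refl , Xp , p≢a , bp , _) → Xp , (Xa , a≢b) , proj₂ Xp , a≢b , inj₂ (inj₂ (refl , p≢a , E-sym bp)) })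
              (λ { ((_ , _ , e) , refl , _ , _ , _ , ¬e) → ¬e e })
              (λ { ((_ , _ , e) , refl , _ , _ , _ , ¬e) → ¬e (E-sym e) })
              (λ { ((refl , _) , _ , _ , p≢a , _) → p≢a refl }))

    link : ∀ v → X v → Coned l (v ∷ T)
    link v Xv = record
      { E = E ; E? = E? ; E-sym = E-sym ; E-irr = E-irr ; drawn = drawn
      ; X = λ w → X w × E v w ; X? = λ w → X? w ×-dec E? v w
      ; T-T = All.map (λ z-X → E-sym (z-X Xv)) T-X ∷ T-T
      ; T-X = proj₂ ∷ All.map (λ z-X {_} (Xw , _) → z-X Xw) T-X
      }

  -- Edges per vertex when `k` more apexes are missing to make three: 0, 1, 3, 7. The constant 14 in
  -- the later bounds is `2 * densityBound 3`, since `edges` counts both directions.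
  densityBound : ℕ → ℕ
  densityBound zero = 0
  densityBound (suc k) = 1 + 2 * densityBound k

  -- Mader's argument: contract an edge whose ends have few common neighbours;
  -- if there is none, the neighbourhood of a vertex is dense already.
  mader-step : ∀ {n} {l : Fin n → Fin n → Bool} {T} c →
    (∀ v (L : Coned l (v ∷ T)) → Coned.edges L ≤ 2 * c * Coned.size L) →
    ∀ s (G : Coned l T) → Coned.size G ≤ s → Coned.edges G ≤ 2 * (1 + 2 * c) * Coned.size G
  mader-step {T = T} c linked s G size≤s = by-common (Fin.any? (λ a → Fin.any? (λ b → edge? a b ×-dec (common a b ℕ.≤? 2 * c))))
    where
    open Coned G
    by-common : Dec (∃[ a ] ∃[ b ] ((X a × X b × E a b) × common a b ≤ 2 * c)) → edges ≤ 2 * (1 + 2 * c) * size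
    by-common (yes (a , b , (Xa , Xb , ab) , few)) = contract s size≤s
      where
      module C = Contraction G a b Xa Xb ab
      contract : ∀ s → size ≤ s → edges ≤ 2 * (1 + 2 * c) * size
      contract zero size≤0 = contradiction (ℕ.≤-trans (ℕ.≤-reflexive (ℕ.+-comm 1 _)) (ℕ.≤-trans (ℕ.≤-reflexive (sym C.size-contracted)) size≤0)) λ ()
      contract (suc s) size≤s = begin
        edges                                                        ≤⟨ C.edges-contracted ⟩
        Coned.edges C.contracted + 2 * (1 + common a b)              ≤⟨ ℕ.+-mono-≤ (mader-step c linked s C.contracted (s≤s⁻¹ (subst (_≤ suc s) (trans C.size-contracted (ℕ.+-comm _ 1)) size≤s))) (ℕ.*-monoʳ-≤ 2 (s≤s few)) ⟩
        2 * (1 + 2 * c) * Coned.size C.contracted + 2 * (1 + 2 * c)  ≡⟨ arith (2 * (1 + 2 * c)) (Coned.size C.contracted) ⟩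
        2 * (1 + 2 * c) * (Coned.size C.contracted + 1)              ≡⟨ cong (2 * (1 + 2 * c) *_) C.size-contracted ⟨
        2 * (1 + 2 * c) * size                                       ∎
        where
        open ℕ.≤-Reasoning
        arith : ∀ u v → u * v + u ≡ u * (v + 1)
        arith = solve-∀
    by-common (no all-many) = by-edge (Fin.any? (λ v → Fin.any? (edge? v)))
      where
      many : ∀ {a b} → X a → X b → E a b → 1 + 2 * c ≤ common a b
      many {a} {b} Xa Xb ab = ℕ.≰⇒> (λ few → all-many (a , b , (Xa , Xb , ab) , few))
      by-edge : Dec (∃[ v ] ∃[ w ] (X v × X w × E v w)) → edges ≤ 2 * (1 + 2 * c) * size
      by-edge (no none) = ℕ.≤-trans (ℕ.≤-reflexive (sum-zero _ (λ a → sum-zero _ (λ b → #-no (edge? a b) (λ e → none (a , b , e)))))) z≤n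
      -- The vertex `w` shows that the neighbourhood of `v` in X is nonempty; only then is (1 + 2 c)
      -- times its size strictly larger than 2 c times its size.
      by-edge (yes (v , w , Xv , Xw , vw)) = contradiction
        (ℕ.≤-trans dense (linked v L))
        (ℕ.<⇒≱ (ℕ.*-monoˡ-< L.size {{>-nonZero (ℕ.≤-trans (ℕ.≤-reflexive (sym (#-yes (L.X? w) (Xw , vw)))) (term≤sum (λ a → # (L.X? a)) w))}} {2 * c} (ℕ.n<1+n (2 * c))))
        where
        L = link G v Xv
        module L = Coned L
        dense : (1 + 2 * c) * L.size ≤ L.edges
        dense = ℕ.≤-trans (ℕ.≤-reflexive (*-distribˡ-sum (1 + 2 * c) (λ a → # (L.X? a)))) (sum-mono row)
          where
          row : ∀ a → (1 + 2 * c) * # (L.X? a) ≤ sum (λ b → # (L.edge? a b))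
          row a = by-member (L.X? a)
            where
            by-member : (d : Dec (L.X a)) → (1 + 2 * c) * # d ≤ sum (λ b → # (L.edge? a b))
            by-member (no _) = ℕ.≤-trans (ℕ.≤-reflexive (ℕ.*-zeroʳ (1 + 2 * c))) z≤n
            by-member (yes (Xa , va)) = ℕ.≤-trans (ℕ.≤-reflexive (ℕ.*-identityʳ (1 + 2 * c))) (ℕ.≤-trans (many Xv Xa va)
              (sum-mono (λ b → #-mono (common? v a b) (L.edge? a b) (λ { (Xb , vb , ab) → (Xa , va) , (Xb , vb) , ab }))))

  -- Induction on the number of missing apexes. Three apexes and the two ends of an edge inside X
  -- would form a K₅, so at the last level X spans no edge at all.
  sparse : ∀ {n} {l : Fin n → Fin n → Bool} k {T} → length T + k ≡ 3 → (G : Coned l T) →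
    Coned.edges G ≤ 2 * densityBound k * Coned.size G
  sparse zero {z₁ ∷ z₂ ∷ z₃ ∷ []} _ G = ℕ.≤-reflexive (sum-zero _ (λ a → sum-zero _ (λ b → #-no (edge? a b) (none a b))))
    where
    open Coned G
    none : ∀ a b → ¬ (X a × X b × E a b)
    none a b (Xa , Xb , ab) with T-T | T-X
    ... | (e₁₂ ∷ e₁₃ ∷ []) ∷ (e₂₃ ∷ []) ∷ [] ∷ [] | e₁ ∷ e₂ ∷ e₃ ∷ [] =
      no-K₅ drawn E-irr e₁₂ e₁₃ (e₁ Xa) (e₁ Xb) e₂₃ (e₂ Xa) (e₂ Xb) (e₃ Xa) (e₃ Xb) ab
  sparse (suc k) {T} len G =
    mader-step (densityBound k) (λ v → sparse k (trans (sym (ℕ.+-suc (length T) k)) len)) (Coned.size G) G ℕ.≤-refl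

-- Sufficiency: vertices of low degree in the square, and greedy colouring.

module UpperBound where

  open import Defs hiding (sym)
  open Crossings using (planar⇒drawn; adj-irrefl; adj-sym)
  open Sums
  open Sparsity
  open import Data.Nat using (ℕ; zero; suc; _+_; _*_; _∸_; _⊔_; _≤_; _<_; z≤n; s≤s; s≤s⁻¹; >-nonZero)
  open import Data.Nat.Properties as ℕ using (+-*-semiring)
  open import Data.Bool as Bool using (Bool; true; false; if_then_else_)
  open import Data.Maybe using (Maybe; just; nothing)
  open import Data.Maybe.Properties using (≡-dec; just-injective)
  open import Data.Fin as Fin using (Fin; zero; suc)
  open import Data.Fin.Properties as Fin using (_≟_)
  open import Data.List as List using (List; [])
  open import Data.List.Properties as List using ()
  import Data.Nat.ListAction as ListAction
  open import Data.Unit using (⊤; tt)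
  open import Data.List.Relation.Unary.All using ([])
  open import Data.List.Relation.Unary.AllPairs using ([])
  open import Data.Product using (Σ; ∃-syntax; _×_; _,_; proj₁; proj₂)
  open import Data.Sum using (_⊎_; inj₁; inj₂; swap)
  open import Relation.Nullary using (¬_; Dec; yes; no; contradiction)
  open import Relation.Nullary.Decidable using (_⊎-dec_; _×-dec_; ¬?)
  open import Relation.Binary.PropositionalEquality hiding ([_])
  open import Algebra.Properties.Semiring.Sum +-*-semiring using (sum; sum-cong-≗; ∑-distrib-+; ∑-comm; *-distribˡ-sum; *-distribʳ-sum)
  open import Data.Nat.Tactic.RingSolver using (solve-∀)

  adj? : ∀ {n} (G : Graph n) u v → Dec (Adj G u v)
  adj? G u v = adj G u v Bool.≟ true

  C₄-free⇒unique : ∀ {n} (G : Graph n) → ¬ CycleOfLength G 4 → ∀ {u v w w′} → u ≢ v →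
    Adj G u w → Adj G v w → Adj G u w′ → Adj G v w′ → w ≡ w′
  C₄-free⇒unique {n} G no-C₄ {u} {v} {w} {w′} u≢v uw vw uw′ vw′ with w ≟ w′
  ... | yes e = e
  ... | no w≢w′ = contradiction (s≤s (s≤s (s≤s z≤n)) , f , (λ {i} {j} → inj {i} {j}) , steps , adj-sym G uw′) no-C₄
    where
    f : Fin 4 → Fin n
    f zero = u
    f (suc zero) = w
    f (suc (suc zero)) = v
    f (suc (suc (suc zero))) = w′
    irr : ∀ {a b} → Adj G a b → a ≢ b
    irr ab refl = adj-irrefl G ab
    inj : ∀ {i j} → f i ≡ f j → i ≡ j
    inj {zero} {zero} _ = refl
    inj {zero} {suc zero} e = contradiction e (irr uw)
    inj {zero} {suc (suc zero)} e = contradiction e u≢v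
    inj {zero} {suc (suc (suc zero))} e = contradiction e (irr uw′)
    inj {suc zero} {zero} e = contradiction (sym e) (irr uw)
    inj {suc zero} {suc zero} _ = refl
    inj {suc zero} {suc (suc zero)} e = contradiction (sym e) (irr vw)
    inj {suc zero} {suc (suc (suc zero))} e = contradiction e w≢w′
    inj {suc (suc zero)} {zero} e = contradiction (sym e) u≢v
    inj {suc (suc zero)} {suc zero} e = contradiction e (irr vw)
    inj {suc (suc zero)} {suc (suc zero)} _ = refl
    inj {suc (suc zero)} {suc (suc (suc zero))} e = contradiction e (irr vw′)
    inj {suc (suc (suc zero))} {zero} e = contradiction (sym e) (irr uw′)
    inj {suc (suc (suc zero))} {suc zero} e = contradiction (sym e) w≢w′
    inj {suc (suc (suc zero))} {suc (suc zero)} e = contradiction (sym e) (irr vw′)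
    inj {suc (suc (suc zero))} {suc (suc (suc zero))} _ = refl
    steps : ∀ (i : Fin 3) → Adj G (f (Fin.inject₁ i)) (f (suc i))
    steps zero = uw
    steps (suc zero) = adj-sym G vw
    steps (suc (suc zero)) = vw′

  sum-allFin : ∀ {n} (f : Fin n → ℕ) → ListAction.sum (List.map f (List.allFin n)) ≡ sum f
  sum-allFin {n} f = trans (cong ListAction.sum (List.map-tabulate (λ i → i) f)) (sum-tabulate f)
    where
    sum-tabulate : ∀ {n} (f : Fin n → ℕ) → ListAction.sum (List.tabulate f) ≡ sum f
    sum-tabulate {zero} f = refl
    sum-tabulate {suc n} f = cong (f zero +_) (sum-tabulate (λ i → f (suc i)))

  ≤-max-allFin : ∀ {n} (f : Fin n → ℕ) i → f i ≤ List.foldr _⊔_ 0 (List.map f (List.allFin n))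
  ≤-max-allFin f i = ℕ.≤-trans (≤-max-tabulate f i) (ℕ.≤-reflexive (sym (cong (List.foldr _⊔_ 0) (List.map-tabulate (λ i → i) f))))
    where
    ≤-max-tabulate : ∀ {n} (f : Fin n → ℕ) i → f i ≤ List.foldr _⊔_ 0 (List.tabulate f)
    ≤-max-tabulate f zero = ℕ.m≤m⊔n _ _
    ≤-max-tabulate f (suc i) = ℕ.≤-trans (≤-max-tabulate (λ i → f (suc i)) i) (ℕ.m≤n⊔m _ _)

  max-allFin-≤ : ∀ {n} (f : Fin n → ℕ) {k} → (∀ i → f i ≤ k) → List.foldr _⊔_ 0 (List.map f (List.allFin n)) ≤ k
  max-allFin-≤ f h = ℕ.≤-trans (ℕ.≤-reflexive (cong (List.foldr _⊔_ 0) (List.map-tabulate (λ i → i) f))) (max-tabulate-≤ f h)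
    where
    max-tabulate-≤ : ∀ {n} (f : Fin n → ℕ) {k} → (∀ i → f i ≤ k) → List.foldr _⊔_ 0 (List.tabulate f) ≤ k
    max-tabulate-≤ {zero} f h = z≤n
    max-tabulate-≤ {suc n} f h = ℕ.⊔-lub (h zero) (max-tabulate-≤ (λ i → f (suc i)) (λ i → h (suc i)))

  degree-sum : ∀ {n} (G : Graph n) v → sum (λ w → # (adj? G v w)) ≡ degree G v
  degree-sum G v = trans (sum-cong-≗ (λ w → #-adj (adj G v w))) (sym (sum-allFin (λ w → if adj G v w then 1 else 0)))
    where
    #-adj : ∀ b → # (b Bool.≟ true) ≡ (if b then 1 else 0)
    #-adj true = refl
    #-adj false = refl

  -- The values of M and K make the average weight in light-vertex less than M.
  module PlanarC₄Free (M K : ℕ) (M-large : 29 < M) (K-def : K ≡ 28 * (15 * M))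
    {n} (G : Graph n) (planar : Planar G) (no-C₄ : ¬ CycleOfLength G 4) where

    private
      l = proj₁ (planar⇒drawn planar)
      drawn = proj₂ (planar⇒drawn planar)

      adj-irr : ∀ {a b} → Adj G a b → a ≢ b
      adj-irr ab refl = adj-irrefl G ab

    module Into {X : Fin n → Set} (X? : ∀ a → Dec (X a)) where

      size : ℕ
      size = sum (λ a → # (X? a))

      nb? : ∀ y x → Dec (X x × Adj G y x)
      nb? y x = X? x ×-dec adj? G y x

      d : Fin n → ℕ
      d y = sum (λ x → # (nb? y x))

      private
        induced : Coned l []
        induced = record
          { E = Adj G ; E? = adj? G ; E-sym = adj-sym G ; E-irr = adj-irr
          ; drawn = drawn ; X = X ; X? = X? ; T-T = [] ; T-X = [] }

      inside : sum (λ a → # (X? a) * d a) ≤ 14 * size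
      inside = ℕ.≤-trans (ℕ.≤-reflexive (sum-cong-≗ (λ a → trans (*-distribˡ-sum (# (X? a)) (λ b → # (nb? a b)))
          (sum-cong-≗ (λ b → sym (#-× (X? a) (nb? a b))))))) (sparse 3 refl induced)

      private
        hub-of : ∀ {y} → Dec (∃[ x ] (X x × Adj G y x)) → Maybe (Fin n)
        hub-of (yes (x , _)) = just x
        hub-of (no _) = nothing

        hub : Fin n → Maybe (Fin n)
        hub y = hub-of (Fin.any? (nb? y))

        hub-just : ∀ {y} (D : Dec (∃[ x ] (X x × Adj G y x))) {a} → hub-of D ≡ just a → X a × Adj G y a
        hub-just (yes (x , p)) refl = p

        hub-nothing : ∀ {y} (D : Dec (∃[ x ] (X x × Adj G y x))) → hub-of D ≡ nothing → ∀ x → ¬ (X x × Adj G y x)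
        hub-nothing (no none) _ x p = none (x , p)

        -- The edge ab arises when y is contracted into its chosen neighbour a. The contracted graph
        -- thus has a star with centre `hub y` for every y outside X that has a neighbour in X.
        Star : Fin n → Fin n → Fin n → Set
        Star y a b = ¬ X y × hub y ≡ just a × b ≢ a × (X b × Adj G y b)

        star? : ∀ y a b → Dec (Star y a b)
        star? y a b = ¬? (X? y) ×-dec ≡-dec _≟_ (hub y) (just a) ×-dec ¬? (b ≟ a) ×-dec nb? y b

        star-first : ∀ {y a b} → Star y a b → X a × Adj G y a
        star-first {y} (_ , h , _) = hub-just (Fin.any? (nb? y)) h

        Linked : Fin n → Fin n → Fin n → Set
        Linked p q y = Star y p q ⊎ Star y q p

        linked? : ∀ p q y → Dec (Linked p q y)
        linked? p q y = star? y p q ⊎-dec star? y q p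

        linked-ends : ∀ {p q y} → Linked p q y → (X p × Adj G y p) × (X q × Adj G y q) × p ≢ q × ¬ X y
        linked-ends (inj₁ s@(¬Xy , _ , q≢p , q)) = star-first s , q , ≢-sym q≢p , ¬Xy
        linked-ends (inj₂ s@(¬Xy , _ , p≢q , p)) = p , star-first s , p≢q , ¬Xy

        -- Two such vertices would form a 4-cycle with p and q. Hence different stars share no edge,
        -- and counting edges of the contracted graph counts all stars.
        linked-unique : ∀ {p q y y′} → Linked p q y → Linked p q y′ → y ≡ y′
        linked-unique s s′ with linked-ends s | linked-ends s′
        ... | (_ , yp) , (_ , yq) , p≢q , _ | (_ , y′p) , (_ , y′q) , _ =
          C₄-free⇒unique G no-C₄ p≢q (adj-sym G yp) (adj-sym G yq) (adj-sym G y′p) (adj-sym G y′q)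

        E′ : Fin n → Fin n → Set
        E′ p q = ∃[ y ] Linked p q y

        E′? : ∀ p q → Dec (E′ p q)
        E′? p q = Fin.any? (linked? p q)

        rerouted : Rerouted (Adj G) E′
        rerouted = record
          { mid = λ p q → via (E′? p q)
          ; mid-sym = λ p q → via-sym (E′? p q) (E′? q p)
          ; direct = λ {p} {q} → direct (E′? p q)
          ; path = λ {p} {q} → path (E′? p q)
          ; avoid = λ {p} {q} → avoid (E′? p q)
          ; private-mid = λ {p} {q} {r} {s} → private-mid (E′? p q) (E′? r s)
          }
          where
          via : ∀ {p q} → Dec (E′ p q) → Maybe (Fin n)
          via (yes (y , _)) = just y
          via (no _) = nothing
          via-sym : ∀ {p q} (d : Dec (E′ p q)) (e : Dec (E′ q p)) → via d ≡ via e
          via-sym (yes (y , s)) (yes (y′ , s′)) = cong just (linked-unique s (swap s′))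
          via-sym (yes (y , s)) (no ¬e) = contradiction (y , swap s) ¬e
          via-sym (no ¬e) (yes (y , s)) = contradiction (y , swap s) ¬e
          via-sym (no _) (no _) = refl
          direct : ∀ {p q} (d : Dec (E′ p q)) → E′ p q → via d ≡ nothing → Adj G p q
          direct (no ¬e) e _ = contradiction e ¬e
          path : ∀ {p q m} (d : Dec (E′ p q)) → E′ p q → via d ≡ just m → Adj G p m × Adj G m q
          path (yes (y , s)) _ refl with linked-ends s
          ... | (_ , yp) , (_ , yq) , _ = adj-sym G yp , yq
          avoid : ∀ {p q r s m} (d : Dec (E′ p q)) → E′ p q → E′ r s → p ≢ r → p ≢ s → q ≢ r → q ≢ s → via d ≡ just m → m ≢ r × m ≢ s
          avoid (yes (y , t)) _ (_ , t′) _ _ _ _ refl with linked-ends t | linked-ends t′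
          ... | _ , _ , _ , ¬Xy | (Xr , _) , (Xs , _) , _ = (λ { refl → ¬Xy Xr }) , (λ { refl → ¬Xy Xs })
          -- All edges routed through y contain `hub y`, so no two of them are independent.
          hub-end : ∀ {p q y} → Linked p q y → hub y ≡ just p ⊎ hub y ≡ just q
          hub-end (inj₁ (_ , h , _)) = inj₁ h
          hub-end (inj₂ (_ , h , _)) = inj₂ h
          private-mid : ∀ {p q r s m} (d : Dec (E′ p q)) (d′ : Dec (E′ r s)) → E′ p q → E′ r s → p ≢ r → p ≢ s → q ≢ r → q ≢ s → via d ≡ just m → via d′ ≢ just m
          private-mid (yes (y , t)) (yes (.y , t′)) _ _ pr ps qr qs refl refl with hub-end t | hub-end t′
          ... | inj₁ h | inj₁ h′ = pr (just-injective (trans (sym h) h′))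
          ... | inj₁ h | inj₂ h′ = ps (just-injective (trans (sym h) h′))
          ... | inj₂ h | inj₁ h′ = qr (just-injective (trans (sym h) h′))
          ... | inj₂ h | inj₂ h′ = qs (just-injective (trans (sym h) h′))

        contracted : Coned l []
        contracted = record
          { E = E′ ; E? = E′? ; E-sym = λ (y , s) → y , swap s ; E-irr = λ (_ , s) → proj₁ (proj₂ (proj₂ (linked-ends s)))
          ; drawn = drawn-reroute drawn rerouted ; X = X ; X? = X? ; T-T = [] ; T-X = [] }

        private module C = Coned contracted

        -- The hub is the one neighbour that `∸ 1` discards; all others are counted in the row of
        -- the hub. Without a neighbour in X the left side is 0, because 0 ∸ 1 = 0.
        leaves : ∀ y → # (¬? (X? y)) * (d y ∸ 1) ≤ sum (λ p → sum (λ q → # (star? y p q)))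
        leaves y = by-X (X? y) refl
          where
          by-hub : ¬ X y → ∀ h → hub y ≡ h → d y ∸ 1 ≤ sum (λ p → sum (λ q → # (star? y p q)))
          by-hub ¬Xy nothing e = ℕ.≤-trans (ℕ.≤-reflexive (cong (_∸ 1) (sum-zero _ (λ x → #-no (nb? y x) (hub-nothing (Fin.any? (nb? y)) e x))))) z≤n
          by-hub ¬Xy (just a) e = ℕ.≤-trans (ℕ.∸-monoˡ-≤ 1 bound) (ℕ.≤-trans (ℕ.≤-reflexive (ℕ.m+n∸n≡m _ 1)) (term≤sum (λ p → sum (λ q → # (star? y p q))) a))
            where
            pointwise : ∀ q → # (nb? y q) ≤ # (star? y a q) + # (q ≟ a) * 1
            pointwise q = by (q ≟ a)
              where
              by : ∀ (D : Dec (q ≡ a)) → # (nb? y q) ≤ # (star? y a q) + # D * 1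
              by (yes _) = ℕ.≤-trans (#≤1 (nb? y q)) (ℕ.m≤n+m 1 _)
              by (no q≢a) = ℕ.≤-trans (#-mono (nb? y q) (star? y a q) (λ p → ¬Xy , e , q≢a , p)) (ℕ.m≤m+n _ 0)
            bound : d y ≤ sum (λ q → # (star? y a q)) + 1
            bound = ℕ.≤-trans (sum-mono pointwise) (ℕ.≤-reflexive (trans (∑-distrib-+ (λ q → # (star? y a q)) (λ q → # (q ≟ a) * 1)) (cong (sum (λ q → # (star? y a q)) +_) (sum-point a (λ _ → 1)))))
          by-X : ∀ D → X? y ≡ D → # (¬? D) * (d y ∸ 1) ≤ sum (λ p → sum (λ q → # (star? y p q)))
          by-X (yes _) _ = z≤n
          by-X (no ¬Xy) _ = ℕ.≤-trans (ℕ.≤-reflexive (ℕ.*-identityˡ _)) (by-hub ¬Xy (hub y) refl)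

        stars : ∀ p q → sum (λ y → # (star? y p q)) ≤ # (C.edge? p q)
        stars p q = by-edge (C.edge? p q)
          where
          by-edge : ∀ D → sum (λ y → # (star? y p q)) ≤ # D
          by-edge (yes _) = sum-unique (λ y → star? y p q) (λ s s′ → linked-unique (inj₁ s) (inj₁ s′))
          by-edge (no ¬e) = ℕ.≤-reflexive (sum-zero _ (λ y → #-no (star? y p q) (λ s → ¬e (proj₁ (star-first s) , proj₁ (proj₂ (proj₂ (proj₂ s))) , y , inj₁ s))))

      -- Contract each vertex y outside X into one of its neighbours in X. As G
      -- has no C₄, the other d y ∸ 1 neighbours give edges not coming from other y.
      outside : sum (λ y → # (¬? (X? y)) * (d y ∸ 1)) ≤ 14 * size
      outside = begin
        sum (λ y → # (¬? (X? y)) * (d y ∸ 1))                    ≤⟨ sum-mono leaves ⟩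
        sum (λ y → sum (λ p → sum (λ q → # (star? y p q))))      ≡⟨ ∑-comm (λ y p → sum (λ q → # (star? y p q))) ⟩
        sum (λ p → sum (λ y → sum (λ q → # (star? y p q))))      ≡⟨ sum-cong-≗ (λ p → ∑-comm (λ y q → # (star? y p q))) ⟩
        sum (λ p → sum (λ q → sum (λ y → # (star? y p q))))      ≤⟨ sum-mono (λ p → sum-mono (λ q → stars p q)) ⟩
        C.edges                                                  ≤⟨ sparse 3 refl contracted ⟩
        14 * size                                                ∎
        where open ℕ.≤-Reasoning

    sqAdj? : ∀ u v → Dec (SqAdj G u v)
    sqAdj? u v = ¬? (u ≟ v) ×-dec (adj? G u v ⊎-dec Fin.any? (λ w → adj? G u w ×-dec adj? G w v))

    -- The three terms bound, for the vertex x to be found, its neighbours in X, the vertices of X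
    -- reached through neighbours in X that are not big, and those reached through at most `M` rich
    -- neighbours that are not big. A single big neighbour accounts for Δ.
    C₀ : ℕ
    C₀ = K + K * K + M * K

    module Averaging {X : Fin n → Set} (X? : ∀ a → Dec (X a)) where
      open Into X?

      Big : Fin n → Set
      Big u = K < d u

      big? : ∀ u → Dec (Big u)
      big? u = K ℕ.<? d u

      module B = Into big?

      -- The vertices outside X through which one vertex of X can reach another. Poor neighbours of
      -- a vertex may be numerous, but lead to no further vertex of X.
      Rich : Fin n → Set
      Rich y = ¬ X y × 2 ≤ d y

      rich? : ∀ y → Dec (Rich y)
      rich? y = ¬? (X? y) ×-dec (2 ℕ.≤? d y)

      rich : Fin n → ℕ
      rich x = sum (λ y → # (rich? y) * # (adj? G x y))

      -- Every big vertex contributes at least K to the sum in `inside` or to the one in `outside`,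
      -- whence 14 + 14. The strict inequality in `Big` pays for the subtracted 1.
      few-big : K * B.size ≤ 28 * size
      few-big = begin
        K * B.size                                                              ≡⟨ *-distribˡ-sum K (λ u → # (big? u)) ⟩
        sum (λ u → K * # (big? u))                                              ≤⟨ sum-mono (λ u → bound u (big? u) (X? u)) ⟩
        sum (λ u → # (¬? (X? u)) * (d u ∸ 1) + # (X? u) * d u)                  ≡⟨ ∑-distrib-+ (λ u → # (¬? (X? u)) * (d u ∸ 1)) (λ u → # (X? u) * d u) ⟩
        sum (λ u → # (¬? (X? u)) * (d u ∸ 1)) + sum (λ u → # (X? u) * d u)      ≤⟨ ℕ.+-mono-≤ outside inside ⟩
        14 * size + 14 * size                                                   ≡⟨ ℕ.*-distribʳ-+ size 14 14 ⟨
        28 * size                                                               ∎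
        where
        open ℕ.≤-Reasoning
        bound : ∀ u (D : Dec (Big u)) (X? : Dec (X u)) → K * # D ≤ # (¬? X?) * (d u ∸ 1) + # X? * d u
        bound u (no _) _ = ℕ.≤-trans (ℕ.≤-reflexive (ℕ.*-zeroʳ K)) z≤n
        bound u (yes K<d) (yes _) = ℕ.≤-trans (ℕ.≤-reflexive (ℕ.*-identityʳ K)) (ℕ.≤-trans (ℕ.<⇒≤ K<d) (ℕ.≤-reflexive (sym (ℕ.*-identityˡ (d u)))))
        bound u (yes K<d) (no _) = ℕ.≤-trans (ℕ.≤-reflexive (ℕ.*-identityʳ K)) (ℕ.≤-trans (ℕ.∸-monoˡ-≤ 1 K<d)
          (ℕ.≤-reflexive (trans (sym (ℕ.*-identityˡ (d u ∸ 1))) (sym (ℕ.+-identityʳ _)))))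

      -- Counting from the side of y, each rich y appears d y times, and d y ≤ 2 (d y - 1) as soon
      -- as d y ≥ 2. So `outside` applies at the price of a factor 2.
      rich-total : sum (λ x → # (X? x) * rich x) ≤ 28 * size
      rich-total = begin
        sum (λ x → # (X? x) * rich x)                                           ≡⟨ sum-cong-≗ (λ x → *-distribˡ-sum (# (X? x)) (λ y → # (rich? y) * # (adj? G x y))) ⟩
        sum (λ x → sum (λ y → # (X? x) * (# (rich? y) * # (adj? G x y))))       ≡⟨ ∑-comm (λ x y → # (X? x) * (# (rich? y) * # (adj? G x y))) ⟩
        sum (λ y → sum (λ x → # (X? x) * (# (rich? y) * # (adj? G x y))))       ≡⟨ sum-cong-≗ (λ y → sum-cong-≗ (λ x → regroup x y)) ⟩
        sum (λ y → sum (λ x → # (rich? y) * # (nb? y x)))                       ≡⟨ sum-cong-≗ (λ y → sym (*-distribˡ-sum (# (rich? y)) (λ x → # (nb? y x)))) ⟩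
        sum (λ y → # (rich? y) * d y)                                           ≤⟨ sum-mono (λ y → bound y (X? y) (2 ℕ.≤? d y)) ⟩
        sum (λ y → 2 * (# (¬? (X? y)) * (d y ∸ 1)))                             ≡⟨ *-distribˡ-sum 2 (λ y → # (¬? (X? y)) * (d y ∸ 1)) ⟨
        2 * sum (λ y → # (¬? (X? y)) * (d y ∸ 1))                               ≤⟨ ℕ.*-monoʳ-≤ 2 outside ⟩
        2 * (14 * size)                                                         ≡⟨ ℕ.*-assoc 2 14 size ⟨
        28 * size                                                               ∎
        where
        open ℕ.≤-Reasoning
        swap-* : ∀ a b c → a * (b * c) ≡ b * (a * c)
        swap-* = solve-∀
        regroup : ∀ x y → # (X? x) * (# (rich? y) * # (adj? G x y)) ≡ # (rich? y) * # (nb? y x)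
        regroup x y = trans (swap-* (# (X? x)) (# (rich? y)) (# (adj? G x y)))
          (cong (# (rich? y) *_) (trans (cong (# (X? x) *_) (#-cong (adj? G x y) (adj? G y x) (adj-sym G) (adj-sym G))) (sym (#-× (X? x) (adj? G y x)))))
        double : ∀ m → 2 ≤ m → m ≤ 2 * (m ∸ 1)
        double (suc zero) (s≤s ())
        double (suc (suc m)) _ = ℕ.≤-trans (ℕ.+-monoʳ-≤ 2 (ℕ.m≤m+n m m)) (ℕ.≤-reflexive (arith m))
          where
          arith : ∀ m → 2 + (m + m) ≡ 2 * (1 + m)
          arith = solve-∀
        bound : ∀ y (D : Dec (X y)) (D′ : Dec (2 ≤ d y)) → # (¬? D ×-dec D′) * d y ≤ 2 * (# (¬? D) * (d y ∸ 1))
        bound y (yes _) _ = z≤n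
        bound y (no _) (no _) = z≤n
        bound y (no _) (yes 2≤d) = subst₂ _≤_ (sym (ℕ.*-identityˡ (d y))) (cong (2 *_) (sym (ℕ.*-identityˡ (d y ∸ 1)))) (double (d y) 2≤d)

      -- It vanishes exactly when x is not big and has at most one big neighbour, and its total is
      -- controlled by `outside` for the set of big vertices.
      big-weight : Fin n → ℕ
      big-weight x = # (big? x) + # (¬? (big? x)) * (B.d x ∸ 1)

      -- The factor `M` makes any weight below `M` force `big-weight` to be 0, while leaving room
      -- for a bounded `rich` part.
      weight : Fin n → ℕ
      weight x = M * big-weight x + rich x

      -- Over all vertices `big-weight` adds up to at most |B| + 14 |B|, and `K` is chosen so that
      -- `few-big` turns M * 15 |B| into at most |X|. Together with 28 from `rich-total` this makes
      -- 29.
      average : sum (λ x → # (X? x) * weight x) ≤ 29 * size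
      average = begin
        sum (λ x → # (X? x) * weight x)                                                ≤⟨ sum-mono (λ x → split (X? x)) ⟩
        sum (λ x → M * big-weight x + # (X? x) * rich x)                               ≡⟨ ∑-distrib-+ (λ x → M * big-weight x) (λ x → # (X? x) * rich x) ⟩
        sum (λ x → M * big-weight x) + sum (λ x → # (X? x) * rich x)                   ≤⟨ ℕ.+-monoʳ-≤ _ rich-total ⟩
        sum (λ x → M * big-weight x) + 28 * size                                       ≤⟨ ℕ.+-monoˡ-≤ (28 * size) big-total ⟩
        1 * size + 28 * size                                                           ≡⟨ ℕ.*-distribʳ-+ size 1 28 ⟨
        29 * size                                                                      ∎
        where
        open ℕ.≤-Reasoning
        split : ∀ {x} (D : Dec (X x)) → # D * weight x ≤ M * big-weight x + # D * rich x
        split (no _) = z≤n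
        split {x} (yes _) = ℕ.≤-reflexive (trans (ℕ.*-identityˡ (weight x)) (cong (M * big-weight x +_) (sym (ℕ.*-identityˡ (rich x)))))
        collect : sum big-weight ≤ 15 * B.size
        collect = ℕ.≤-trans (ℕ.≤-reflexive (∑-distrib-+ (λ x → # (big? x)) (λ x → # (¬? (big? x)) * (B.d x ∸ 1)))) (ℕ.+-monoʳ-≤ B.size B.outside)
        big-total : sum (λ x → M * big-weight x) ≤ 1 * size
        big-total = begin
          sum (λ x → M * big-weight x)  ≡⟨ *-distribˡ-sum M big-weight ⟨
          M * sum big-weight            ≤⟨ ℕ.*-monoʳ-≤ M collect ⟩
          M * (15 * B.size)             ≡⟨ trans (sym (ℕ.*-assoc M 15 B.size)) (cong (_* B.size) (ℕ.*-comm M 15)) ⟩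
          15 * M * B.size               ≤⟨ ℕ.*-cancelˡ-≤ 28 (ℕ.≤-trans (ℕ.≤-reflexive (trans (sym (ℕ.*-assoc 28 (15 * M) B.size)) (cong (_* B.size) (sym K-def)))) few-big) ⟩
          size                          ≡⟨ ℕ.*-identityˡ size ⟨
          1 * size                      ∎

      light-vertex : ∀ {a} → X a → ∃[ x ] (X x × weight x < M)
      light-vertex {a} Xa = extract (sum-below (ℕ.≤-<-trans average strict))
        where
        size>0 : 1 ≤ size
        size>0 = ℕ.≤-trans (ℕ.≤-reflexive (sym (#-yes (X? a) Xa))) (term≤sum (λ x → # (X? x)) a)
        strict : 29 * size < sum (λ x → # (X? x) * M)
        strict = ℕ.<-≤-trans (ℕ.*-monoˡ-< size {{>-nonZero size>0}} {29} {M} M-large)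
          (ℕ.≤-reflexive (trans (ℕ.*-comm M size) (*-distribʳ-sum M (λ x → # (X? x)))))
        extract : ∃[ x ] (# (X? x) * weight x < # (X? x) * M) → ∃[ x ] (X x × weight x < M)
        extract (x , h) = by (X? x) h
          where
          by : (D : Dec (X x)) → # D * weight x < # D * M → ∃[ x ] (X x × weight x < M)
          by (yes Xx) h = x , Xx , subst₂ _<_ (ℕ.*-identityˡ (weight x)) (ℕ.*-identityˡ M) h

      module Light {x} (Xx : X x) (light : weight x < M) where

        private
          b≡0 : ∀ b r → M * b + r < M → b ≡ 0
          b≡0 zero r _ = refl
          b≡0 (suc b) r h = contradiction (ℕ.≤-trans (ℕ.m≤m*n M (suc b)) (ℕ.m≤m+n _ r)) (ℕ.<⇒≱ h)

          big-weight≡0 : big-weight x ≡ 0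
          big-weight≡0 = b≡0 (big-weight x) (rich x) light

          by-big : (D : Dec (Big x)) → # D + # (¬? D) * (B.d x ∸ 1) ≡ 0 → d x ≤ K × B.d x ≤ 1
          by-big (no ¬big) e = ℕ.≮⇒≥ ¬big , ℕ.m∸n≡0⇒m≤n (trans (sym (ℕ.*-identityˡ _)) e)

        small-degree : d x ≤ K
        small-degree = proj₁ (by-big (big? x) big-weight≡0)

        one-big : B.d x ≤ 1
        one-big = proj₂ (by-big (big? x) big-weight≡0)

        few-rich : rich x ≤ M
        few-rich = ℕ.≤-trans (ℕ.m≤n+m (rich x) (M * big-weight x)) (ℕ.<⇒≤ light)

        other? : ∀ u z → Dec (z ≢ x × X z × Adj G u z)
        other? u z = ¬? (z ≟ x) ×-dec nb? u z

        others : Fin n → ℕ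
        others u = sum (λ z → # (other? u z))

        others≤degree : ∀ u → others u ≤ maxDegree G
        others≤degree u = ℕ.≤-trans (sum-mono (λ z → #-mono (other? u z) (adj? G u z) (λ (_ , _ , uz) → uz)))
          (ℕ.≤-trans (ℕ.≤-reflexive (degree-sum G u)) (≤-max-allFin (degree G) u))

        others≤d : ∀ u → others u ≤ d u
        others≤d u = sum-mono (λ z → #-mono (other? u z) (nb? u z) proj₂)

        others-poor : ∀ {u} → Adj G x u → d u ≤ 1 → others u ≡ 0
        others-poor {u} xu d≤1 = sum-zero _ (λ z → #-no (other? u z) (λ (z≢x , p) → z≢x (≤1-unique (nb? u) d≤1 p (Xx , adj-sym G xu))))

        -- A big u is charged its full degree. Any other u has d u ≤ K and is charged K if it lies
        -- in X or is rich; if neither, x is its only neighbour in X.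
        reach : ∀ u → # (adj? G x u) * others u ≤ # (B.nb? x u) * maxDegree G + (# (nb? x u) * K + # (rich? u) * # (adj? G x u) * K)
        reach u = by (adj? G x u)
          where
          Δ = maxDegree G
          by : (D : Dec (Adj G x u)) → # D * others u ≤ # (big? u ×-dec D) * Δ + (# (X? u ×-dec D) * K + # (rich? u) * # D * K)
          by (no _) = z≤n
          by (yes xu) = ℕ.≤-trans (ℕ.≤-reflexive (ℕ.*-identityˡ (others u)))
            (subst₂ (λ s t → others u ≤ s * Δ + (t * K + # (rich? u) * 1 * K)) (one (big? u)) (one (X? u))
              (subst (λ r → others u ≤ # (big? u) * Δ + (# (X? u) * K + r * K)) (sym (ℕ.*-identityʳ (# (rich? u)))) (cases (big? u) (X? u) (2 ℕ.≤? d u))))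
            where
            one : ∀ {P : Set} (D : Dec P) → # D ≡ # (D ×-dec yes xu)
            one (yes _) = refl
            one (no _) = refl
            cases : (B? : Dec (Big u)) (X? : Dec (X u)) (D? : Dec (2 ≤ d u)) → others u ≤ # B? * Δ + (# X? * K + # (¬? X? ×-dec D?) * K)
            cases (yes _) _ _ = ℕ.≤-trans (others≤degree u) (ℕ.≤-trans (ℕ.≤-reflexive (sym (ℕ.*-identityˡ Δ))) (ℕ.m≤m+n _ _))
            cases (no ¬big) (yes _) _ = ℕ.≤-trans (others≤d u) (ℕ.≤-trans (ℕ.≮⇒≥ ¬big) (ℕ.≤-trans (ℕ.≤-reflexive (sym (ℕ.*-identityˡ K))) (ℕ.m≤m+n _ _)))
            cases (no ¬big) (no _) (yes _) = ℕ.≤-trans (others≤d u) (ℕ.≤-trans (ℕ.≮⇒≥ ¬big) (ℕ.≤-reflexive (sym (ℕ.*-identityˡ K))))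
            cases (no _) (no _) (no d≱2) = ℕ.≤-trans (ℕ.≤-reflexive (others-poor xu (s≤s⁻¹ (ℕ.≰⇒> d≱2)))) z≤n

        sq-neighbours : sum (λ z → # (X? z ×-dec sqAdj? x z)) ≤ maxDegree G + C₀
        sq-neighbours = begin
          sum (λ z → # (X? z ×-dec sqAdj? x z))                                            ≤⟨ sum-mono via ⟩
          sum (λ z → # (nb? x z) + sum (λ u → # (adj? G x u) * # (other? u z)))             ≡⟨ ∑-distrib-+ (λ z → # (nb? x z)) (λ z → sum (λ u → # (adj? G x u) * # (other? u z))) ⟩
          d x + sum (λ z → sum (λ u → # (adj? G x u) * # (other? u z)))                     ≡⟨ cong (d x +_) (∑-comm (λ z u → # (adj? G x u) * # (other? u z))) ⟩
          d x + sum (λ u → sum (λ z → # (adj? G x u) * # (other? u z)))                     ≡⟨ cong (d x +_) (sum-cong-≗ (λ u → sym (*-distribˡ-sum (# (adj? G x u)) (λ z → # (other? u z))))) ⟩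
          d x + sum (λ u → # (adj? G x u) * others u)                                       ≤⟨ ℕ.+-monoʳ-≤ (d x) (sum-mono reach) ⟩
          d x + sum (λ u → # (B.nb? x u) * Δ + (# (nb? x u) * K + # (rich? u) * # (adj? G x u) * K)) ≡⟨ cong (d x +_) total ⟩
          d x + (B.d x * Δ + (d x * K + rich x * K))                                        ≤⟨ ℕ.+-mono-≤ small-degree (ℕ.+-mono-≤ (ℕ.*-monoˡ-≤ Δ one-big) (ℕ.+-mono-≤ (ℕ.*-monoˡ-≤ K small-degree) (ℕ.*-monoˡ-≤ K few-rich))) ⟩
          K + (1 * Δ + (K * K + M * K))                                                     ≡⟨ arith K Δ (K * K) (M * K) ⟩
          Δ + C₀                                                                            ∎
          where
          open ℕ.≤-Reasoning
          Δ = maxDegree G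
          arith : ∀ k D s t → k + (1 * D + (s + t)) ≡ D + (k + s + t)
          arith = solve-∀
          total : sum (λ u → # (B.nb? x u) * Δ + (# (nb? x u) * K + # (rich? u) * # (adj? G x u) * K)) ≡ B.d x * Δ + (d x * K + rich x * K)
          total = trans (∑-distrib-+ (λ u → # (B.nb? x u) * Δ) (λ u → # (nb? x u) * K + # (rich? u) * # (adj? G x u) * K))
            (cong₂ _+_ (sym (*-distribʳ-sum Δ (λ u → # (B.nb? x u))))
              (trans (∑-distrib-+ (λ u → # (nb? x u) * K) (λ u → # (rich? u) * # (adj? G x u) * K))
                (cong₂ _+_ (sym (*-distribʳ-sum K (λ u → # (nb? x u)))) (sym (*-distribʳ-sum K (λ u → # (rich? u) * # (adj? G x u)))))))
          via : ∀ z → # (X? z ×-dec sqAdj? x z) ≤ # (nb? x z) + sum (λ u → # (adj? G x u) * # (other? u z))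
          via z = by (X? z ×-dec sqAdj? x z)
            where
            by : (D : Dec (X z × SqAdj G x z)) → # D ≤ # (nb? x z) + sum (λ u → # (adj? G x u) * # (other? u z))
            by (no _) = z≤n
            by (yes (Xz , _ , inj₁ xz)) = ℕ.≤-trans (ℕ.≤-reflexive (sym (#-yes (nb? x z) (Xz , xz)))) (ℕ.m≤m+n _ _)
            by (yes (Xz , x≢z , inj₂ (w , xw , wz))) = ℕ.≤-trans
              (ℕ.≤-trans (ℕ.≤-reflexive (sym (cong₂ _*_ (#-yes (adj? G x w) xw) (#-yes (other? w z) (≢-sym x≢z , Xz , wz)))))
                (term≤sum (λ u → # (adj? G x u) * # (other? u z)) w)) (ℕ.m≤n+m _ _)

    low-degree-vertex : ∀ {X : Fin n → Set} (X? : ∀ a → Dec (X a)) → ∃[ a ] X a →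
      ∃[ x ] (X x × sum (λ z → # (X? z ×-dec sqAdj? x z)) ≤ maxDegree G + C₀)
    low-degree-vertex {X} X? (a , Xa) = from (light-vertex Xa)
      where
      open Averaging X?
      from : ∃[ x ] (X x × weight x < M) → ∃[ x ] (X x × sum (λ z → # (X? z ×-dec sqAdj? x z)) ≤ maxDegree G + C₀)
      from (x , Xx , light) = x , Xx , Light.sq-neighbours Xx light

    sqAdj-sym : ∀ {u v} → SqAdj G u v → SqAdj G v u
    sqAdj-sym (u≢v , inj₁ uv) = ≢-sym u≢v , inj₁ (adj-sym G uv)
    sqAdj-sym (u≢v , inj₂ (w , uw , wv)) = ≢-sym u≢v , inj₂ (w , adj-sym G wv , adj-sym G uw)

    ColouringOf : (Fin n → Set) → ℕ → Set
    ColouringOf X k = Σ (Fin n → Fin k) λ c → ∀ u v → X u → X v → SqAdj G u v → c u ≢ c v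

    -- Conflicts are measured in the square of the whole graph, so removing x from X leaves all
    -- conflicts among the other vertices in place. The number `s` bounds the size of X and drives
    -- the recursion.
    colour-set : ∀ {k} → maxDegree G + C₀ < suc k → ∀ s {X : Fin n → Set} (X? : ∀ a → Dec (X a)) →
      sum (λ a → # (X? a)) ≤ s → ColouringOf X (suc k)
    colour-set {k} enough s {X} X? size≤s = by (Fin.any? X?)
      where
      extend : ∀ {x} → X x → sum (λ z → # (X? z ×-dec sqAdj? x z)) ≤ maxDegree G + C₀ → ∀ s → sum (λ a → # (X? a)) ≤ s → ColouringOf X (suc k)
      extend Xx few zero size≤0 = contradiction (ℕ.≤-trans (ℕ.≤-trans (ℕ.≤-reflexive (sym (#-yes (X? _) Xx))) (term≤sum (λ a → # (X? a)) _)) size≤0) λ ()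
      extend {x} Xx few (suc s) size≤s = add (colour-set enough s (λ a → X? a ×-dec ¬? (a ≟ x)) smaller)
        where
        smaller : sum (λ a → # (X? a ×-dec ¬? (a ≟ x))) ≤ s
        smaller = s≤s⁻¹ (ℕ.≤-trans (ℕ.≤-trans (ℕ.≤-reflexive (ℕ.+-comm 1 _)) (ℕ.≤-reflexive (sym split))) size≤s)
          where
          part : ∀ a → # (X? a) ≡ # (X? a ×-dec ¬? (a ≟ x)) + # (a ≟ x) * 1
          part a = cases (X? a) (a ≟ x)
            where
            cases : (D : Dec (X a)) (E : Dec (a ≡ x)) → # D ≡ # (D ×-dec ¬? E) + # E * 1
            cases (yes _) (yes _) = refl
            cases (yes _) (no _) = refl
            cases (no ¬Xa) (yes refl) = contradiction Xx ¬Xa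
            cases (no _) (no _) = refl
          split : sum (λ a → # (X? a)) ≡ sum (λ a → # (X? a ×-dec ¬? (a ≟ x))) + 1
          split = trans (sum-cong-≗ part) (trans (∑-distrib-+ (λ a → # (X? a ×-dec ¬? (a ≟ x))) (λ a → # (a ≟ x) * 1))
            (cong (sum (λ a → # (X? a ×-dec ¬? (a ≟ x))) +_) (sum-point x (λ _ → 1))))
        add : ColouringOf (λ a → X a × a ≢ x) (suc k) → ColouringOf X (suc k)
        add (c , proper) = choose (Fin.any? (λ κ → ¬? (Fin.any? (used? κ))))
          where
          used? : ∀ κ z → Dec ((X z × SqAdj G x z) × c z ≡ κ)
          used? κ z = (X? z ×-dec sqAdj? x z) ×-dec (c z ≟ κ)
          -- Double counting of pairs of a colour and a conflicting vertex: every colour is hit at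
          -- least once, every vertex has just one colour.
          all-used : ¬ (∃[ κ ] ¬ (∃[ z ] ((X z × SqAdj G x z) × c z ≡ κ))) → suc k ≤ maxDegree G + C₀
          all-used none = begin
            suc k                                                              ≡⟨ ℕ.*-identityʳ (suc k) ⟨
            suc k * 1                                                          ≡⟨ sum-const (suc k) 1 ⟨
            sum (λ (κ : Fin (suc k)) → 1)                                      ≤⟨ sum-mono hit ⟩
            sum (λ κ → sum (λ z → # (used? κ z)))                              ≡⟨ ∑-comm (λ κ z → # (used? κ z)) ⟩
            sum (λ z → sum (λ κ → # (used? κ z)))                              ≤⟨ sum-mono once ⟩
            sum (λ z → # (X? z ×-dec sqAdj? x z))                              ≤⟨ few ⟩
            maxDegree G + C₀                                                   ∎
            where
            open ℕ.≤-Reasoning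
            hit : ∀ κ → 1 ≤ sum (λ z → # (used? κ z))
            hit κ = by-use (Fin.any? (used? κ))
              where
              by-use : Dec (∃[ z ] ((X z × SqAdj G x z) × c z ≡ κ)) → 1 ≤ sum (λ z → # (used? κ z))
              by-use (yes (z , p)) = ℕ.≤-trans (ℕ.≤-reflexive (sym (#-yes (used? κ z) p))) (term≤sum (λ z → # (used? κ z)) z)
              by-use (no ¬p) = contradiction (κ , ¬p) none
            once : ∀ z → sum (λ κ → # (used? κ z)) ≤ # (X? z ×-dec sqAdj? x z)
            once z = by-adj (X? z ×-dec sqAdj? x z)
              where
              by-adj : (D : Dec (X z × SqAdj G x z)) → sum (λ κ → # (D ×-dec (c z ≟ κ))) ≤ # D
              by-adj D@(yes _) = sum-unique (λ κ → D ×-dec (c z ≟ κ)) (λ (_ , e) (_ , e′) → trans (sym e) e′)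
              by-adj (no _) = ℕ.≤-reflexive (sum-zero {suc k} _ (λ κ → refl))
          choose : Dec (∃[ κ ] ¬ (∃[ z ] ((X z × SqAdj G x z) × c z ≡ κ))) → ColouringOf X (suc k)
          choose (no none) = contradiction (all-used none) (ℕ.<⇒≱ enough)
          choose (yes (κ , free)) = (λ v → c′ v (v ≟ x)) , λ u v Xu Xv uv → proper′ Xu Xv uv (u ≟ x) (v ≟ x)
            where
            c′ : ∀ v → Dec (v ≡ x) → Fin (suc k)
            c′ v (yes _) = κ
            c′ v (no _) = c v
            proper′ : ∀ {u v} → X u → X v → SqAdj G u v → (D : Dec (u ≡ x)) (E : Dec (v ≡ x)) → c′ u D ≢ c′ v E
            proper′ Xu Xv (u≢v , _) (yes refl) (yes refl) _ = u≢v refl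
            proper′ Xu Xv uv (yes refl) (no _) e = free (_ , (Xv , uv) , sym e)
            proper′ Xu Xv uv (no _) (yes refl) e = free (_ , (Xu , sqAdj-sym uv) , e)
            proper′ Xu Xv uv (no u≢x) (no v≢x) e = proper _ _ (Xu , u≢x) (Xv , v≢x) uv e
      by : Dec (∃[ a ] X a) → ColouringOf X (suc k)
      -- Vertices outside X need some colour too; one exists because the number of colours is a
      -- successor.
      by (no none) = (λ _ → zero) , λ u v Xu → contradiction (u , Xu) none
      by (yes nonempty) = from (low-degree-vertex X? nonempty)
        where
        from : ∃[ x ] (X x × sum (λ z → # (X? z ×-dec sqAdj? x z)) ≤ maxDegree G + C₀) → ColouringOf X (suc k)
        from (x , Xx , few) = extend Xx few s size≤s

    square-colourable : SquareColourable G (maxDegree G + suc C₀)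
    square-colourable = subst (SquareColourable G) (sym (ℕ.+-suc (maxDegree G) C₀))
      (from (colour-set ℕ.≤-refl n (λ (a : Fin n) → yes tt) (ℕ.≤-reflexive (trans (sum-const n 1) (ℕ.*-identityʳ n)))))
      where
      from : ColouringOf (λ _ → ⊤) (suc (maxDegree G + C₀)) → SquareColourable G (suc (maxDegree G + C₀))
      from (c , proper) = c , λ u v → proper u v tt tt

-- Necessity: cycles, degrees and colours of the necklace.

module Necklaces where

  open import Defs hiding (sym)
  open Crossings using (adj-sym)
  open Sums
  open UpperBound using (adj?; max-allFin-≤; degree-sum)
  open import Data.Nat using (ℕ; zero; suc; _+_; _*_; _≤_; _<_; z≤n; s≤s; >-nonZero)
  open import Data.Nat.Properties as ℕ using (+-*-semiring)
  open import Data.Nat.DivMod using (_%_; _/_; m≡m%n+[m/n]*n; m<n⇒m%n≡m; n%n≡0; %-distribˡ-+; m%n%n≡m%n; [m+kn]%n≡m%n)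
  open import Data.Nat.Divisibility using (_∣_; divides; ∣⇒≤)
  open import Data.Bool using (true; false)
  open import Data.Fin as Fin using (Fin; zero; suc; toℕ; inject₁; fromℕ; _↑ˡ_; _↑ʳ_; splitAt; combine; remQuot; join)
  open import Data.Fin.Properties as Fin using (_≟_)
  open import Data.Product using (∃-syntax; _×_; _,_; proj₁; proj₂; map₂)
  open import Data.Product.Properties using (,-injective)
  open import Data.Sum as Sum using (_⊎_; inj₁; inj₂)
  open import Data.Sum.Properties using (inj₁-injective; inj₂-injective)
  open import Data.Empty using (⊥; ⊥-elim)
  open import Relation.Nullary using (¬_; Dec; yes; no; does; contradiction)
  open import Relation.Nullary.Decidable using (_⊎-dec_; dec-true)
  open import Relation.Binary.PropositionalEquality hiding ([_])
  open import Algebra.Properties.Semiring.Sum +-*-semiring using (sum; sum-cong-≗; ∑-distrib-+; ∑-comm; *-distribˡ-sum; sum-init-last)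
  open import Data.Nat.Tactic.RingSolver using (solve-∀)

  does-true : ∀ {P : Set} (d : Dec P) → does d ≡ true → P
  does-true (yes p) _ = p

  -- Cyclic predecessor, used both for the hubs and for the positions on a cycle.
  prev : ∀ {r} → Fin (suc r) → Fin (suc r)
  prev {r} zero = fromℕ r
  prev (suc i) = inject₁ i

  sum-prev : ∀ {r} (f : Fin (suc r) → ℕ) → sum (λ i → f (prev i)) ≡ sum f
  sum-prev {r} f = trans (ℕ.+-comm (f (fromℕ r)) _) (sym (sum-init-last f))

  prev-% : ∀ {r} (a : Fin (suc r)) → toℕ a ≡ suc (toℕ (prev a)) % suc r
  prev-% {r} zero = sym (trans (cong (λ k → suc k % suc r) (Fin.toℕ-fromℕ r)) (n%n≡0 (suc r)))
  prev-% {r} (suc i) = sym (trans (cong (λ k → suc k % suc r) (Fin.toℕ-inject₁ i)) (m<n⇒m%n≡m (s≤s (Fin.toℕ<n i))))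

  prev-injective : ∀ {r} {a b : Fin (suc r)} → prev a ≡ prev b → a ≡ b
  prev-injective {r} {a} {b} e = Fin.toℕ-injective (trans (prev-% a) (trans (cong (λ c → suc (toℕ c) % suc r) e) (sym (prev-% b))))

  back : ∀ {r} → ℕ → Fin (suc r) → Fin (suc r)
  back zero a = a
  back (suc j) a = prev (back j a)

  back-prev : ∀ {r} j (a : Fin (suc r)) → back j (prev a) ≡ prev (back j a)
  back-prev zero a = refl
  back-prev (suc j) a = cong prev (back-prev j a)

  back-% : ∀ {r} j (a : Fin (suc r)) → toℕ a ≡ (toℕ (back j a) + j) % suc r
  back-% {r} zero a = sym (trans (cong (_% suc r) (ℕ.+-identityʳ (toℕ a))) (m<n⇒m%n≡m (Fin.toℕ<n a)))
  back-% {r} (suc j) a = begin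
    toℕ a                                                  ≡⟨ back-% j a ⟩
    (toℕ (back j a) + j) % m                               ≡⟨ cong (λ x → (x + j) % m) (prev-% (back j a)) ⟩
    (suc b % m + j) % m                                    ≡⟨ %-distribˡ-+ (suc b % m) j m ⟩
    (suc b % m % m + j % m) % m                            ≡⟨ cong (λ x → (x + j % m) % m) (m%n%n≡m%n (suc b) m) ⟩
    (suc b % m + j % m) % m                                ≡⟨ %-distribˡ-+ (suc b) j m ⟨
    (suc b + j) % m                                        ≡⟨ cong (_% m) (ℕ.+-suc b j) ⟨
    (b + suc j) % m                                        ∎
    where
    open ≡-Reasoning
    m = suc r
    b = toℕ (prev (back j a))

  back-fixed⇒∣ : ∀ {r} j {a : Fin (suc r)} → back j a ≡ a → suc r ∣ j
  back-fixed⇒∣ {r} j {a} e = divides ((toℕ a + j) / suc r) (ℕ.+-cancelˡ-≡ (toℕ a) _ _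
    (trans (m≡m%n+[m/n]*n (toℕ a + j) (suc r))
      (cong (_+ (toℕ a + j) / suc r * suc r) (sym (trans (back-% j a) (cong (λ b → (toℕ b + j) % suc r) e))))))

  back-full : ∀ {r} q (a : Fin (suc r)) → back (q * suc r) a ≡ a
  back-full {r} q a = Fin.toℕ-injective (sym (trans (back-% (q * suc r) a)
    (trans ([m+kn]%n≡m%n (toℕ (back (q * suc r) a)) q (suc r)) (m<n⇒m%n≡m (Fin.toℕ<n (back (q * suc r) a))))))

  prev≢ : ∀ {r} → 1 ≤ r → (a : Fin (suc r)) → prev a ≢ a
  prev≢ {r} 1≤r a e = contradiction (∣⇒≤ (back-fixed⇒∣ 1 {a} e)) (ℕ.<⇒≱ (s≤s 1≤r))

  -- Hubs in cyclic order; for each τ there are p vertices joined to exactly the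
  -- hubs τ and prev τ. All cycles have length 4 or go around.
  module Necklace (r p : ℕ) where

    Hub : Set
    Hub = Fin (suc r)

    V : Set
    V = Hub ⊎ (Hub × Fin p)

    order : ℕ
    order = suc r + suc r * p

    decode : Fin order → V
    decode v = Sum.map₂ (remQuot p) (splitAt (suc r) v)

    encode : V → Fin order
    encode (inj₁ h) = h ↑ˡ (suc r * p)
    encode (inj₂ (i , j)) = suc r ↑ʳ combine i j

    decode-encode : ∀ v → decode (encode v) ≡ v
    decode-encode (inj₁ h) rewrite Fin.splitAt-↑ˡ (suc r) h (suc r * p) = refl
    decode-encode (inj₂ (i , j)) rewrite Fin.splitAt-↑ʳ (suc r) (suc r * p) (combine i j) = cong inj₂ (Fin.remQuot-combine i j)

    encode-decode : ∀ v → encode (decode v) ≡ v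
    encode-decode v = trans (by (splitAt (suc r) v)) (Fin.join-splitAt (suc r) (suc r * p) v)
      where
      by : ∀ s → encode (Sum.map₂ (remQuot p) s) ≡ join (suc r) (suc r * p) s
      by (inj₁ h) = refl
      by (inj₂ m) = cong (suc r ↑ʳ_) (Fin.combine-remQuot {suc r} p m)

    decode-injective : ∀ u v → decode u ≡ decode v → u ≡ v
    decode-injective u v e = trans (sym (encode-decode u)) (trans (cong encode e) (encode-decode v))

    Inc : Hub → Hub → Set
    Inc h τ = h ≡ τ ⊎ h ≡ prev τ

    inc? : ∀ h τ → Dec (Inc h τ)
    inc? h τ = h ≟ τ ⊎-dec h ≟ prev τ

    AdjV : V → V → Set
    AdjV (inj₁ h) (inj₂ (τ , _)) = Inc h τ
    AdjV (inj₂ (τ , _)) (inj₁ h) = Inc h τ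
    AdjV _ _ = ⊥

    adjV? : ∀ u v → Dec (AdjV u v)
    adjV? (inj₁ h) (inj₁ h′) = no (λ ())
    adjV? (inj₁ h) (inj₂ (τ , _)) = inc? h τ
    adjV? (inj₂ (τ , _)) (inj₁ h) = inc? h τ
    adjV? (inj₂ _) (inj₂ _) = no (λ ())

    necklace : Graph order
    necklace = record
      { adj = λ u v → does (adjV? (decode u) (decode v))
      ; sym = λ u v → symmetric (decode u) (decode v)
      ; irrefl = λ v → irreflexive (decode v)
      }
      where
      symmetric : ∀ u v → does (adjV? u v) ≡ does (adjV? v u)
      symmetric (inj₁ _) (inj₁ _) = refl
      symmetric (inj₁ _) (inj₂ _) = refl
      symmetric (inj₂ _) (inj₁ _) = refl
      symmetric (inj₂ _) (inj₂ _) = refl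
      irreflexive : ∀ v → does (adjV? v v) ≡ false
      irreflexive (inj₁ _) = refl
      irreflexive (inj₂ _) = refl

    adj⇒ : ∀ u v → Adj necklace u v → AdjV (decode u) (decode v)
    adj⇒ u v = does-true (adjV? (decode u) (decode v))

    adj⇐ : ∀ u v → AdjV u v → Adj necklace (encode u) (encode v)
    adj⇐ u v uv = dec-true (adjV? _ _) (subst₂ AdjV (sym (decode-encode u)) (sym (decode-encode v)) uv)

    -- A cycle run through periodically, so that its closing edge needs no special treatment.
    -- `no-return` keeps the walk from going back to the hub it has just left, and `no-square` from
    -- reversing its direction around the necklace.
    module Walk (w : ℕ → V) (step : ∀ i → AdjV (w i) (w (suc i)))
      (no-return : ∀ i → w (2 + i) ≢ w i) (no-square : ∀ i → w (4 + i) ≢ w i) where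

      twice : ℕ → ℕ → ℕ
      twice zero i = i
      twice (suc j) i = twice j (2 + i)

      turn : ∀ i {h} → w i ≡ inj₁ h → ∃[ h′ ] (w (2 + i) ≡ inj₁ h′ × (h′ ≡ prev h ⊎ h ≡ prev h′))
      turn i {h} e = along (w (1 + i)) (w (2 + i)) refl (subst (λ a → AdjV a (w (1 + i))) e (step i)) (step (1 + i))
        where
        along : ∀ b c → w (2 + i) ≡ c → AdjV (inj₁ h) b → AdjV b c → ∃[ h′ ] (c ≡ inj₁ h′ × (h′ ≡ prev h ⊎ h ≡ prev h′))
        along (inj₂ (τ , _)) (inj₁ h′) e′ (inj₁ refl) (inj₁ refl) = contradiction (trans e′ (sym e)) (no-return i)
        along (inj₂ (τ , _)) (inj₁ h′) e′ (inj₁ refl) (inj₂ r) = h′ , refl , inj₁ r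
        along (inj₂ (τ , _)) (inj₁ h′) e′ (inj₂ r) (inj₁ refl) = h′ , refl , inj₂ r
        along (inj₂ (τ , _)) (inj₁ h′) e′ (inj₂ r) (inj₂ r′) = contradiction (trans e′ (trans (cong inj₁ (trans r′ (sym r))) (sym e))) (no-return i)

      -- After the move from h to `prev h`, a turn in the other direction would lead to h again,
      -- four steps after w i; this contradicts `no-square`.
      backwards : ∀ j i {h} → w i ≡ inj₁ h → w (2 + i) ≡ inj₁ (prev h) → w (twice j i) ≡ inj₁ (back j h)
      backwards zero i e e′ = e
      backwards (suc j) i {h} e e′ with turn (2 + i) e′
      ... | h″ , e″ , inj₁ refl = trans (backwards j (2 + i) e′ e″) (cong inj₁ (back-prev j h))
      ... | h″ , e″ , inj₂ r = contradiction (trans e″ (trans (cong inj₁ (sym (prev-injective r))) (sym e))) (no-square i)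

      forwards : ∀ j i {h h′} → w i ≡ inj₁ h → w (2 + i) ≡ inj₁ h′ → h ≡ prev h′ → ∃[ g ] (w (twice j i) ≡ inj₁ g × h ≡ back j g)
      forwards zero i {h} e _ _ = h , e , refl
      forwards (suc j) i {h} {h′} e e′ r with turn (2 + i) e′
      ... | h″ , e″ , inj₁ r″ = contradiction (trans e″ (trans (cong inj₁ (trans r″ (sym r))) (sym e))) (no-square i)
      ... | h″ , e″ , inj₂ r″ with forwards j (2 + i) e′ e″ r″
      ... | g , eg , rg = g , eg , trans r (cong prev rg)

      closes : ∀ j {h} → w 0 ≡ inj₁ h → w (twice j 0) ≡ w 0 → suc r ∣ j
      closes j {h} e closed with turn 0 e
      ... | h′ , e′ , inj₁ refl = back-fixed⇒∣ j (inj₁-injective (trans (sym (backwards j 0 e e′)) (trans closed e)))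
      ... | h′ , e′ , inj₂ q with forwards j 0 e e′ q
      ... | g , eg , rg = back-fixed⇒∣ j {h} (trans (cong (back j) (inj₁-injective (trans (sym e) (trans (sym closed) eg)))) (sym rg))

    short-cycles : ∀ k → CycleOfLength necklace k → k ≢ 4 → suc r ≤ k
    short-cycles (suc m) (3≤k , f , f-inj , f-steps , f-close) k≢4 = ∣⇒≤ (from (decode (f zero)) refl)
      where
      k = suc m
      f-prev : ∀ a → AdjV (decode (f a)) (decode (f (prev a)))
      f-prev zero = adj⇒ (f zero) (f (fromℕ m)) (adj-sym necklace {f (fromℕ m)} {f zero} f-close)
      f-prev (suc i) = adj⇒ (f (suc i)) (f (inject₁ i)) (adj-sym necklace {f (inject₁ i)} {f (suc i)} (f-steps i))
      not-fixed : ∀ j → 0 < j → j < k ⊎ (j ≡ 4) → ∀ a i → decode (f (back (j + i) a)) ≢ decode (f (back i a))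
      not-fixed j 0<j small a i e = bad small (back-fixed⇒∣ j (trans (back-+ j i) (f-inj (decode-injective _ _ e))))
        where
        back-+ : ∀ j i → back j (back i a) ≡ back (j + i) a
        back-+ zero i = refl
        back-+ (suc j) i = cong prev (back-+ j i)
        bad : j < k ⊎ (j ≡ 4) → ¬ (k ∣ j)
        bad (inj₁ j<k) d = contradiction (∣⇒≤ {{>-nonZero 0<j}} d) (ℕ.<⇒≱ j<k)
        bad (inj₂ refl) d = only-four k 3≤k k≢4 d
          where
          -- A periodic run comes back after four steps only if its length divides 4; here cycles of
          -- length 4 drop out.
          only-four : ∀ k → 3 ≤ k → k ≢ 4 → ¬ (k ∣ 4)
          only-four zero () _ _
          only-four (suc zero) (s≤s ()) _ _
          only-four (suc (suc zero)) (s≤s (s≤s ())) _ _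
          only-four (suc (suc (suc zero))) _ _ (divides zero ())
          only-four (suc (suc (suc zero))) _ _ (divides (suc zero) ())
          only-four (suc (suc (suc zero))) _ _ (divides (suc (suc q)) ())
          only-four (suc (suc (suc (suc zero)))) _ k≢4 _ = k≢4 refl
          only-four (suc (suc (suc (suc (suc k))))) _ _ d = contradiction (∣⇒≤ d) λ { (s≤s (s≤s (s≤s (s≤s ())))) }
      -- The cycle is run through twice: after 2 k steps the walk is back at its start and has made
      -- k moves between hubs in one direction. This avoids having to know that k is even.
      walk : ∀ a {h} → decode (f a) ≡ inj₁ h → suc r ∣ k
      walk a e = Walk.closes (λ i → decode (f (back i a))) (λ i → f-prev (back i a))
        (λ i → not-fixed 2 (s≤s z≤n) (inj₁ 3≤k) a i) (λ i → not-fixed 4 (s≤s z≤n) (inj₂ refl) a i) k e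
        (cong (λ b → decode (f b)) (trans (cong (λ i → back i a) (twice≡ k 0)) (trans (cong (λ i → back i a) (ℕ.+-identityʳ (2 * k))) (back-full 2 a))))
        where
        open Walk (λ i → decode (f (back i a))) (λ i → f-prev (back i a))
          (λ i → not-fixed 2 (s≤s z≤n) (inj₁ 3≤k) a i) (λ i → not-fixed 4 (s≤s z≤n) (inj₂ refl) a i) using (twice)
        twice≡ : ∀ j i → twice j i ≡ 2 * j + i
        twice≡ zero i = refl
        twice≡ (suc j) i = trans (twice≡ j (2 + i)) (arith j i)
          where
          arith : ∀ j i → 2 * j + (2 + i) ≡ 2 * (1 + j) + i
          arith = solve-∀
      from : ∀ v → decode (f zero) ≡ v → suc r ∣ k
      from (inj₁ h) e = walk zero e
      from (inj₂ (τ , j)) e = next (decode (f (prev zero))) refl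
        where
        next : ∀ v → decode (f (prev zero)) ≡ v → suc r ∣ k
        next (inj₁ h) e′ = walk (prev zero) e′
        next (inj₂ _) e′ = ⊥-elim (subst₂ AdjV e e′ (f-prev zero))

    sum-V : (f : Fin order → ℕ) → sum f ≡ sum (λ h → f (encode (inj₁ h))) + sum (λ τ → sum (λ j → f (encode (inj₂ (τ , j)))))
    sum-V f = trans (sum-↑ (suc r) f) (cong (sum {suc r} (λ h → f (h ↑ˡ (suc r * p))) +_) (sum-combine (suc r) (λ v → f (suc r ↑ʳ v))))

    max-degree : 1 ≤ p → maxDegree necklace ≤ p * 2
    max-degree 1≤p = max-allFin-≤ (degree necklace) (λ v → ℕ.≤-trans (ℕ.≤-reflexive (sym (degree-sum necklace v)))
      (ℕ.≤-trans (sum-mono (λ w → #-mono (adj? necklace v w) (adjV? (decode v) (decode w)) (adj⇒ v w)))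
        (ℕ.≤-trans (ℕ.≤-reflexive (trans (sum-V (λ w → # (adjV? (decode v) (decode w))))
          (cong₂ _+_ (sum-cong-≗ (λ h → cong (λ x → # (adjV? (decode v) x)) (decode-encode (inj₁ h))))
            (sum-cong-≗ (λ τ → sum-cong-≗ (λ j → cong (λ x → # (adjV? (decode v) x)) (decode-encode (inj₂ (τ , j)))))))))
          (bound (decode v)))))
      where
      two : ∀ {n} {f : Fin n → ℕ} a b → (∀ i → f i ≤ # (i ≟ a) * 1 + # (i ≟ b) * 1) → sum f ≤ 2
      two a b h = ℕ.≤-trans (sum-mono h) (ℕ.≤-reflexive (trans (∑-distrib-+ (λ i → # (i ≟ a) * 1) (λ i → # (i ≟ b) * 1))
        (cong₂ _+_ (sum-point a (λ _ → 1)) (sum-point b (λ _ → 1)))))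
      inc-bound : ∀ h τ → # (inc? h τ) ≤ # (h ≟ τ) * 1 + # (h ≟ prev τ) * 1
      inc-bound h τ = ℕ.≤-trans (#-⊎ (h ≟ τ) (h ≟ prev τ)) (ℕ.≤-reflexive (sym (cong₂ _+_ (ℕ.*-identityʳ (# (h ≟ τ))) (ℕ.*-identityʳ (# (h ≟ prev τ))))))
      hubs-of-type : ∀ τ → sum (λ h → # (inc? h τ)) ≤ 2
      hubs-of-type τ = two τ (prev τ) (λ h → inc-bound h τ)
      types-of-hub : ∀ h → sum (λ τ → # (inc? h τ)) ≤ 2
      types-of-hub h = ℕ.≤-trans (sum-mono (λ τ → inc-bound h τ)) (ℕ.≤-reflexive
        (trans (∑-distrib-+ (λ τ → # (h ≟ τ) * 1) (λ τ → # (h ≟ prev τ) * 1))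
          (cong₂ _+_ one (trans (sum-prev (λ τ → # (h ≟ τ) * 1)) one))))
        where
        one : sum (λ τ → # (h ≟ τ) * 1) ≡ 1
        one = trans (sum-cong-≗ (λ τ → cong (_* 1) (#-cong (h ≟ τ) (τ ≟ h) sym sym))) (sum-point h (λ _ → 1))
      bound : ∀ v → sum (λ h → # (adjV? v (inj₁ h))) + sum (λ τ → sum (λ j → # (adjV? v (inj₂ (τ , j))))) ≤ p * 2
      bound (inj₁ h) = ℕ.≤-trans (ℕ.≤-reflexive (cong₂ _+_ (sum-zero {suc r} (λ _ → 0) (λ _ → refl))
          (trans (sum-cong-≗ (λ τ → sum-const p (# (inc? h τ)))) (sym (*-distribˡ-sum p (λ τ → # (inc? h τ)))))))
        (ℕ.*-monoʳ-≤ p (types-of-hub h))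
      -- A vertex between hubs has degree at most 2, which is within the bound because p ≥ 1.
      bound (inj₂ (τ , _)) = ℕ.≤-trans (ℕ.+-mono-≤ (hubs-of-type τ) (ℕ.≤-reflexive (sum-zero {suc r} _ (λ _ → sum-zero {p} _ (λ _ → refl)))))
        (ℕ.≤-trans (ℕ.*-monoˡ-≤ 2 1≤p) (ℕ.≤-refl))

    -- A colour occurs on at most one vertex at each hub, so in an odd necklace
    -- r = 2 t on at most t of the suc r * p vertices between hubs.
    colours : ∀ t {k} → 1 ≤ t → r ≡ 2 * t → SquareColourable necklace k → suc r * p ≤ k * t
    colours t {k} 1≤t r≡2t (c , proper) = begin
      suc r * p                                                        ≡⟨ cong (suc r *_) (trans (sym (ℕ.*-identityʳ p)) (sym (sum-const p 1))) ⟩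
      suc r * sum (λ (j : Fin p) → 1)                                  ≡⟨ sum-const (suc r) _ ⟨
      sum (λ (τ : Hub) → sum (λ (j : Fin p) → 1))                      ≡⟨ sum-cong-≗ (λ τ → sum-cong-≗ (λ j → one-colour τ j)) ⟩
      sum (λ τ → sum (λ j → sum (λ κ → # (has? κ τ j))))               ≡⟨ sum-cong-≗ (λ τ → ∑-comm (λ j κ → # (has? κ τ j))) ⟩
      sum (λ τ → sum (λ κ → s κ τ))                                    ≡⟨ ∑-comm (λ τ κ → s κ τ) ⟩
      sum (λ κ → sum (s κ))                                            ≤⟨ sum-mono few ⟩
      sum (λ (κ : Fin k) → t)                                          ≡⟨ sum-const k t ⟩
      k * t                                                            ∎
      where
      open ℕ.≤-Reasoning
      has? : ∀ κ τ j → Dec (c (encode (inj₂ (τ , j))) ≡ κ)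
      has? κ τ j = c (encode (inj₂ (τ , j))) ≟ κ
      s : Fin k → Hub → ℕ
      s κ τ = sum (λ j → # (has? κ τ j))
      one-colour : ∀ τ j → 1 ≡ sum (λ κ → # (has? κ τ j))
      one-colour τ j = sym (trans (sum-cong-≗ (λ κ → trans (#-cong (has? κ τ j) (κ ≟ cτj) sym sym) (sym (ℕ.*-identityʳ _)))) (sum-point cτj (λ _ → 1)))
        where cτj = c (encode (inj₂ (τ , j)))
      same : ∀ {h τ τ′ j j′} → Inc h τ → Inc h τ′ → c (encode (inj₂ (τ , j))) ≡ c (encode (inj₂ (τ′ , j′))) → _≡_ {A = Hub × Fin p} (τ , j) (τ′ , j′)
      same {h} {τ} {τ′} {j} {j′} hτ hτ′ e = by (u ≟ v)
        where
        u = encode (inj₂ (τ , j))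
        v = encode (inj₂ (τ′ , j′))
        by : Dec (u ≡ v) → _
        by (yes u≡v) = inj₂-injective (trans (sym (decode-encode (inj₂ (τ , j)))) (trans (cong decode u≡v) (decode-encode (inj₂ (τ′ , j′)))))
        by (no u≢v) = contradiction e (proper u v (u≢v , inj₂ (encode (inj₁ h) , adj⇐ (inj₂ (τ , j)) (inj₁ h) hτ , adj⇐ (inj₁ h) (inj₂ (τ′ , j′)) hτ′)))
      s≤1 : ∀ κ τ → s κ τ ≤ 1
      s≤1 κ τ = sum-unique (has? κ τ) (λ e e′ → proj₂ (,-injective (same {τ} (inj₁ refl) (inj₁ refl) (trans e (sym e′)))))
      -- The vertices of types τ and `prev τ` are all joined to the hub `prev τ`.
      pair : ∀ κ τ → s κ τ + s κ (prev τ) ≤ 1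
      pair κ τ = by (s κ τ) (s κ (prev τ)) refl refl (s≤1 κ τ) (s≤1 κ (prev τ))
        where
        by : ∀ x y → s κ τ ≡ x → s κ (prev τ) ≡ y → x ≤ 1 → y ≤ 1 → x + y ≤ 1
        by zero y _ _ _ y≤1 = y≤1
        by (suc zero) zero _ _ _ _ = s≤s z≤n
        by (suc (suc x)) _ _ _ (s≤s ()) _
        by (suc zero) (suc y) e e′ _ _ = clash (sum>0 _ (ℕ.≤-reflexive (sym e))) (sum>0 _ (subst (1 ≤_) (sym e′) (s≤s z≤n)))
          where
          clash : ∃[ j ] 1 ≤ # (has? κ τ j) → ∃[ j ] 1 ≤ # (has? κ (prev τ) j) → 1 + suc y ≤ 1
          clash (j , h) (j′ , h′) = contradiction
            (sym (proj₁ (,-injective (same {prev τ} (inj₂ refl) (inj₁ refl) (trans (#-pos (has? κ τ j) h) (sym (#-pos (has? κ (prev τ) j′) h′)))))))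
            (prev≢ (subst (1 ≤_) (sym r≡2t) (ℕ.≤-trans 1≤t (ℕ.m≤m+n t _))) τ)
      -- Each type lies in two of the cyclic pairs, so twice the sum is at most 2 t + 1. Parity
      -- gives t: the odd number of hubs is what makes the rounding gain.
      few : ∀ κ → sum (s κ) ≤ t
      few κ = halve (begin
        sum (s κ) + sum (s κ)                       ≡⟨ cong (sum (s κ) +_) (sum-prev (s κ)) ⟨
        sum (s κ) + sum (λ τ → s κ (prev τ))        ≡⟨ ∑-distrib-+ (s κ) (λ τ → s κ (prev τ)) ⟨
        sum (λ τ → s κ τ + s κ (prev τ))            ≤⟨ sum-mono (pair κ) ⟩
        sum (λ (τ : Hub) → 1)                       ≡⟨ trans (sum-const (suc r) 1) (ℕ.*-identityʳ (suc r)) ⟩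
        suc r                                       ≡⟨ cong suc r≡2t ⟩
        1 + 2 * t                                   ∎)
        where
        halve : ∀ {x} → x + x ≤ 1 + 2 * t → x ≤ t
        halve {x} h = ℕ.≮⇒≥ (λ t<x → contradiction (ℕ.≤-trans (ℕ.≤-reflexive (arith t)) (ℕ.≤-trans (ℕ.+-mono-≤ t<x t<x) h)) (ℕ.<⇒≱ (ℕ.n<1+n _)))
          where
          arith : ∀ t → 1 + (1 + 2 * t) ≡ (1 + t) + (1 + t)
          arith = solve-∀

-- A straight-line drawing of the necklace.

module NecklaceDrawing where

  open import Defs hiding (sym)
  open Crossings
  open Sums
  open Necklaces
  open import Data.Nat as ℕ using (ℕ; zero; suc; z≤n; s≤s)
  open import Data.Nat.Properties as ℕ using ()
  open import Data.Integer as ℤ using (+_)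
  open import Data.Integer.Properties as ℤ using ()
  open import Data.Bool as Bool using (Bool; true; false)
  open import Data.Fin as Fin using (Fin; zero; suc; toℕ)
  open import Data.Fin.Properties as Fin using (_≟_)
  open import Data.List using ([]; _∷_; [_])
  open import Data.Rational as ℚ using (ℚ; 0ℚ; 1ℚ; _<_; _-_; -_; toℚᵘ) renaming (_+_ to _+ℚ_; _*_ to _*ℚ_; _≤_ to _≤ℚ_)
  open import Data.Rational.Properties as ℚ using ()
  open import Data.Rational.Unnormalised as ℚᵘ using (mkℚᵘ; *≡*)
  open import Data.Rational.Unnormalised.Properties as ℚᵘ using ()
  open import Data.Rational.Solver using (module +-*-Solver)
  open import Data.Product using (∃-syntax; _×_; _,_; proj₁; proj₂)
  open import Data.Sum as Sum using (_⊎_; inj₁; inj₂)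
  open import Relation.Nullary using (¬_; yes; no; contradiction)
  open import Relation.Binary.Definitions using (tri<; tri≈; tri>)
  open import Relation.Binary.PropositionalEquality hiding ([_])
  open +-*-Solver using (solve; _:+_; _:*_; _:-_; :-_; _:=_; con)
  open import Data.Nat.Tactic.RingSolver using (solve-∀)

  abstract
    ι : ℕ → ℚ
    ι n = + n ℚ./ 1

    toℚᵘ-ι : ∀ n → toℚᵘ (ι n) ℚᵘ.≃ mkℚᵘ (+ n) 0
    toℚᵘ-ι n = ℚ.toℚᵘ-fromℚᵘ (mkℚᵘ (+ n) 0)

    ι-+ : ∀ m n → ι (m ℕ.+ n) ≡ ι m +ℚ ι n
    ι-+ m n = ℚ.toℚᵘ-injective (ℚᵘ.≃-trans (toℚᵘ-ι (m ℕ.+ n)) (ℚᵘ.≃-sym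
      (ℚᵘ.≃-trans (ℚ.toℚᵘ-homo-+ (ι m) (ι n)) (ℚᵘ.≃-trans (ℚᵘ.+-cong (toℚᵘ-ι m) (toℚᵘ-ι n)) (*≡* (cong (ℤ._* + 1) (cong₂ ℤ._+_ (ℤ.*-identityʳ (+ m)) (ℤ.*-identityʳ (+ n)))))))))

    ι-* : ∀ m n → ι (m ℕ.* n) ≡ ι m *ℚ ι n
    ι-* m n = ℚ.toℚᵘ-injective (ℚᵘ.≃-trans (toℚᵘ-ι (m ℕ.* n)) (ℚᵘ.≃-sym
      (ℚᵘ.≃-trans (ℚ.toℚᵘ-homo-* (ι m) (ι n)) (ℚᵘ.≃-trans (ℚᵘ.*-cong (toℚᵘ-ι m) (toℚᵘ-ι n)) (*≡* (cong (ℤ._* + 1) (sym (ℤ.pos-* m n))))))))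

    ι-nonneg : ∀ n → 0ℚ ≤ℚ ι n
    ι-nonneg n = ℚ.nonNegative⁻¹ (ι n) {{ℚ.normalize-nonNeg n 1}}

    ι-pos : ∀ n → Pos (ι (suc n))
    ι-pos n = ℚ.positive⁻¹ (ι (suc n)) {{ℚ.normalize-pos (suc n) 1}}

    ι-injective : ∀ {m n} → ι m ≡ ι n → m ≡ n
    ι-injective {m} {n} e = by (ℚᵘ.≃-trans (ℚᵘ.≃-sym (toℚᵘ-ι m)) (ℚᵘ.≃-trans (ℚᵘ.≃-reflexive (cong toℚᵘ e)) (toℚᵘ-ι n)))
      where
      by : mkℚᵘ (+ m) 0 ℚᵘ.≃ mkℚᵘ (+ n) 0 → m ≡ n
      by (*≡* h) = ℤ.+-injective (trans (sym (ℤ.*-identityʳ (+ m))) (trans h (ℤ.*-identityʳ (+ n))))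

    ι-0 : ι 0 ≡ 0ℚ
    ι-0 = refl

  nonneg-+ : ∀ {x y} → 0ℚ ≤ℚ x → 0ℚ ≤ℚ y → 0ℚ ≤ℚ x +ℚ y
  nonneg-+ = ℚ.+-mono-≤

  nonneg-* : ∀ {x y} → 0ℚ ≤ℚ x → 0ℚ ≤ℚ y → 0ℚ ≤ℚ x *ℚ y
  nonneg-* {x} {y} p q = subst (_≤ℚ x *ℚ y) (ℚ.*-zeroʳ x) (ℚ.*-monoˡ-≤-nonNeg x {{ℚ.nonNegative p}} q)

  ≤⇒nonneg : ∀ {x y} → x ≤ℚ y → 0ℚ ≤ℚ y - x
  ≤⇒nonneg {x} {y} l = subst (_≤ℚ y - x) (ℚ.+-inverseʳ x) (ℚ.+-monoˡ-≤ (- x) l)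

  pos+nonneg≢0 : ∀ {x y} → Pos x → 0ℚ ≤ℚ y → x +ℚ y ≢ 0ℚ
  pos+nonneg≢0 p q e = pos-irrefl (subst Pos e (ℚ.+-mono-<-≤ p q))

  nonneg-zero : ∀ {x y} → 0ℚ ≤ℚ x → 0ℚ ≤ℚ y → x +ℚ y ≡ 0ℚ → x ≡ 0ℚ
  nonneg-zero {x} {y} p q e = by (sign x)
    where
    by : Sign x → x ≡ 0ℚ
    by (plus px) = contradiction e (pos+nonneg≢0 px q)
    by (nil z) = z
    by (minus n) = contradiction (ℚ.<-≤-trans n (subst (_≤ℚ 0ℚ) (ℚ.+-identityˡ (- x)) (subst (0ℚ +ℚ - x ≤ℚ_) (ℚ.+-inverseʳ x) (ℚ.+-monoˡ-≤ (- x) p)))) pos-irrefl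

  ≡⇒-‿zero : ∀ {x y} → x ≡ y → x - y ≡ 0ℚ
  ≡⇒-‿zero {x} refl = ℚ.+-inverseʳ x

  data Side : Set where
    east west : Side

  -- the segment from (h , 0) to (h ± w , s w)
  record Ray : Set where
    constructor ray
    field
      side  : Side
      h s w : ℚ

  move : Side → ℚ → ℚ → ℚ
  move east x τ = x +ℚ τ
  move west x τ = x - τ

  at : Ray → ℚ → Point
  at (ray σ h s w) τ = move σ h τ , s *ℚ τ

  record OnRay (ρ : Ray) (q : Point) : Set where
    constructor onRay
    field
      τ      : ℚ
      τ≥0    : 0ℚ ≤ℚ τ
      τ≤w    : 0ℚ ≤ℚ Ray.w ρ - τ
      at-τ   : q ≡ at ρ τ

  data EndOf (ρ : Ray) (q : Point) : Set where
    at-start  : q ≡ at ρ 0ℚ → EndOf ρ q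
    at-finish : q ≡ at ρ (Ray.w ρ) → EndOf ρ q

  Apart : Ray → Ray → Set
  Apart ρ ρ′ = ∀ {q} → OnRay ρ q → OnRay ρ′ q → EndOf ρ q × EndOf ρ′ q

  apart-sym : ∀ {ρ ρ′} → Apart ρ ρ′ → Apart ρ′ ρ
  apart-sym A on on′ with A on′ on
  ... | e , e′ = e′ , e

  start : ∀ {ρ q} (on : OnRay ρ q) → OnRay.τ on ≡ 0ℚ → EndOf ρ q
  start (onRay τ _ _ e) refl = at-start e

  finish : ∀ {ρ q} (on : OnRay ρ q) → OnRay.τ on ≡ Ray.w ρ → EndOf ρ q
  finish (onRay τ _ _ e) refl = at-finish e

  move-injective : ∀ σ h {τ τ′} → move σ h τ ≡ move σ h τ′ → τ ≡ τ′
  move-injective east h {τ} {τ′} e = trans (z h τ) (trans (cong (_- h) e) (sym (z h τ′)))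
    where
    z : ∀ h τ → τ ≡ h +ℚ τ - h
    z = solve 2 (λ h τ → τ := h :+ τ :- h) refl
  move-injective west h {τ} {τ′} e = trans (z h τ) (trans (cong (λ x → h - x) e) (sym (z h τ′)))
    where
    z : ∀ h τ → τ ≡ h - (h - τ)
    z = solve 2 (λ h τ → τ := h :- (h :- τ)) refl

  apart-slopes : ∀ σ {h s f w w′} → Pos f → Apart (ray σ h s w) (ray σ h (s +ℚ f) w′)
  apart-slopes σ {h} {s} {f} pf on@(onRay τ τ≥0 _ e) on′@(onRay τ′ _ _ e′) = start on τ≡0 , start on′ (trans (sym τ≡τ′) τ≡0)
    where
    τ≡τ′ : τ ≡ τ′
    τ≡τ′ = move-injective σ h (cong proj₁ (trans (sym e) e′))
    τ≡0 : τ ≡ 0ℚ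
    τ≡0 = *-cancelˡ pf (trans (trans (solve 3 (λ s f τ → f :* τ := (s :+ f) :* τ :- s :* τ) refl s f τ)
      (≡⇒-‿zero (trans (cong ((s +ℚ f) *ℚ_) τ≡τ′) (cong proj₂ (trans (sym e′) e))))) (sym (ℚ.*-zeroʳ f)))

  apart-opposite : ∀ {h s s′ w w′} → Apart (ray east h s w) (ray west h s′ w′)
  apart-opposite {h} on@(onRay τ τ≥0 _ e) on′@(onRay τ′ τ′≥0 _ e′) =
    start on (nonneg-zero τ≥0 τ′≥0 sum≡0) , start on′ (nonneg-zero τ′≥0 τ≥0 (trans (ℚ.+-comm τ′ τ) sum≡0))
    where
    sum≡0 : τ +ℚ τ′ ≡ 0ℚ
    sum≡0 = trans (solve 3 (λ h τ τ′ → τ :+ τ′ := (h :+ τ) :- (h :- τ′)) refl h τ τ′) (≡⇒-‿zero (cong proj₁ (trans (sym e) e′)))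

  -- The starting points are at least the sum of the widths apart, with slack e. Only rays facing
  -- each other can meet, and then both have to be at their tips.
  apart-far : ∀ σ σ′ {h s s′ w w′ e} → Pos w → Pos w′ → 0ℚ ≤ℚ e → Apart (ray σ h s w) (ray σ′ (h +ℚ (w +ℚ w′ +ℚ e)) s′ w′)
  apart-far east west {h} {w = w} {w′} {e} pw pw′ e≥0 on@(onRay τ _ a≥0 eq) on′@(onRay τ′ _ a′≥0 eq′) =
    finish on (sym (-‿zero w τ (nonneg-zero a≥0 (nonneg-+ a′≥0 e≥0) sum≡0)))
    , finish on′ (sym (-‿zero w′ τ′ (nonneg-zero a′≥0 (nonneg-+ a≥0 e≥0) (trans (solve 3 (λ a b c → b :+ (a :+ c) := a :+ (b :+ c)) refl (w - τ) (w′ - τ′) e) sum≡0))))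
    where
    sum≡0 : (w - τ) +ℚ ((w′ - τ′) +ℚ e) ≡ 0ℚ
    sum≡0 = trans (solve 6 (λ h w w′ e τ τ′ → (w :- τ) :+ ((w′ :- τ′) :+ e) := (h :+ (w :+ w′ :+ e) :- τ′) :- (h :+ τ)) refl h w w′ e τ τ′)
      (≡⇒-‿zero (cong proj₁ (trans (sym eq′) eq)))
  apart-far east east {h} {w = w} {w′} {e} pw pw′ e≥0 (onRay τ _ a≥0 eq) (onRay τ′ τ′≥0 _ eq′) =
    contradiction sum≡0 (pos+nonneg≢0 pw′ (nonneg-+ (nonneg-+ a≥0 τ′≥0) e≥0))
    where
    sum≡0 : w′ +ℚ ((w - τ) +ℚ τ′ +ℚ e) ≡ 0ℚ
    sum≡0 = trans (solve 6 (λ h w w′ e τ τ′ → w′ :+ ((w :- τ) :+ τ′ :+ e) := (h :+ (w :+ w′ :+ e) :+ τ′) :- (h :+ τ)) refl h w w′ e τ τ′)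
      (≡⇒-‿zero (cong proj₁ (trans (sym eq′) eq)))
  apart-far west west {h} {w = w} {w′} {e} pw pw′ e≥0 (onRay τ τ≥0 _ eq) (onRay τ′ _ a′≥0 eq′) =
    contradiction sum≡0 (pos+nonneg≢0 pw (nonneg-+ (nonneg-+ a′≥0 τ≥0) e≥0))
    where
    sum≡0 : w +ℚ ((w′ - τ′) +ℚ τ +ℚ e) ≡ 0ℚ
    sum≡0 = trans (solve 6 (λ h w w′ e τ τ′ → w :+ ((w′ :- τ′) :+ τ :+ e) := (h :+ (w :+ w′ :+ e) :- τ′) :- (h :- τ)) refl h w w′ e τ τ′)
      (≡⇒-‿zero (cong proj₁ (trans (sym eq′) eq)))
  apart-far west east {h} {w = w} {w′} {e} pw pw′ e≥0 (onRay τ τ≥0 _ eq) (onRay τ′ τ′≥0 _ eq′) =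
    contradiction sum≡0 (pos+nonneg≢0 (pos-+ pw pw′) (nonneg-+ (nonneg-+ τ≥0 τ′≥0) e≥0))
    where
    sum≡0 : (w +ℚ w′) +ℚ (τ +ℚ τ′ +ℚ e) ≡ 0ℚ
    sum≡0 = trans (solve 6 (λ h w w′ e τ τ′ → (w :+ w′) :+ (τ :+ τ′ :+ e) := (h :+ (w :+ w′ :+ e) :+ τ′) :- (h :- τ)) refl h w w′ e τ τ′)
      (≡⇒-‿zero (cong proj₁ (trans (sym eq′) eq)))

  -- Where the rays could meet, the point is at least as far along the steeper
  -- ray as along the other one, hence higher.
  apart-steep : ∀ σ σ′ {h s f e w w′} → Pos w → 0ℚ ≤ℚ s → Pos f → 0ℚ ≤ℚ e →
    Apart (ray σ (move σ′ h (w +ℚ w +ℚ e)) s w) (ray σ′ h (s +ℚ f) w′)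
  apart-steep σ σ′ {h} {s} {f} {e} {w} pw s≥0 pf e≥0 (onRay τ τ≥0 a≥0 eq) (onRay τ′ _ _ eq′) =
    by σ σ′ (cong proj₁ (trans (sym eq) eq′))
    where
    steep : 0ℚ ≤ℚ τ′ - τ → Pos τ′ → ∀ {A : Set} → A
    steep d pτ′ = contradiction
      (trans (solve 4 (λ s f τ τ′ → f :* τ′ :+ s :* (τ′ :- τ) := (s :+ f) :* τ′ :- s :* τ) refl s f τ τ′) (≡⇒-‿zero (cong proj₂ (trans (sym eq′) eq))))
      (pos+nonneg≢0 (pos-* pf pτ′) (nonneg-* s≥0 d))
    outward : τ′ ≡ (w +ℚ w +ℚ e) +ℚ τ → ∀ {A : Set} → A
    outward refl = steep
      (subst (0ℚ ≤ℚ_) (solve 3 (λ w e τ → w :+ w :+ e := (w :+ w :+ e) :+ τ :- τ) refl w e τ) (nonneg-+ (ℚ.<⇒≤ (pos-+ pw pw)) e≥0))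
      (ℚ.+-mono-<-≤ (ℚ.+-mono-<-≤ (pos-+ pw pw) e≥0) τ≥0)
    inward : τ′ ≡ (w +ℚ w +ℚ e) - τ → ∀ {A : Set} → A
    inward refl = steep
      (subst (0ℚ ≤ℚ_) (solve 3 (λ w e τ → ((w :- τ) :+ (w :- τ)) :+ e := (w :+ w :+ e) :- τ :- τ) refl w e τ) (nonneg-+ (nonneg-+ a≥0 a≥0) e≥0))
      (subst Pos (solve 3 (λ w e τ → w :+ ((w :- τ) :+ e) := (w :+ w :+ e) :- τ) refl w e τ) (ℚ.+-mono-<-≤ pw (nonneg-+ a≥0 e≥0)))
    by : ∀ σ σ′ → move σ (move σ′ h (w +ℚ w +ℚ e)) τ ≡ move σ′ h τ′ → ∀ {A : Set} → A
    by east east x = outward (move-injective east h (trans (sym x) (solve 3 (λ h d τ → h :+ d :+ τ := h :+ (d :+ τ)) refl h (w +ℚ w +ℚ e) τ)))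
    by west east x = inward (move-injective east h (trans (sym x) (solve 3 (λ h d τ → h :+ d :- τ := h :+ (d :- τ)) refl h (w +ℚ w +ℚ e) τ)))
    by east west x = inward (move-injective west h (trans (sym x) (solve 3 (λ h d τ → h :- d :+ τ := h :- (d :- τ)) refl h (w +ℚ w +ℚ e) τ)))
    by west west x = outward (move-injective west h (trans (sym x) (solve 3 (λ h d τ → h :- d :- τ := h :- (d :+ τ)) refl h (w +ℚ w +ℚ e) τ)))

  natRay : Side → (a s w : ℕ) → Ray
  natRay σ a s w = ray σ (ι (2 ℕ.* a)) (ι s) (ι w)

  natApart-slopes : ∀ σ a {s s′ w w′} → s ℕ.< s′ → Apart (natRay σ a s w) (natRay σ a s′ w′)
  natApart-slopes σ a {s} {s′} {w} {w′} s<s′ with ℕ.m≤n⇒∃[o]m+o≡n s<s′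
  ... | o , refl = subst (λ z → Apart (natRay σ a s w) (ray σ (ι (2 ℕ.* a)) z (ι w′)))
    (trans (sym (ι-+ s (suc o))) (cong ι (ℕ.+-suc s o))) (apart-slopes σ (ι-pos o))

  natApart-far : ∀ σ σ′ {a a′ s s′ w w′} → 2 ℕ.* a ℕ.+ (suc w ℕ.+ suc w′) ℕ.≤ 2 ℕ.* a′ →
    Apart (natRay σ a s (suc w)) (natRay σ′ a′ s′ (suc w′))
  natApart-far σ σ′ {a} {a′} {s} {s′} {w} {w′} h with ℕ.m≤n⇒∃[o]m+o≡n h
  ... | o , e = subst (λ z → Apart (natRay σ a s (suc w)) (ray σ′ z (ι s′) (ι (suc w′))))
    (trans (cong (ι (2 ℕ.* a) +ℚ_) (sym (trans (ι-+ (suc w ℕ.+ suc w′) o) (cong (_+ℚ ι o) (ι-+ (suc w) (suc w′))))))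
      (trans (sym (ι-+ (2 ℕ.* a) (suc w ℕ.+ suc w′ ℕ.+ o))) (cong ι (trans (sym (ℕ.+-assoc (2 ℕ.* a) _ o)) e))))
    (apart-far σ σ′ (ι-pos w) (ι-pos w′) (ι-nonneg o))

  natApart-east : ∀ σ {a s s′ w′} → 0 ℕ.< a → s ℕ.< s′ → Apart (natRay σ a s 1) (natRay east 0 s′ w′)
  natApart-east σ {suc a} {s} {s′} {w′} _ s<s′ with ℕ.m≤n⇒∃[o]m+o≡n s<s′
  ... | o , refl = subst₂ (λ h z → Apart (ray σ h (ι s) (ι 1)) (ray east (ι 0) z (ι w′)))
    (trans (cong (ι 0 +ℚ_) (trans (cong (_+ℚ ι (2 ℕ.* a)) (sym (ι-+ 1 1))) (sym (ι-+ 2 (2 ℕ.* a))))) (trans (sym (ι-+ 0 (2 ℕ.+ 2 ℕ.* a))) (cong ι (arith a))))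
    (trans (sym (ι-+ s (suc o))) (cong ι (ℕ.+-suc s o)))
    (apart-steep σ east {h = ι 0} {e = ι (2 ℕ.* a)} (ι-pos 0) (ι-nonneg s) (ι-pos o) (ι-nonneg (2 ℕ.* a)))
    where
    arith : ∀ a → 2 ℕ.+ 2 ℕ.* a ≡ 2 ℕ.* (1 ℕ.+ a)
    arith = solve-∀

  natApart-west : ∀ σ {a r s s′ w′} → a ℕ.< r → s ℕ.< s′ → Apart (natRay σ a s 1) (natRay west r s′ w′)
  natApart-west σ {a} {r} {s} {s′} {w′} a<r s<s′ with ℕ.m≤n⇒∃[o]m+o≡n a<r | ℕ.m≤n⇒∃[o]m+o≡n s<s′
  ... | k , refl | o , refl = subst₂ (λ h z → Apart (ray σ h (ι s) (ι 1)) (ray west (ι (2 ℕ.* (suc a ℕ.+ k))) z (ι w′)))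
    back-to-a
    (trans (sym (ι-+ s (suc o))) (cong ι (ℕ.+-suc s o)))
    (apart-steep σ west {h = ι (2 ℕ.* (suc a ℕ.+ k))} {e = ι (2 ℕ.* k)} (ι-pos 0) (ι-nonneg s) (ι-pos o) (ι-nonneg (2 ℕ.* k)))
    where
    d = ι 1 +ℚ ι 1 +ℚ ι (2 ℕ.* k)
    arith : ∀ a k → 2 ℕ.* (1 ℕ.+ a ℕ.+ k) ≡ 2 ℕ.* a ℕ.+ (2 ℕ.+ 2 ℕ.* k)
    arith = solve-∀
    back-to-a : ι (2 ℕ.* (suc a ℕ.+ k)) - d ≡ ι (2 ℕ.* a)
    back-to-a = trans (cong (_- d) (trans (cong ι (arith a k)) (trans (ι-+ (2 ℕ.* a) (2 ℕ.+ 2 ℕ.* k)) (cong (ι (2 ℕ.* a) +ℚ_) (trans (ι-+ 2 (2 ℕ.* k)) (cong (_+ℚ ι (2 ℕ.* k)) (ι-+ 1 1)))))))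
      (solve 2 (λ x d → x :+ d :- d := x) refl (ι (2 ℕ.* a)) d)

  onSegment⇒onRay : ∀ ρ {q} → 0ℚ ≤ℚ Ray.w ρ → OnSegment q (at ρ 0ℚ) (at ρ (Ray.w ρ)) → OnRay ρ q
  onSegment⇒onRay (ray σ h s w) {qx , qy} w≥0 (t , t≥0 , t≤1 , ex , ey) = onRay (t *ℚ w) (nonneg-* t≥0 w≥0)
    (subst (0ℚ ≤ℚ_) (solve 2 (λ t w → (con 1ℚ :- t) :* w := w :- t :* w) refl t w) (nonneg-* (≤⇒nonneg t≤1) w≥0))
    (cong₂ _,_ (trans ex (along σ)) (trans ey (solve 3 (λ s t w → s :* con 0ℚ :+ t :* (s :* w :- s :* con 0ℚ) := s :* (t :* w)) refl s t w)))
    where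
    along : ∀ σ → move σ h 0ℚ +ℚ t *ℚ (move σ h w - move σ h 0ℚ) ≡ move σ h (t *ℚ w)
    along east = solve 3 (λ h t w → h :+ con 0ℚ :+ t :* (h :+ w :- (h :+ con 0ℚ)) := h :+ t :* w) refl h t w
    along west = solve 3 (λ h t w → h :- con 0ℚ :+ t :* (h :- w :- (h :- con 0ℚ)) := h :- t :* w) refl h t w

  onRay-start : ∀ ρ → 0ℚ ≤ℚ Ray.w ρ → OnRay ρ (at ρ 0ℚ)
  onRay-start ρ w≥0 = onRay 0ℚ ℚ.≤-refl (subst (0ℚ ≤ℚ_) (solve 1 (λ w → w := w :- con 0ℚ) refl (Ray.w ρ)) w≥0) refl

  onRay-finish : ∀ ρ → 0ℚ ≤ℚ Ray.w ρ → OnRay ρ (at ρ (Ray.w ρ))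
  onRay-finish ρ w≥0 = onRay (Ray.w ρ) w≥0 (ℚ.≤-reflexive (sym (ℚ.+-inverseʳ (Ray.w ρ)))) refl

  module Drawing (r′ p : ℕ) where

    r : ℕ
    r = suc r′

    open Necklace r p

    -- Hub i stands at (2 i, 0), and the vertices between consecutive hubs are stacked above the
    -- midpoint, at the tips of rays of slopes 1 to p. The paths of type `zero` close the cycle:
    -- they rise from hub 0 and hub r with slopes above p to tips over the centre, and so pass over
    -- everything else. The Boolean selects the hub τ or `prev τ`.
    rayOf : Hub → Bool → Fin p → Ray
    rayOf zero true j = natRay east 0 (p ℕ.+ suc (toℕ j)) r
    rayOf zero false j = natRay west r (p ℕ.+ suc (toℕ j)) r
    rayOf (suc i) true j = natRay west (suc (toℕ i)) (suc (toℕ j)) 1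
    rayOf (suc i) false j = natRay east (toℕ i) (suc (toℕ j)) 1

    apart-edges : ∀ τ o j τ′ o′ j′ → (τ ≡ τ′ → o ≡ o′ → j ≢ j′) → Apart (rayOf τ o j) (rayOf τ′ o′ j′)
    apart-edges = cases
      where
      nested : ∀ σ a {x w x′ w′} → x ≢ x′ → Apart (natRay σ a x w) (natRay σ a x′ w′)
      nested σ a {x} {w} {x′} x≢x′ with ℕ.<-cmp x x′
      ... | tri< l _ _ = natApart-slopes σ a l
      ... | tri≈ _ e _ = contradiction e x≢x′
      ... | tri> _ _ g = apart-sym (natApart-slopes σ a g)
      one-two : ∀ {a a′} → a ℕ.< a′ → 2 ℕ.* a ℕ.+ (1 ℕ.+ 1) ℕ.≤ 2 ℕ.* a′
      one-two {a} {a′} l = ℕ.≤-trans (ℕ.≤-reflexive (arith a)) (ℕ.*-monoʳ-≤ 2 l)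
        where
        arith : ∀ a → 2 ℕ.* a ℕ.+ 2 ≡ 2 ℕ.* (1 ℕ.+ a)
        arith = solve-∀
      short : ∀ σ a (j : Fin p) σ′ a′ (j′ : Fin p) → (a ≡ a′ → σ ≡ σ′ → j ≢ j′) →
        Apart (natRay σ a (suc (toℕ j)) 1) (natRay σ′ a′ (suc (toℕ j′)) 1)
      short σ a j σ′ a′ j′ distinct with ℕ.<-cmp a a′
      ... | tri< l _ _ = natApart-far σ σ′ {a} {a′} (one-two l)
      ... | tri> _ _ g = apart-sym (natApart-far σ′ σ {a′} {a} (one-two g))
      short east a j east .a j′ distinct | tri≈ _ refl _ = nested east a (λ e → distinct refl refl (Fin.toℕ-injective (ℕ.suc-injective e)))
      short west a j west .a j′ distinct | tri≈ _ refl _ = nested west a (λ e → distinct refl refl (Fin.toℕ-injective (ℕ.suc-injective e)))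
      short east a j west .a j′ distinct | tri≈ _ refl _ = apart-opposite
      short west a j east .a j′ distinct | tri≈ _ refl _ = apart-sym apart-opposite
      steeper : ∀ (j j′ : Fin p) → suc (toℕ j) ℕ.< p ℕ.+ suc (toℕ j′)
      steeper j j′ = ℕ.≤-<-trans (Fin.toℕ<n j) (ℕ.m<m+n p (s≤s z≤n))
      wrap : ∀ (j j′ : Fin p) → j ≢ j′ → p ℕ.+ suc (toℕ j) ≢ p ℕ.+ suc (toℕ j′)
      wrap j j′ d e = d (Fin.toℕ-injective (ℕ.suc-injective (ℕ.+-cancelˡ-≡ p _ _ e)))
      whole : 2 ℕ.* 0 ℕ.+ (r ℕ.+ r) ℕ.≤ 2 ℕ.* r
      whole = ℕ.+-monoʳ-≤ r (ℕ.m≤m+n r 0)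
      -- Either both rays leave the same hub on the same side, and the slopes decide, or the short
      -- one starts at distance at least 2 inwards from the end hub; this is twice its width, as
      -- `apart-steep` requires.
      short-wrap : ∀ i o j o′ j′ → Apart (rayOf (suc i) o j) (rayOf zero o′ j′)
      short-wrap i true j true j′ = natApart-east west (s≤s z≤n) (steeper j j′)
      short-wrap zero false j true j′ = natApart-slopes east 0 (steeper j j′)
      short-wrap (suc i) false j true j′ = natApart-east east (s≤s z≤n) (steeper j j′)
      short-wrap i true j false j′ with ℕ.m≤n⇒m<n∨m≡n (Fin.toℕ<n i)
      ... | inj₁ l = natApart-west west l (steeper j j′)
      ... | inj₂ e = subst (λ a → Apart (natRay west (suc (toℕ i)) (suc (toℕ j)) 1) (natRay west a (p ℕ.+ suc (toℕ j′)) r)) e (natApart-slopes west (suc (toℕ i)) (steeper j j′))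
      short-wrap i false j false j′ = natApart-west east (Fin.toℕ<n i) (steeper j j′)
      cases : ∀ τ o j τ′ o′ j′ → (τ ≡ τ′ → o ≡ o′ → j ≢ j′) → Apart (rayOf τ o j) (rayOf τ′ o′ j′)
      cases zero true j zero true j′ d = nested east 0 (wrap j j′ (d refl refl))
      cases zero false j zero false j′ d = nested west r (wrap j j′ (d refl refl))
      cases zero true j zero false j′ d = natApart-far east west {a = 0} {a′ = r} whole
      cases zero false j zero true j′ d = apart-sym (natApart-far east west {a = 0} {a′ = r} whole)
      cases zero o j (suc i) o′ j′ d = apart-sym (short-wrap i o′ j′ o j)
      cases (suc i) o j zero o′ j′ d = short-wrap i o j o′ j′
      cases (suc i) true j (suc i′) true j′ d = short west (suc (toℕ i)) j west (suc (toℕ i′)) j′ (λ e _ → d (cong suc (Fin.toℕ-injective (ℕ.suc-injective e))) refl)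
      cases (suc i) false j (suc i′) false j′ d = short east (toℕ i) j east (toℕ i′) j′ (λ e _ → d (cong suc (Fin.toℕ-injective e)) refl)
      cases (suc i) true j (suc i′) false j′ d = short west (suc (toℕ i)) j east (toℕ i′) j′ (λ _ ())
      cases (suc i) false j (suc i′) true j′ d = short east (toℕ i) j west (suc (toℕ i′)) j′ (λ _ ())

    hubAt : Hub → Bool → Hub
    hubAt τ true = τ
    hubAt τ false = prev τ

    coordinates : V → ℕ × ℕ
    coordinates (inj₁ h) = 2 ℕ.* toℕ h , 0
    coordinates (inj₂ (zero , j)) = r , (p ℕ.+ suc (toℕ j)) ℕ.* r
    coordinates (inj₂ (suc i , j)) = 1 ℕ.+ 2 ℕ.* toℕ i , suc (toℕ j) ℕ.* 1

    place : V → Point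
    place v = ι (proj₁ (coordinates v)) , ι (proj₂ (coordinates v))

    width≥0 : ∀ τ o j → 0ℚ ≤ℚ Ray.w (rayOf τ o j)
    width≥0 zero true j = ι-nonneg r
    width≥0 zero false j = ι-nonneg r
    width≥0 (suc i) true j = ι-nonneg 1
    width≥0 (suc i) false j = ι-nonneg 1

    place-hub : ∀ τ o j → place (inj₁ (hubAt τ o)) ≡ at (rayOf τ o j) 0ℚ
    place-hub τ o j = cases τ o
      where
      base : ∀ σ {a b} s w → a ≡ b → _≡_ {A = Point} (ι (2 ℕ.* a) , ι 0) (at (natRay σ b s w) 0ℚ)
      base east {a} s w refl = cong₂ _,_ (sym (ℚ.+-identityʳ (ι (2 ℕ.* a)))) (trans ι-0 (sym (ℚ.*-zeroʳ (ι s))))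
      base west {a} s w refl = cong₂ _,_ (sym (ℚ.+-identityʳ (ι (2 ℕ.* a)))) (trans ι-0 (sym (ℚ.*-zeroʳ (ι s))))
      cases : ∀ τ o → place (inj₁ (hubAt τ o)) ≡ at (rayOf τ o j) 0ℚ
      cases zero true = base east {0} (p ℕ.+ suc (toℕ j)) r refl
      cases zero false = base west (p ℕ.+ suc (toℕ j)) r (Fin.toℕ-fromℕ r)
      cases (suc i) true = base west {suc (toℕ i)} (suc (toℕ j)) 1 refl
      cases (suc i) false = base east (suc (toℕ j)) 1 (Fin.toℕ-inject₁ i)

    place-mid : ∀ τ o j → place (inj₂ (τ , j)) ≡ at (rayOf τ o j) (Ray.w (rayOf τ o j))
    place-mid τ o j = cases τ o
      where
      tip-east : ∀ a s w x → x ≡ 2 ℕ.* a ℕ.+ w → _≡_ {A = Point} (ι x , ι (s ℕ.* w)) (at (natRay east a s w) (ι w))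
      tip-east a s w _ refl = cong₂ _,_ (ι-+ (2 ℕ.* a) w) (ι-* s w)
      tip-west : ∀ a s w x → x ℕ.+ w ≡ 2 ℕ.* a → _≡_ {A = Point} (ι x , ι (s ℕ.* w)) (at (natRay west a s w) (ι w))
      tip-west a s w x e = cong₂ _,_ (trans (solve 2 (λ x w → x := x :+ w :- w) refl (ι x) (ι w)) (cong (_- ι w) (trans (sym (ι-+ x w)) (cong ι e)))) (ι-* s w)
      cases : ∀ τ o → place (inj₂ (τ , j)) ≡ at (rayOf τ o j) (Ray.w (rayOf τ o j))
      cases zero true = tip-east 0 (p ℕ.+ suc (toℕ j)) r r refl
      cases zero false = tip-west r (p ℕ.+ suc (toℕ j)) r r (cong (r ℕ.+_) (sym (ℕ.+-identityʳ r)))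
      cases (suc i) true = tip-west (suc (toℕ i)) (suc (toℕ j)) 1 (1 ℕ.+ 2 ℕ.* toℕ i) (arith (toℕ i))
        where
        arith : ∀ a → 1 ℕ.+ 2 ℕ.* a ℕ.+ 1 ≡ 2 ℕ.* (1 ℕ.+ a)
        arith = solve-∀
      cases (suc i) false = tip-east (toℕ i) (suc (toℕ j)) 1 (1 ℕ.+ 2 ℕ.* toℕ i) (ℕ.+-comm 1 _)

    coordinates-injective : ∀ u v → coordinates u ≡ coordinates v → u ≡ v
    coordinates-injective (inj₁ h) (inj₁ h′) e = cong inj₁ (Fin.toℕ-injective (ℕ.*-cancelˡ-≡ (toℕ h) (toℕ h′) 2 (cong proj₁ e)))
    coordinates-injective (inj₁ h) (inj₂ (zero , j)) e = contradiction (trans (cong proj₂ e) (cong (ℕ._* r) (ℕ.+-suc p (toℕ j)))) λ ()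
    coordinates-injective (inj₁ h) (inj₂ (suc i , j)) ()
    coordinates-injective (inj₂ (zero , j)) (inj₁ h) e = contradiction (trans (sym (cong proj₂ e)) (cong (ℕ._* r) (ℕ.+-suc p (toℕ j)))) λ ()
    coordinates-injective (inj₂ (suc i , j)) (inj₁ h) ()
    coordinates-injective (inj₂ (zero , j)) (inj₂ (zero , j′)) e = cong (λ j → inj₂ (zero , j)) (Fin.toℕ-injective (ℕ.suc-injective
      (ℕ.+-cancelˡ-≡ p _ _ (ℕ.*-cancelʳ-≡ (p ℕ.+ suc (toℕ j)) (p ℕ.+ suc (toℕ j′)) r (cong proj₂ e)))))
    coordinates-injective (inj₂ (suc i , j)) (inj₂ (suc i′ , j′)) e = cong₂ (λ i j → inj₂ (suc i , j))
      (Fin.toℕ-injective (ℕ.*-cancelˡ-≡ (toℕ i) (toℕ i′) 2 (ℕ.suc-injective (cong proj₁ e))))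
      (Fin.toℕ-injective (ℕ.suc-injective (ℕ.*-cancelʳ-≡ (suc (toℕ j)) (suc (toℕ j′)) 1 (cong proj₂ e))))
    coordinates-injective (inj₂ (zero , j)) (inj₂ (suc i , j′)) e = contradiction (cong proj₂ e) (lower j j′)
      where
      -- Tips over the centre have height above p, all other tips height at most p; the factor r
      -- only helps, as r ≥ 1.
      lower : ∀ (j j′ : Fin p) → (p ℕ.+ suc (toℕ j)) ℕ.* r ≢ suc (toℕ j′) ℕ.* 1
      lower j j′ e = contradiction (ℕ.≤-reflexive e) (ℕ.<⇒≱ (begin-strict
        suc (toℕ j′) ℕ.* 1           ≡⟨ ℕ.*-identityʳ _ ⟩
        suc (toℕ j′)                 ≤⟨ Fin.toℕ<n j′ ⟩
        p                            <⟨ ℕ.m<m+n p (s≤s z≤n) ⟩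
        p ℕ.+ suc (toℕ j)            ≤⟨ ℕ.m≤m*n (p ℕ.+ suc (toℕ j)) r ⟩
        (p ℕ.+ suc (toℕ j)) ℕ.* r    ∎))
        where open ℕ.≤-Reasoning
    coordinates-injective (inj₂ (suc i , j)) (inj₂ (zero , j′)) e =
      sym (coordinates-injective (inj₂ (zero , j′)) (inj₂ (suc i , j)) (sym e))

    place-injective : ∀ {u v} → place u ≡ place v → u ≡ v
    place-injective {u} {v} e = coordinates-injective u v (cong₂ _,_ (ι-injective (cong proj₁ e)) (ι-injective (cong proj₂ e)))

    record EdgeOf (u v : V) : Set where
      constructor edgeOf
      field
        τ : Hub
        o : Bool
        j : Fin p
        ends : (u ≡ inj₁ (hubAt τ o) × v ≡ inj₂ (τ , j)) ⊎ (v ≡ inj₁ (hubAt τ o) × u ≡ inj₂ (τ , j))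

    edge-of : ∀ u v → AdjV u v → EdgeOf u v
    edge-of (inj₁ h) (inj₂ (τ , j)) (inj₁ e) = edgeOf τ true j (inj₁ (cong inj₁ e , refl))
    edge-of (inj₁ h) (inj₂ (τ , j)) (inj₂ e) = edgeOf τ false j (inj₁ (cong inj₁ e , refl))
    edge-of (inj₂ (τ , j)) (inj₁ h) (inj₁ e) = edgeOf τ true j (inj₂ (cong inj₁ e , refl))
    edge-of (inj₂ (τ , j)) (inj₁ h) (inj₂ e) = edgeOf τ false j (inj₂ (cong inj₁ e , refl))

    rayOfEdge : ∀ {u v} → EdgeOf u v → Ray
    rayOfEdge (edgeOf τ o j _) = rayOf τ o j

    on-edge : ∀ {u v q} (e : EdgeOf u v) → OnPolyline q (place u ∷ [ place v ]) → OnRay (rayOfEdge e) q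
    on-edge {q = q} (edgeOf τ o j ends) = by ends
      where
      ρ = rayOf τ o j
      hub = place (inj₁ (hubAt τ o))
      mid = place (inj₂ (τ , j))
      segment : OnSegment q hub mid → OnRay ρ q
      segment on = onSegment⇒onRay ρ (width≥0 τ o j) (subst₂ (OnSegment q) (place-hub τ o j) (place-mid τ o j) on)
      by : ∀ {u v} → (u ≡ inj₁ (hubAt τ o) × v ≡ inj₂ (τ , j)) ⊎ (v ≡ inj₁ (hubAt τ o) × u ≡ inj₂ (τ , j)) →
        OnPolyline q (place u ∷ [ place v ]) → OnRay ρ q
      by (inj₁ (refl , refl)) (inj₁ on) = segment on
      by (inj₁ (refl , refl)) (inj₂ e) = subst (OnRay ρ) (trans (sym (place-mid τ o j)) (sym e)) (onRay-finish ρ (width≥0 τ o j))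
      by (inj₂ (refl , refl)) (inj₁ on) = segment (onSegment-swap {q} {mid} {hub} on)
      by (inj₂ (refl , refl)) (inj₂ e) = subst (OnRay ρ) (trans (sym (place-hub τ o j)) (sym e)) (onRay-start ρ (width≥0 τ o j))

    end-of-edge : ∀ {u v q} (e : EdgeOf u v) → EndOf (rayOfEdge e) q → q ≡ place u ⊎ q ≡ place v
    end-of-edge (edgeOf τ o j (inj₁ (refl , refl))) (at-start e) = inj₁ (trans e (sym (place-hub τ o j)))
    end-of-edge (edgeOf τ o j (inj₁ (refl , refl))) (at-finish e) = inj₂ (trans e (sym (place-mid τ o j)))
    end-of-edge (edgeOf τ o j (inj₂ (refl , refl))) (at-start e) = inj₂ (trans e (sym (place-hub τ o j)))
    end-of-edge (edgeOf τ o j (inj₂ (refl , refl))) (at-finish e) = inj₁ (trans e (sym (place-mid τ o j)))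

    same-edge? : ∀ (τ τ′ : Hub) (o o′ : Bool) (j j′ : Fin p) → (τ ≡ τ′ × o ≡ o′ × j ≡ j′) ⊎ (τ ≡ τ′ → o ≡ o′ → j ≢ j′)
    same-edge? τ τ′ o o′ j j′ with τ ≟ τ′ | o Bool.≟ o′ | j ≟ j′
    ... | yes a | yes b | yes c = inj₁ (a , b , c)
    ... | no ¬a | _ | _ = inj₂ (λ a _ _ → ¬a a)
    ... | yes _ | no ¬b | _ = inj₂ (λ _ b _ → ¬b b)
    ... | yes _ | yes _ | no ¬c = inj₂ (λ _ _ c → ¬c c)

    -- Every vertex is itself an end of some ray, so `apart-edges` applied to that ray shows that it
    -- is an end of e. For a hub the index j of the given edge serves to name such a ray.
    incident-only : ∀ {u v} (e : EdgeOf u v) w → OnRay (rayOfEdge e) (place w) → w ≡ u ⊎ w ≡ v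
    incident-only {u} {v} e@(edgeOf τ o j ends) w on = by w on
      where
      ended : ∀ {w} → EndOf (rayOfEdge e) (place w) → w ≡ u ⊎ w ≡ v
      ended {w} end = Sum.map (place-injective {w}) (place-injective {w}) (end-of-edge e end)
      by : ∀ w → OnRay (rayOfEdge e) (place w) → w ≡ u ⊎ w ≡ v
      by (inj₁ h) on with same-edge? τ h o true j j
      ... | inj₁ (refl , refl , _) = ended (at-start (place-hub h true j))
      ... | inj₂ distinct = ended (proj₁ (apart-edges τ o j h true j distinct on
        (subst (OnRay (rayOf h true j)) (sym (place-hub h true j)) (onRay-start (rayOf h true j) (width≥0 h true j)))))
      by (inj₂ (τ′ , j′)) on with same-edge? τ τ′ o true j j′
      ... | inj₁ (refl , refl , refl) = ended (at-finish (place-mid τ′ true j′))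
      ... | inj₂ distinct = ended (proj₁ (apart-edges τ o j τ′ true j′ distinct on
        (subst (OnRay (rayOf τ′ true j′)) (sym (place-mid τ′ true j′)) (onRay-finish (rayOf τ′ true j′) (width≥0 τ′ true j′)))))

    meet-at-end : ∀ {u v u′ v′} (e : EdgeOf u v) (e′ : EdgeOf u′ v′) → ¬ (u ≡ u′ × v ≡ v′) → ¬ (u ≡ v′ × v ≡ u′) →
      ∀ {q} → OnRay (rayOfEdge e) q → OnRay (rayOfEdge e′) q → q ≡ place u ⊎ q ≡ place v
    meet-at-end e@(edgeOf τ o j ends) (edgeOf τ′ o′ j′ ends′) ¬same ¬flipped on on′ with same-edge? τ τ′ o o′ j j′
    ... | inj₂ distinct = end-of-edge e (proj₁ (apart-edges τ o j τ′ o′ j′ distinct on on′))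
    ... | inj₁ (refl , refl , refl) with ends | ends′
    ... | inj₁ (refl , refl) | inj₁ (refl , refl) = contradiction (refl , refl) ¬same
    ... | inj₁ (refl , refl) | inj₂ (refl , refl) = contradiction (refl , refl) ¬flipped
    ... | inj₂ (refl , refl) | inj₁ (refl , refl) = contradiction (refl , refl) ¬flipped
    ... | inj₂ (refl , refl) | inj₂ (refl , refl) = contradiction (refl , refl) ¬same

    necklace-planar : Planar necklace
    necklace-planar = record
      { pos = λ v → place (decode v)
      ; pos-injective = λ {u} {v} e → decode-injective u v (place-injective {decode u} {decode v} e)
      ; bends = λ _ _ → []
      ; avoids-vertices = λ u v w q _ uv on e → Sum.map (decode-injective w u) (decode-injective w v)
          (incident-only (edge u v uv) (decode w) (subst (OnRay (rayOfEdge (edge u v uv))) e (on-edge (edge u v uv) on)))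
      ; no-crossings = λ u v u′ v′ q u<v uv u′<v′ u′v′ distinct on on′ → at-vertex {u} {v}
          (meet-at-end (edge u v uv) (edge u′ v′ u′v′)
            (λ (a , b) → distinct (cong₂ _,_ (decode-injective u u′ a) (decode-injective v v′ b)))
            (λ (a , b) → Fin.<-asym u<v (subst₂ Fin._<_ (sym (decode-injective v u′ b)) (sym (decode-injective u v′ a)) u′<v′))
            (on-edge (edge u v uv) on) (on-edge (edge u′ v′ u′v′) on′))
      }
      where
      edge : ∀ u v → Adj necklace u v → EdgeOf (decode u) (decode v)
      edge u v uv = edge-of (decode u) (decode v) (adj⇒ u v uv)
      at-vertex : ∀ {u v q} → q ≡ place (decode u) ⊎ q ≡ place (decode v) → ∃[ w ] q ≡ place (decode w)
      at-vertex {u} (inj₁ e) = u , e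
      at-vertex {v = v} (inj₂ e) = v , e

-- The parameters and the equivalence.

open import Defs
open UpperBound using (module PlanarC₄Free)
open Necklaces using (module Necklace)
open NecklaceDrawing using (module Drawing)
open import Data.Nat using (ℕ; suc; _+_; _*_; _⊔_; _≤_; z≤n; s≤s)
open import Data.Nat.Properties as ℕ using ()
open import Data.List as List using (List; _∷_)
open import Data.List.Relation.Unary.All using (All)
open import Data.List.Relation.Unary.Any using (here; there)
open import Data.List.Membership.Propositional using (_∈_)
open import Data.List.Membership.DecPropositional ℕ._≟_ using (_∈?_)
open import Data.Product using (_×_; ∃-syntax; _,_)
open import Relation.Nullary using (¬_; yes; no; contradiction)
open import Relation.Binary.PropositionalEquality using (_≡_; refl)
open import Data.Nat.Tactic.RingSolver using (solve-∀)

∈⇒≤max : ∀ {k} (S : List ℕ) → k ∈ S → k ≤ List.foldr _⊔_ 0 S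
∈⇒≤max (x ∷ S) (here refl) = ℕ.m≤m⊔n x _
∈⇒≤max (x ∷ S) (there k∈S) = ℕ.≤-trans (∈⇒≤max S k∈S) (ℕ.m≤n⊔m x _)

module _ (S : List ℕ) (C : ℕ) where

  private
    -- The number of hubs is 2 t + 1 with t > M, so every cycle of length other than 4 is longer
    -- than all elements of S; `r` unfolds to `2 * t`. A colouring with Δ + C ≤ 2 p + C colours
    -- would give (2 t + 1) p ≤ (2 p + C) t, that is p ≤ C t, which the choice of `p` just violates.
    M t r′ r p : ℕ
    M = List.foldr _⊔_ 0 S
    t = suc M
    r′ = M + (suc M + 0)
    r = suc r′
    p = suc (C * t)

  open Necklace r p using (necklace; short-cycles; max-degree; colours)

  necklace-avoids : ¬ (4 ∈ S) → NoCycleLengthIn S necklace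
  necklace-avoids 4∉S k k∈S cycle = contradiction (short-cycles k cycle (λ { refl → 4∉S k∈S }))
    (ℕ.<⇒≱ (s≤s (ℕ.≤-trans (∈⇒≤max S k∈S) (ℕ.≤-trans (ℕ.m≤m+n M _) (ℕ.n≤1+n r′)))))

  necklace-not-colourable : ¬ SquareColourable necklace (maxDegree necklace + C)
  necklace-not-colourable colouring = contradiction (ℕ.+-cancelˡ-≤ (p * 2 * t) p (C * t) (begin
    p * 2 * t + p                    ≡⟨ arith p t ⟩
    suc r * p                        ≤⟨ colours t (s≤s z≤n) refl colouring ⟩
    (maxDegree necklace + C) * t     ≤⟨ ℕ.*-monoˡ-≤ t (ℕ.+-monoˡ-≤ C (max-degree (s≤s z≤n))) ⟩
    (p * 2 + C) * t                  ≡⟨ ℕ.*-distribʳ-+ t (p * 2) C ⟩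
    p * 2 * t + C * t                ∎)) (ℕ.<⇒≱ ℕ.≤-refl)
    where
    open ℕ.≤-Reasoning
    arith : ∀ p t → p * 2 * t + p ≡ (1 + 2 * t) * p
    arith = solve-∀

mainTheorem1 : (S : List ℕ) → All (λ s → 1 ≤ s) S →
    ((∃[ C ] (∀ (n : ℕ) (G : Graph n) → Planar G → NoCycleLengthIn S G →
    SquareColourable G (maxDegree G + C))) → 4 ∈ S)
    × (4 ∈ S → ∃[ C ] (∀ (n : ℕ) (G : Graph n) → Planar G → NoCycleLengthIn S G →
    SquareColourable G (maxDegree G + C)))
mainTheorem1 S _ = necessary , sufficient
  where
  necessary : _ → 4 ∈ S
  necessary (C , bound) with 4 ∈? S
  ... | yes 4∈S = 4∈S
  ... | no 4∉S = contradiction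
    (bound _ _ (Drawing.necklace-planar _ _) (necklace-avoids S C 4∉S)) (necklace-not-colourable S C)
  sufficient : 4 ∈ S → _
  sufficient 4∈S = _ , λ n G planar noCycle →
    -- The least `M` above the average weight 29, with the `K` that it determines.
    PlanarC₄Free.square-colourable 30 (28 * (15 * 30)) ℕ.≤-refl refl G planar (noCycle 4 4∈S)
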